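{- For every constant $K\in\mathbb{N}$, the segmented TSP with $K$ segments on edge-weighted trees with polynomially bounded non-negative integer edge weights can be solved exactly in polynomial time; the running time is $n^{O(K)}$.
   Context: Edge-weighted tree metric: a tree with non-negative integer edge weights is given; the distance between two points is the total weight of the unique path between them in the tree. Weights are bounded by a fixed polynomial in the number $n$ of points. Segmented TSP with $K$ segments: an instance is a set $V$ of $n+1$ points of the metric space, one of which is the origin, together with numbers $l_1\leq l_2\leq\dots\leq l_K$ and $n_1\leq n_2\leq\dots\leq n_K$. A solution is a tour that starts and ends in the origin, has length at most $l_K$, and visits at least $n_h$ points of $V$ within the first $l_h$ distance along the tour, for all $h\in\{1,\dots,K\}$. An algorithm solves the problem if it always finds a solution whenever one exists. -}

module Defs where

open import Data.Fin using (Fin; toℕ; fromℕ) renaming (_≤_ to _≤ᶠ_)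
open import Data.Fin.Subset using (Subset; _∈_; _⊆_; ∣_∣)
open import Data.Fin.Subset.Properties using (_∈?_)
open import Data.List using (List; []; _∷_; _++_; [_]; map; filter; foldr; allFin; tabulate)
open import Data.List.Membership.Propositional using () renaming (_∈_ to _∈ˡ_)
open import Data.List.Relation.Unary.All using (All; []; _∷_; lookup)
open import Data.List.Relation.Unary.Unique.Propositional using (Unique)
open import Data.Nat using (ℕ; zero; suc; _+_; _*_; _∸_; _^_; _≤_; _≤?_)
open import Data.Nat.GeneralisedArithmetic using (fold)
open import Data.Product using (Σ-syntax; ∃-syntax; _×_; _,_; proj₁; proj₂)
open import Relation.Binary.Construct.Closure.ReflexiveTransitive using (Star; ε; _◅_)
open import Relation.Binary.PropositionalEquality using (_≡_; _≢_)
open import Relation.Nullary using (yes; no)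

------------------------------------------------------------------------
-- Edge-weighted trees and their metric

-- An undirected edge, listed once, with an arbitrary order of its ends:
-- (end , end , weight).
Edge : ℕ → Set
Edge m = Fin m × Fin m × ℕ

module _ {m : ℕ} (E : List (Edge m)) where

  data Link (u v : Fin m) : Set where
    forward  : ∀ {w} → (u , v , w) ∈ˡ E → Link u v
    backward : ∀ {w} → (v , u , w) ∈ˡ E → Link u v

  Walk : Fin m → Fin m → Set
  Walk = Star Link

module _ {m : ℕ} {E : List (Edge m)} where

  linkWeight : ∀ {u v} → Link E u v → ℕ
  linkWeight (forward  {w} _) = w
  linkWeight (backward {w} _) = w

  weight : ∀ {u v} → Walk E u v → ℕ
  weight ε       = 0
  weight (e ◅ p) = linkWeight e + weight p

  vertices : ∀ {u v} → Walk E u v → List (Fin m)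
  vertices {u} ε       = u ∷ []
  vertices {u} (e ◅ p) = u ∷ vertices p

  Simple : ∀ {u v} → Walk E u v → Set
  Simple p = Unique (vertices p)

-- Paths are compared as sequences of edges (positions in E), so parallel
-- edges violate `unique`.
record IsTree {m : ℕ} (E : List (Edge m)) : Set where
  field
    loopless : ∀ {u v w} → (u , v , w) ∈ˡ E → u ≢ v
    path     : ∀ u v → Walk E u v
    simple   : ∀ u v → Simple (path u v)
    unique   : ∀ {u v} (q : Walk E u v) → Simple q → q ≡ path u v

  dist : Fin m → Fin m → ℕ
  dist u v = weight (path u v)

------------------------------------------------------------------------
-- Segmented TSP

-- The index k stands for K = suc k segments; segment h is h : Fin (suc k).
-- The points of the metric space are the m vertices of the tree, of which
-- V may be any subset.
record Instance (k : ℕ) : Set where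
  field
    m        : ℕ
    E        : List (Edge m)
    isTree   : IsTree E
    V        : Subset m
    origin   : Fin m
    origin∈V : origin ∈ V
    n        : ℕ
    size     : ∣ V ∣ ≡ suc n
    len      : Fin (suc k) → ℕ
    len-mono : ∀ {g h} → g ≤ᶠ h → len g ≤ len h
    num      : Fin (suc k) → ℕ
    num-mono : ∀ {g h} → g ≤ᶠ h → num g ≤ num h

  open IsTree isTree public

  tourLength : List (Fin m) → ℕ
  tourLength (u ∷ v ∷ vs) = dist u v + tourLength (v ∷ vs)
  tourLength _            = 0

  -- The stops of a tour, each with the distance travelled on arrival, when
  -- the first stop is reached at distance t.
  arrivals : ℕ → List (Fin m) → List (Fin m × ℕ)
  arrivals t []           = []
  arrivals t (u ∷ [])     = (u , t) ∷ []
  arrivals t (u ∷ v ∷ vs) = (u , t) ∷ arrivals (t + dist u v) (v ∷ vs)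

  -- A tour lists every point it visits.  A vertex passed on the way between
  -- two consecutive stops can be made a stop without changing any distance.
  VisitedWithin : ℕ → List (Fin m) → Fin m → Set
  VisitedWithin d tour v = ∃[ t ] (v , t) ∈ˡ arrivals 0 tour × t ≤ d

  record IsSolution (tour : List (Fin m)) : Set where
    field
      closed : ∃[ stops ] tour ≡ origin ∷ stops ++ [ origin ]
      short  : tourLength tour ≤ len (fromℕ k)
      visits : ∀ h → Σ[ S ∈ Subset m ]
                 S ⊆ V × num h ≤ ∣ S ∣ ×
                 (∀ {v} → v ∈ S → VisitedWithin (len h) tour v)

-- Coefficients from the constant term upwards.
Polynomial : Set
Polynomial = List ℕ

evalPoly : Polynomial → ℕ → ℕ
evalPoly p x = foldr (λ a r → a + x * r) 0 p

WeightsBoundedBy : ∀ {k} → Polynomial → Instance k → Set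
WeightsBoundedBy p I = ∀ {u v w} → (u , v , w) ∈ˡ E → w ≤ evalPoly p n
  where open Instance I

------------------------------------------------------------------------
-- Algorithms and running time
--
-- Programs are terms of a first-order, call-by-value functional language;
-- the running time is the number of evaluation steps, as in the cost
-- semantics of Blelloch and Greiner (1995).  Each step is a bounded number
-- of operations of a unit-cost RAM with addition, truncated subtraction and
-- comparison of naturals (pairs and list cells being pointers to shared
-- immutable cells).  There is no unit-cost multiplication, so numbers grow by
-- at most one bit per step.  All loops are bounded: this makes evaluation a
-- total function, and only restricts the programs that may be used.

data Ty : Set where
  nat  : Ty
  _⊗_  : Ty → Ty → Ty
  list : Ty → Ty

infixr 6 _⊗_

⟦_⟧ : Ty → Set
⟦ nat ⟧    = ℕ
⟦ a ⊗ b ⟧  = ⟦ a ⟧ × ⟦ b ⟧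
⟦ list a ⟧ = List ⟦ a ⟧

Ctx : Set
Ctx = List Ty

Env : Ctx → Set
Env = All ⟦_⟧

data Tm (Γ : Ctx) : Ty → Set where
  var   : ∀ {a} → a ∈ˡ Γ → Tm Γ a
  let′  : ∀ {a b} → Tm Γ a → Tm (a ∷ Γ) b → Tm Γ b
  -- call of a closed one-argument procedure
  call  : ∀ {a b} → Tm (a ∷ []) b → Tm Γ a → Tm Γ b
  lit   : ℕ → Tm Γ nat
  add   : Tm Γ nat → Tm Γ nat → Tm Γ nat
  sub   : Tm Γ nat → Tm Γ nat → Tm Γ nat
  -- if≤ s t x y  is  x  when s ≤ t, and  y  otherwise
  if≤   : ∀ {a} → Tm Γ nat → Tm Γ nat → Tm Γ a → Tm Γ a → Tm Γ a
  pair  : ∀ {a b} → Tm Γ a → Tm Γ b → Tm Γ (a ⊗ b)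
  fst   : ∀ {a b} → Tm Γ (a ⊗ b) → Tm Γ a
  snd   : ∀ {a b} → Tm Γ (a ⊗ b) → Tm Γ b
  nil   : ∀ {a} → Tm Γ (list a)
  cons  : ∀ {a} → Tm Γ a → Tm Γ (list a) → Tm Γ (list a)
  caseL : ∀ {a b} → Tm Γ (list a) → Tm Γ b → Tm (a ∷ list a ∷ Γ) b → Tm Γ b
  -- right fold; the body sees the current element and the accumulator
  foldL : ∀ {a b} → Tm Γ (list a) → Tm Γ b → Tm (a ∷ b ∷ Γ) b → Tm Γ b
  -- loop t z s  runs the body s exactly t times on an accumulator
  loop  : ∀ {b} → Tm Γ nat → Tm Γ b → Tm (b ∷ Γ) b → Tm Γ b

eval : ∀ {Γ a} → Tm Γ a → Env Γ → ⟦ a ⟧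
eval (var x)       ρ = lookup ρ x
eval (let′ t u)    ρ = eval u (eval t ρ ∷ ρ)
eval (call f t)    ρ = eval f (eval t ρ ∷ [])
eval (lit i)       ρ = i
eval (add s t)     ρ = eval s ρ + eval t ρ
eval (sub s t)     ρ = eval s ρ ∸ eval t ρ
eval (if≤ s t x y) ρ with eval s ρ ≤? eval t ρ
... | yes _ = eval x ρ
... | no  _ = eval y ρ
eval (pair s t)    ρ = eval s ρ , eval t ρ
eval (fst t)       ρ = proj₁ (eval t ρ)
eval (snd t)       ρ = proj₂ (eval t ρ)
eval nil           ρ = []
eval (cons s t)    ρ = eval s ρ ∷ eval t ρ
eval (caseL t z s) ρ with eval t ρ
... | []     = eval z ρ
... | x ∷ xs = eval s (x ∷ xs ∷ ρ)
eval (foldL t z s) ρ = foldr (λ x r → eval s (x ∷ r ∷ ρ)) (eval z ρ) (eval t ρ)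
eval (loop t z s)  ρ = fold (eval z ρ) (λ r → eval s (r ∷ ρ)) (eval t ρ)

-- Steps of a fold or loop: one per iteration, plus the cost c of each run of
-- the body f.
foldSteps : ∀ {A B : Set} → (A → B → B) → (A → B → ℕ) → B → List A → ℕ
foldSteps f c z []       = 0
foldSteps f c z (x ∷ xs) = suc (c x (foldr f z xs) + foldSteps f c z xs)

loopSteps : ∀ {B : Set} → (B → B) → (B → ℕ) → B → ℕ → ℕ
loopSteps f c z zero    = 0
loopSteps f c z (suc i) = suc (c (fold z f i) + loopSteps f c z i)

steps : ∀ {Γ a} → Tm Γ a → Env Γ → ℕ
steps (var x)       ρ = 1
steps (let′ t u)    ρ = suc (steps t ρ + steps u (eval t ρ ∷ ρ))
steps (call f t)    ρ = suc (steps t ρ + steps f (eval t ρ ∷ []))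
steps (lit i)       ρ = 1
steps (add s t)     ρ = suc (steps s ρ + steps t ρ)
steps (sub s t)     ρ = suc (steps s ρ + steps t ρ)
steps (if≤ s t x y) ρ with eval s ρ ≤? eval t ρ
... | yes _ = suc (steps s ρ + steps t ρ + steps x ρ)
... | no  _ = suc (steps s ρ + steps t ρ + steps y ρ)
steps (pair s t)    ρ = suc (steps s ρ + steps t ρ)
steps (fst t)       ρ = suc (steps t ρ)
steps (snd t)       ρ = suc (steps t ρ)
steps nil           ρ = 1
steps (cons s t)    ρ = suc (steps s ρ + steps t ρ)
steps (caseL t z s) ρ with eval t ρ
... | []     = suc (steps t ρ + steps z ρ)
... | x ∷ xs = suc (steps t ρ + steps s (x ∷ xs ∷ ρ))
steps (foldL t z s) ρ =
  suc (steps t ρ + steps z ρ +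
       foldSteps (λ x r → eval s (x ∷ r ∷ ρ)) (λ x r → steps s (x ∷ r ∷ ρ))
                 (eval z ρ) (eval t ρ))
steps (loop t z s)  ρ =
  suc (steps t ρ + steps z ρ +
       loopSteps (λ r → eval s (r ∷ ρ)) (λ r → steps s (r ∷ ρ))
                 (eval z ρ) (eval t ρ))

------------------------------------------------------------------------
-- Solving segmented TSP

-- (m , edges , points of V , origin , segments (l_h , n_h) for h = 1 … K)
Input : Ty
Input = nat ⊗ list (nat ⊗ nat ⊗ nat) ⊗ list nat ⊗ nat ⊗ list (nat ⊗ nat)

encode : ∀ {k} → Instance k → ⟦ Input ⟧
encode I =
    m
  , map (λ (u , v , w) → toℕ u , toℕ v , w) E
  , map toℕ (filter (_∈? V) (allFin m))
  , toℕ origin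
  , tabulate (λ h → len h , num h)
  where open Instance I

-- The output is the list of the stops of the tour.
Program : Set
Program = Tm (Input ∷ []) (list nat)

output : ∀ {k} → Program → Instance k → List ℕ
output A I = eval A (encode I ∷ [])

time : ∀ {k} → Program → Instance k → ℕ
time A I = steps A (encode I ∷ [])

Solves : ∀ {k} → Program → Instance k → Set
Solves A I = (∃[ tour ] IsSolution tour) →
             ∃[ tour ] IsSolution tour × output A I ≡ map toℕ tour
  where open Instance I

-- The running time is measured in the number m of tree vertices, since the
-- tree is part of the input; m = n + 1 when V consists of all vertices.
RunsInTime : ∀ {k} → Program → (ℕ → ℕ) → Instance k → Set
RunsInTime A f I = time A I ≤ f (Instance.m I)

{-# OPTIONS --safe #-}
module Submission where

-- Cut a tour at the last stop reached by each time l_h: it becomes K walks from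
-- s_h to t_h, where s_1 = t_K is the origin and t_h = s_{h+1}, such that the
-- first h of them have total length at most l_h and visit n_h points.  The
-- inner t_h are found by trying all tuples of vertices.  For given terminals,
-- root the tree at the origin and contract its edges from the leaves upwards,
-- a child x into its parent p.  A shortest walk through given vertices crosses
-- the edge xp once if the edge separates its terminals, and otherwise twice or,
-- staying on the side of its terminals, not at all.  Hence what matters about
-- the restriction of the K walks to the block of vertices contracted into u
-- is, for each h, whether u is visited, the length, and the number of points
-- visited in the block by the first h walks.  There are m^O(K) such keys, and
-- it suffices to keep one realisation for each key that occurs.

open import Defs
open import Data.Bool using (Bool; true; false; T; _∧_)
open import Data.Empty using (⊥-elim)
open import Data.Fin using (Fin; zero; suc; toℕ; fromℕ; fromℕ<)
open import Data.Fin.Properties using (toℕ-injective; toℕ<n; toℕ-fromℕ<)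
open import Data.Fin.Subset using (Subset; _∈_; ∣_∣) renaming (_⊆_ to _⊆ˢ_)
open import Data.Fin.Subset.Properties using (_∈?_; ∣p∣≤n)
open import Data.List using (List; []; _∷_; _++_; foldr; length; map; tabulate; upTo; cartesianProduct; allFin; filter)
open import Data.List.Membership.Propositional using (_∉_) renaming (_∈_ to _∈ˡ_)
open import Data.List.Membership.Propositional.Properties using (∈-++⁺ˡ; ∈-++⁺ʳ; ∈-++⁻; ∈-map⁺; ∈-map⁻; ∈-∃++; ∈-cartesianProduct⁺; ∈-upTo⁺; ∈-length; ∈-allFin; ∈-filter⁺; ∈-filter⁻)
open import Data.List.Properties using (++-assoc; length-++; length-map; length-upTo; length-tabulate; map-++; length-filter)
open import Data.List.Relation.Unary.All using ([]; _∷_) renaming (lookup to All-lookup; tabulate to All-tabulate)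
open import Data.List.Relation.Unary.AllPairs using ([]; _∷_)
open import Data.List.Relation.Unary.Any using (here; there; index; any?)
open import Data.List.Relation.Unary.Unique.Propositional using (Unique)
open import Data.Nat using (ℕ; zero; suc; pred; _+_; _*_; _^_; _⊔_; _≤_; _<_; _≤?_; _≟_; z≤n; s≤s; NonZero; >-nonZero; >-nonZero⁻¹)
open import Data.Nat.GeneralisedArithmetic using (fold)
open import Data.Nat.ListAction using (sum)
open import Data.Nat.Properties hiding (_≟_)
open import Data.Nat.Tactic.RingSolver using (solve-∀)
open import Data.Product using (Σ-syntax; ∃-syntax; _×_; _,_; proj₁; proj₂)
open import Data.Sum using (_⊎_; inj₁; inj₂; [_,_]) renaming (map to map-⊎)
open import Data.Vec using ([]; _∷_) renaming (tabulate to tabulateᵛ; here to hereᵛ; there to thereᵛ)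
open import Data.Vec.Properties using (lookup⇒[]=; []=⇒lookup; lookup∘tabulate)
open import Data.List.Membership.DecPropositional _≟_ using () renaming (_∈?_ to _∈ˡ?_)
open import Function using (id; _∘_)
open import Relation.Binary.Construct.Closure.ReflexiveTransitive using (Star; ε; _◅_; _◅◅_)
open import Relation.Binary.PropositionalEquality hiding ([_])
open import Relation.Nullary using (¬_; yes; no; does; Dec; contradiction)

-- A segment may revisit points of earlier segments, so points cannot be counted per segment. A key
-- counts what the first `h` segments visit together: each vertex is judged once, when its
-- one-vertex block is set up, and counts add under contraction. Keeping one realisation per key is
-- justified by comparison: for any solution, every block has an entry with the same bits, no larger
-- costs and no smaller counts than the solution has there. Bits and terminals determine which
-- crossings of `xp` are unavoidable, so merging two such entries adds no more than the solution
-- itself pays for crossing, and at the root the entry meets all limits. Running time and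
-- correctness are proved in one program logic, because the lengths of loops follow from invariants
-- such as the distinctness of keys. With `N` the square of the number of possible entries up to
-- realisation, no loop is longer than `N`, and the nesting depth of the program is 5 for every `K`.
-- So the time is O(N ^ 5) for fixed `K`, and `N` is m ^ O(K).

-- A program logic for results and running time.

-- If no list folded over and no loop is longer than N, then t takes at most
-- coef t * N ^ depth t steps.

depth : ∀ {Γ a} → Tm Γ a → ℕ
depth (var x)       = 0
depth (let′ t u)    = depth t ⊔ depth u
depth (call f t)    = depth t ⊔ depth f
depth (lit i)       = 0
depth (add s t)     = depth s ⊔ depth t
depth (sub s t)     = depth s ⊔ depth t
depth (if≤ s t x y) = (depth s ⊔ depth t) ⊔ (depth x ⊔ depth y)
depth (pair s t)    = depth s ⊔ depth t
depth (fst t)       = depth t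
depth (snd t)       = depth t
depth nil           = 0
depth (cons s t)    = depth s ⊔ depth t
depth (caseL t z s) = depth t ⊔ (depth z ⊔ depth s)
depth (foldL t z s) = (depth t ⊔ depth z) ⊔ suc (depth s)
depth (loop t z s)  = (depth t ⊔ depth z) ⊔ suc (depth s)

coef : ∀ {Γ a} → Tm Γ a → ℕ
coef (var x)       = 1
coef (let′ t u)    = suc (coef t + coef u)
coef (call f t)    = suc (coef t + coef f)
coef (lit i)       = 1
coef (add s t)     = suc (coef s + coef t)
coef (sub s t)     = suc (coef s + coef t)
coef (if≤ s t x y) = suc ((coef s + coef t) + (coef x + coef y))
coef (pair s t)    = suc (coef s + coef t)
coef (fst t)       = suc (coef t)
coef (snd t)       = suc (coef t)
coef nil           = 1
coef (cons s t)    = suc (coef s + coef t)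
coef (caseL t z s) = suc (coef t + (coef z + coef s))
coef (foldL t z s) = suc ((coef t + coef z) + suc (coef s))
coef (loop t z s)  = suc ((coef t + coef z) + suc (coef s))

-- Singles out the terms whose cost bound needs no knowledge of the data and holds in every
-- environment.
flat : ∀ {Γ a} → Tm Γ a → Bool
flat (var x)       = true
flat (let′ t u)    = flat t ∧ flat u
flat (call f t)    = flat t ∧ flat f
flat (lit i)       = true
flat (add s t)     = flat s ∧ flat t
flat (sub s t)     = flat s ∧ flat t
flat (if≤ s t x y) = (flat s ∧ flat t) ∧ (flat x ∧ flat y)
flat (pair s t)    = flat s ∧ flat t
flat (fst t)       = flat t
flat (snd t)       = flat t
flat nil           = true
flat (cons s t)    = flat s ∧ flat t
flat (caseL t z s) = flat t ∧ (flat z ∧ flat s)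
flat (foldL t z s) = false
flat (loop t z s)  = false

∧-split : ∀ {a b} → T (a ∧ b) → T a × T b
∧-split {true} {true} _ = _ , _

module Logic (N : ℕ) (1≤N : 1 ≤ N) where

  instance
    N≢0 : NonZero N
    N≢0 = >-nonZero 1≤N

  bound : ℕ → ℕ → ℕ
  bound c d = c * N ^ d

  lift : ∀ {a} c {d e} → d ≤ e → a ≤ bound c d → a ≤ bound c e
  lift c d≤e h = ≤-trans h (*-monoʳ-≤ c (^-monoʳ-≤ N d≤e))

  plus : ∀ {a b} c c′ {e} → a ≤ bound c e → b ≤ bound c′ e → a + b ≤ bound (c + c′) e
  plus c c′ {e} h h′ =
    ≤-trans (+-mono-≤ h h′) (≤-reflexive (sym (*-distribʳ-+ (N ^ e) c c′)))

  tick : ∀ {a} c e → a ≤ bound c e → suc a ≤ bound (suc c) e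
  tick c e h = +-mono-≤ (>-nonZero⁻¹ (N ^ e) ⦃ m^n≢0 N e ⦄) h


  plus′ : ∀ {a b} c c′ d d′ → a ≤ bound c d → b ≤ bound c′ d′ → a + b ≤ bound (c + c′) (d ⊔ d′)
  plus′ c c′ d d′ h h′ = plus c c′ {d ⊔ d′} (lift c (m≤m⊔n d d′) h) (lift c′ (m≤n⊔m d d′) h′)

  seq : ∀ {a b} c c′ d d′ → a ≤ bound c d → b ≤ bound c′ d′ →
        suc (a + b) ≤ bound (suc (c + c′)) (d ⊔ d′)
  seq c c′ d d′ h h′ = tick (c + c′) (d ⊔ d′) (plus′ c c′ d d′ h h′)

  weakenˡ : ∀ {a} c c′ d d′ → a ≤ bound c d → a ≤ bound (c + c′) (d ⊔ d′)
  weakenˡ c c′ d d′ h = ≤-trans (m≤m+n _ 0) (plus′ c c′ d d′ h z≤n)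

  weakenʳ : ∀ {a} c c′ d d′ → a ≤ bound c′ d′ → a ≤ bound (c + c′) (d ⊔ d′)
  weakenʳ c c′ d d′ h = plus′ c c′ d d′ z≤n h

  -- The extra step of each iteration is absorbed into the coefficient, the number of iterations
  -- into the exponent. Hence the `suc` in both `coef` and `depth` of a fold or loop.
  iterate : ∀ n c d {a} → n ≤ N → a ≤ n * suc (bound c d) → a ≤ bound (suc c) (suc d)
  iterate n c d {a} n≤N h = begin
    a                         ≤⟨ h ⟩
    n * suc (bound c d)       ≤⟨ *-mono-≤ n≤N (tick c d ≤-refl) ⟩
    N * (suc c * N ^ d)       ≡⟨ sym (*-assoc N (suc c) _) ⟩
    N * suc c * N ^ d         ≡⟨ cong (_* N ^ d) (*-comm N (suc c)) ⟩
    suc c * N * N ^ d         ≡⟨ *-assoc (suc c) N _ ⟩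
    bound (suc c) (suc d)     ∎
    where open ≤-Reasoning

  Cheap : ∀ {Γ a} → Tm Γ a → Env Γ → Set
  Cheap t ρ = steps t ρ ≤ bound (coef t) (depth t)

  unit : 1 ≤ bound 1 0
  unit = ≤-refl

  cheap-if : ∀ {Γ a} (s t : Tm Γ nat) (x y : Tm Γ a) {ρ} → Cheap s ρ → Cheap t ρ →
             (eval s ρ ≤ eval t ρ → Cheap x ρ) → (eval t ρ < eval s ρ → Cheap y ρ) →
             Cheap (if≤ s t x y) ρ
  cheap-if s t x y {ρ} hs ht hx hy with eval s ρ ≤? eval t ρ
  ... | yes p = seq (coef s + coef t) (coef x + coef y) (depth s ⊔ depth t) (depth x ⊔ depth y)
                  (plus′ (coef s) (coef t) (depth s) (depth t) hs ht)
                  (weakenˡ (coef x) (coef y) (depth x) (depth y) (hx p))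
  ... | no p  = seq (coef s + coef t) (coef x + coef y) (depth s ⊔ depth t) (depth x ⊔ depth y)
                  (plus′ (coef s) (coef t) (depth s) (depth t) hs ht)
                  (weakenʳ (coef x) (coef y) (depth x) (depth y) (hy (≰⇒> p)))

  cheap-case : ∀ {Γ a b} (t : Tm Γ (list a)) (z : Tm Γ b) (s : Tm (a ∷ list a ∷ Γ) b) {ρ} →
               Cheap t ρ → (eval t ρ ≡ [] → Cheap z ρ) →
               (∀ x xs → eval t ρ ≡ x ∷ xs → Cheap s (x ∷ xs ∷ ρ)) →
               Cheap (caseL t z s) ρ
  cheap-case t z s {ρ} ht hz hs with eval t ρ
  ... | []     = seq (coef t) (coef z + coef s) (depth t) (depth z ⊔ depth s) ht
                   (weakenˡ (coef z) (coef s) (depth z) (depth s) (hz refl))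
  ... | x ∷ xs = seq (coef t) (coef z + coef s) (depth t) (depth z ⊔ depth s) ht
                   (weakenʳ (coef z) (coef s) (depth z) (depth s) (hs x xs refl))

  flat-cheap : ∀ {Γ a} (t : Tm Γ a) ρ → T (flat t) → Cheap t ρ
  flat-cheap (var x)       ρ h = unit
  flat-cheap (let′ t u)    ρ h = seq (coef t) (coef u) (depth t) (depth u)
    (flat-cheap t ρ (proj₁ (∧-split h))) (flat-cheap u _ (proj₂ (∧-split {flat t} h)))
  flat-cheap (call f t)    ρ h = seq (coef t) (coef f) (depth t) (depth f)
    (flat-cheap t ρ (proj₁ (∧-split h))) (flat-cheap f _ (proj₂ (∧-split {flat t} h)))
  flat-cheap (lit i)       ρ h = unit
  flat-cheap (add s t)     ρ h = seq (coef s) (coef t) (depth s) (depth t)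
    (flat-cheap s ρ (proj₁ (∧-split h))) (flat-cheap t _ (proj₂ (∧-split {flat s} h)))
  flat-cheap (sub s t)     ρ h = seq (coef s) (coef t) (depth s) (depth t)
    (flat-cheap s ρ (proj₁ (∧-split h))) (flat-cheap t _ (proj₂ (∧-split {flat s} h)))
  flat-cheap (if≤ s t x y) ρ h =
    let hst , hxy = ∧-split {flat s ∧ flat t} h
        hs , ht   = ∧-split {flat s} hst
        hx , hy   = ∧-split {flat x} hxy
    in cheap-if s t x y (flat-cheap s ρ hs) (flat-cheap t ρ ht)
         (λ _ → flat-cheap x ρ hx) (λ _ → flat-cheap y ρ hy)
  flat-cheap (pair s t)    ρ h = seq (coef s) (coef t) (depth s) (depth t)
    (flat-cheap s ρ (proj₁ (∧-split h))) (flat-cheap t _ (proj₂ (∧-split {flat s} h)))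
  flat-cheap (fst t)       ρ h = tick (coef t) (depth t) (flat-cheap t ρ h)
  flat-cheap (snd t)       ρ h = tick (coef t) (depth t) (flat-cheap t ρ h)
  flat-cheap nil           ρ h = unit
  flat-cheap (cons s t)    ρ h = seq (coef s) (coef t) (depth s) (depth t)
    (flat-cheap s ρ (proj₁ (∧-split h))) (flat-cheap t _ (proj₂ (∧-split {flat s} h)))
  flat-cheap (caseL t z s) ρ h =
    let ht , hzs = ∧-split {flat t} h
        hz , hs  = ∧-split {flat z} hzs
    in cheap-case t z s (flat-cheap t ρ ht) (λ _ → flat-cheap z ρ hz) (λ _ _ _ → flat-cheap s _ hs)

  -- Cost and result are treated together: the length of a list that is folded over is known only
  -- from the postconditions of the terms evaluated before.
  record WP {Γ : Ctx} {a : Ty} (t : Tm Γ a) (ρ : Env Γ) (Q : ⟦ a ⟧ → Set) : Set where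
    constructor wp
    field
      cheap : Cheap t ρ
      post  : Q (eval t ρ)
  open WP public

  wp-conseq : ∀ {Γ a} {t : Tm Γ a} {ρ Q Q′} → WP t ρ Q → (∀ v → Q v → Q′ v) → WP t ρ Q′
  wp-conseq (wp c q) h = wp c (h _ q)

  -- For a concrete flat term the anonymous argument reduces to the unit type and is filled in
  -- automatically.
  wp-flat : ∀ {Γ a} {t : Tm Γ a} {ρ Q} {_ : T (flat t)} → Q (eval t ρ) → WP t ρ Q
  wp-flat {t = t} {ρ} {_} {f} q = wp (flat-cheap t ρ f) q

  wp-let : ∀ {Γ a b} {t : Tm Γ a} {u : Tm (a ∷ Γ) b} {ρ Q} →
           WP t ρ (λ v → WP u (v ∷ ρ) Q) → WP (let′ t u) ρ Q
  wp-let {t = t} {u} (wp c (wp c′ q)) = wp (seq (coef t) (coef u) (depth t) (depth u) c c′) q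

  wp-call : ∀ {Γ a b} {f : Tm (a ∷ []) b} {t : Tm Γ a} {ρ Q} →
            WP t ρ (λ v → WP f (v ∷ []) Q) → WP (call f t) ρ Q
  wp-call {f = f} {t} (wp c (wp c′ q)) = wp (seq (coef t) (coef f) (depth t) (depth f) c c′) q

  wp-pair : ∀ {Γ a b} {s : Tm Γ a} {t : Tm Γ b} {ρ Q} →
            WP s ρ (λ v → WP t ρ (λ w → Q (v , w))) → WP (pair s t) ρ Q
  wp-pair {s = s} {t} (wp c (wp c′ q)) = wp (seq (coef s) (coef t) (depth s) (depth t) c c′) q

  wp-cons : ∀ {Γ a} {s : Tm Γ a} {t : Tm Γ (list a)} {ρ Q} →
            WP s ρ (λ v → WP t ρ (λ w → Q (v ∷ w))) → WP (cons s t) ρ Q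
  wp-cons {s = s} {t} (wp c (wp c′ q)) = wp (seq (coef s) (coef t) (depth s) (depth t) c c′) q

  wp-if : ∀ {Γ a} {s t : Tm Γ nat} {x y : Tm Γ a} {ρ Q} {_ : T (flat s)} {_ : T (flat t)} →
          (eval s ρ ≤ eval t ρ → WP x ρ Q) → (eval t ρ < eval s ρ → WP y ρ Q) →
          WP (if≤ s t x y) ρ Q
  wp-if {s = s} {t} {x} {y} {ρ} {Q} {fs} {ft} hx hy =
    wp (cheap-if s t x y (flat-cheap s ρ fs) (flat-cheap t ρ ft) (λ p → cheap (hx p)) (λ p → cheap (hy p)))
       q
    where
    q : Q (eval (if≤ s t x y) ρ)
    q with eval s ρ ≤? eval t ρ
    ... | yes p = post (hx p)
    ... | no p  = post (hy (≰⇒> p))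

  wp-case : ∀ {Γ a b} {t : Tm Γ (list a)} {z : Tm Γ b} {s : Tm (a ∷ list a ∷ Γ) b} {ρ Q} →
            WP t ρ (λ l → (l ≡ [] → WP z ρ Q) × (∀ x xs → l ≡ x ∷ xs → WP s (x ∷ xs ∷ ρ) Q)) →
            WP (caseL t z s) ρ Q
  wp-case {t = t} {z} {s} {ρ} {Q} (wp c (hz , hs)) =
    wp (cheap-case t z s c (λ e → cheap (hz e)) (λ x xs e → cheap (hs x xs e))) q
    where
    q : Q (eval (caseL t z s) ρ)
    q with eval t ρ
    ... | []     = post (hz refl)
    ... | x ∷ xs = post (hs x xs refl)

  -- The invariant I ys r relates the part ys of the list processed so far, a
  -- suffix, to the accumulator r.
  wp-fold : ∀ {Γ a b} {t : Tm Γ (list a)} {z : Tm Γ b} {s : Tm (a ∷ b ∷ Γ) b} {ρ Q}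
            (I : List ⟦ a ⟧ → ⟦ b ⟧ → Set) →
            WP t ρ (λ xs → length xs ≤ N × WP z ρ (I []) ×
              (∀ zs x ys r → zs ++ x ∷ ys ≡ xs → I ys r → WP s (x ∷ r ∷ ρ) (I (x ∷ ys))) ×
              (∀ r → I xs r → Q r)) →
            WP (foldL t z s) ρ Q
  wp-fold {a = a} {b} {t} {z} {s} {ρ} {Q} I (wp ct (len , wp cz iz , step , fin)) =
    wp (seq (coef t + coef z) (suc (coef s)) (depth t ⊔ depth z) (suc (depth s))
          (plus′ (coef t) (coef z) (depth t) (depth z) ct cz)
          (iterate _ (coef s) (depth s) len (proj₂ (go [] (eval t ρ) refl))))
       (fin _ (proj₁ (go [] (eval t ρ) refl)))
    where
    f : ⟦ a ⟧ → ⟦ b ⟧ → ⟦ b ⟧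
    f x r = eval s (x ∷ r ∷ ρ)
    -- The prefix `zs` is still unprocessed. It is carried along because the equation lets a body
    -- conclude that `x` belongs to the folded list and that `ys` is a suffix of it.
    go : ∀ zs ys → zs ++ ys ≡ eval t ρ →
         I ys (foldr f (eval z ρ) ys) ×
         foldSteps f (λ x r → steps s (x ∷ r ∷ ρ)) (eval z ρ) ys
           ≤ length ys * suc (bound (coef s) (depth s))
    go zs []       eq = iz , z≤n
    go zs (x ∷ ys) eq =
      let i , c = go (zs ++ x ∷ []) ys (trans (++-assoc zs (x ∷ []) ys) eq)
          w     = step zs x ys _ eq i
      in post w , s≤s (+-mono-≤ (cheap w) c)

  wp-loop : ∀ {Γ b} {t : Tm Γ nat} {z : Tm Γ b} {s : Tm (b ∷ Γ) b} {ρ Q}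
            (I : ℕ → ⟦ b ⟧ → Set) →
            WP t ρ (λ n → n ≤ N × WP z ρ (I 0) ×
              (∀ i r → I i r → WP s (r ∷ ρ) (I (suc i))) ×
              (∀ r → I n r → Q r)) →
            WP (loop t z s) ρ Q
  wp-loop {b = b} {t} {z} {s} {ρ} {Q} I (wp ct (len , wp cz iz , step , fin)) =
    wp (seq (coef t + coef z) (suc (coef s)) (depth t ⊔ depth z) (suc (depth s))
          (plus′ (coef t) (coef z) (depth t) (depth z) ct cz)
          (iterate _ (coef s) (depth s) len (proj₂ (go (eval t ρ)))))
       (fin _ (proj₁ (go (eval t ρ))))
    where
    f : ⟦ b ⟧ → ⟦ b ⟧
    f r = eval s (r ∷ ρ)
    go : ∀ n → I n (fold (eval z ρ) f n) ×
         loopSteps f (λ r → steps s (r ∷ ρ)) (eval z ρ) n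
           ≤ n * suc (bound (coef s) (depth s))
    go zero    = iz , z≤n
    go (suc n) =
      let i , c = go n
          w     = step n _ i
      in post w , s≤s (+-mono-≤ (cheap w) c)

-- The programs.

v0 : ∀ {Γ a} → Tm (a ∷ Γ) a
v0 = var (here refl)

v1 : ∀ {Γ a b} → Tm (b ∷ a ∷ Γ) a
v1 = var (there (here refl))

v2 : ∀ {Γ a b c} → Tm (c ∷ b ∷ a ∷ Γ) a
v2 = var (there (there (here refl)))

v3 : ∀ {Γ a b c d} → Tm (d ∷ c ∷ b ∷ a ∷ Γ) a
v3 = var (there (there (there (here refl))))

v4 : ∀ {Γ a b c d e} → Tm (e ∷ d ∷ c ∷ b ∷ a ∷ Γ) a
v4 = var (there (there (there (there (here refl)))))

v5 : ∀ {Γ a b c d e f} → Tm (f ∷ e ∷ d ∷ c ∷ b ∷ a ∷ Γ) a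
v5 = var (there (there (there (there (there (here refl))))))

v6 : ∀ {Γ a b c d e f g} → Tm (g ∷ f ∷ e ∷ d ∷ c ∷ b ∷ a ∷ Γ) a
v6 = var (there (there (there (there (there (there (here refl)))))))

ifEq : ∀ {Γ a} → Tm Γ nat → Tm Γ nat → Tm Γ a → Tm Γ a → Tm Γ a
ifEq s t x y = if≤ s t (if≤ t s x y) y

append : ∀ {a} → Tm (list a ⊗ list a ∷ []) (list a)
append = foldL (fst v0) (snd v0) (cons v0 v1)

infixr 5 _⊕_

_⊕_ : ∀ {Γ a} → Tm Γ (list a) → Tm Γ (list a) → Tm Γ (list a)
s ⊕ t = call append (pair s t)

single : ∀ {Γ a} → Tm Γ a → Tm Γ (list a)
single t = cons t nil

member : Tm (nat ⊗ list nat ∷ []) nat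
member = foldL (snd v0) (lit 0) (ifEq v0 (fst v2) (lit 1) v1)

Tup : ℕ → Ty → Ty
Tup zero    a = a
Tup (suc k) a = a ⊗ Tup k a

get : ∀ k {a} → ⟦ Tup k a ⟧ → Fin (suc k) → ⟦ a ⟧
get zero    v       zero    = v
get (suc k) (v , _) zero    = v
get (suc k) (_ , w) (suc h) = get k w h

EdgeT : Ty
EdgeT = nat ⊗ nat ⊗ nat

Growth : Ty
Growth = list nat ⊗ list EdgeT

-- An edge with exactly one end found so far is oriented as (child , parent , weight) and put at the
-- end of the list. As `foldL` works from the right, the contraction later meets the youngest leaf
-- first.
grow : Tm (EdgeT ⊗ Growth ∷ []) Growth
grow =
  let′ (call member (pair (fst (fst v0)) (fst (snd v0))))
  (let′ (call member (pair (fst (snd (fst v1))) (fst (snd v1))))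
  (if≤ v0 v1
    (if≤ v1 v0 (snd v2)
      (pair (cons (fst (snd (fst v2))) (fst (snd v2)))
            (snd (snd v2) ⊕ single (pair (fst (snd (fst v2))) (pair (fst (fst v2)) (snd (snd (fst v2))))))))
    (pair (cons (fst (fst v2)) (fst (snd v2)))
          (snd (snd v2) ⊕ single (fst v2)))))

-- `m` rounds over all edges suffice, since a simple path has at most `m` vertices.
growAll : Tm (nat ⊗ list EdgeT ⊗ nat ∷ []) Growth
growAll =
  loop (fst v0) (pair (single (snd (snd v0))) nil)
    (foldL (fst (snd v1)) v0 (call grow (pair v0 v1)))

tuples : ∀ k → Tm (list nat ∷ []) (list (Tup k nat))
tuples zero    = v0
tuples (suc k) =
  let′ (call (tuples k) v0)
    (foldL v1 nil (foldL v2 v1 (cons (pair v2 v0) v1)))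

-- (origin , start of the first segment , guess) ↦ terminals of the segments.  The
-- last component of the guess is ignored, as the last segment ends at the origin.
chain : ∀ k → Tm (nat ⊗ nat ⊗ Tup k nat ∷ []) (Tup k (nat ⊗ nat))
chain zero    = pair (fst (snd v0)) (fst v0)
chain (suc k) =
  pair (pair (fst (snd v0)) (fst (snd (snd v0))))
       (call (chain k) (pair (fst v0) (snd (snd v0))))

-- The pairs of zeros only make the procedure total: an encoded instance has exactly `suc k`
-- segments.
fromList : ∀ k → Tm (list (nat ⊗ nat) ∷ []) (Tup k (nat ⊗ nat))
fromList zero    = caseL v0 (pair (lit 0) (lit 0)) v0
fromList (suc k) =
  caseL v0 (pair (pair (lit 0) (lit 0)) (call (fromList k) nil))
           (pair v0 (call (fromList k) v1))

-- What one segment does in the block of the vertices contracted into u: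
-- ((bit , cost , count) , pre , post), where bit = 1 iff it visits u, cost is
-- its length, count the number of points visited by this segment and the
-- earlier ones, and pre ++ post its walk; if bit = 1, post begins with u.
Key Seg : Ty
Key = nat ⊗ nat ⊗ nat
Seg = Key ⊗ list nat ⊗ list nat

seg : ∀ {Γ} → Tm Γ nat → Tm Γ nat → Tm Γ nat → Tm Γ (list nat) → Tm Γ (list nat) → Tm Γ Seg
seg b c n xs ys = pair (pair b (pair c n)) (pair xs ys)

bitOf costOf countOf : ∀ {Γ} → Tm Γ Seg → Tm Γ nat
bitOf   s = fst (fst s)
costOf  s = fst (snd (fst s))
countOf s = snd (snd (fst s))

preOf postOf : ∀ {Γ} → Tm Γ Seg → Tm Γ (list nat)
preOf  s = fst (snd s)
postOf s = snd (snd s)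

Entry : ℕ → Ty
Entry k = nat ⊗ Tup k Seg

seg₁ seg₀ : ∀ {Γ a} → Tm Γ (nat ⊗ nat ⊗ nat ⊗ a) → Tm Γ Seg
seg₁ i = seg (lit 1) (lit 0) (fst (snd i)) nil (single (fst (snd (snd i))))
seg₀ i = seg (lit 0) (lit 0) (if≤ (lit 1) (fst i) (fst (snd i)) (lit 0)) nil nil

-- The argument is (1 iff an earlier segment visits `u` , 1 iff `u` is a point , `u` , terminals).
-- On a single vertex the only choice is which segments visit it, and this is forced at terminals.
-- After a visit the flag is 1 for all later segments.
initSegs : ∀ k → Tm (nat ⊗ nat ⊗ nat ⊗ Tup k (nat ⊗ nat) ∷ []) (list (Tup k Seg))
initSegs zero =
  ifEq (fst (snd (snd (snd v0)))) (fst (snd (snd v0))) (single (seg₁ v0))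
    (ifEq (snd (snd (snd (snd v0)))) (fst (snd (snd v0))) (single (seg₁ v0))
      (cons (seg₁ v0) (single (seg₀ v0))))
initSegs (suc k) =
  let′ (call (initSegs k) (pair (lit 1) (pair (fst (snd v0)) (pair (fst (snd (snd v0))) (snd (snd (snd (snd v0))))))))
  (let′ (foldL v0 nil (cons (pair (seg₁ v3) v0) v1))
  (ifEq (fst (fst (snd (snd (snd v2))))) (fst (snd (snd v2))) v0
    (ifEq (snd (fst (snd (snd (snd v2))))) (fst (snd (snd v2))) v0
      (let′ (call (initSegs k) (pair (fst v2) (pair (fst (snd v2)) (pair (fst (snd (snd v2))) (snd (snd (snd (snd v2))))))))
        (foldL v0 v1 (cons (pair (seg₀ v5) v0) v1))))))

initTable : ∀ k → Tm (list nat ⊗ list nat ⊗ Tup k (nat ⊗ nat) ∷ []) (list (Entry k))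
initTable k =
  foldL (fst (snd v0)) nil
    (let′ (call member (pair v0 (fst v2)))
      (foldL (call (initSegs k) (pair (lit 0) (pair v0 (pair v1 (snd (snd v3))))))
             v2
             (cons (pair v3 v0) v1)))

MergeIn : ℕ → Ty
MergeIn k = EdgeT ⊗ Tup k (nat ⊗ nat) ⊗ Tup k Seg ⊗ Tup k Seg

-- ((x , p , w) , current terminals , segment at p , segment at x) ↦ the segment
-- at p after the contraction, or no result if the two do not fit together.
mergeSeg : Tm (MergeIn 0 ∷ []) (list Seg)
mergeSeg =
  ifEq s x
    (ifEq t x
      (if≤ (lit 1) (bitOf P)
        (if≤ (lit 1) (bitOf X)
          (single (seg (bitOf P) (add c₀ (add w w)) n (preOf X ⊕ cons x (preOf P)) (postOf P ⊕ postOf X)))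
          nil)
        (single (seg (bitOf P) c₀ n (preOf X) (postOf X))))
      (if≤ (lit 1) (bitOf P)
        (if≤ (lit 1) (bitOf X)
          (single (seg (bitOf P) (add c₀ w) n ((preOf X ⊕ postOf X) ⊕ preOf P) (postOf P)))
          nil)
        nil))
    (ifEq t x
      (if≤ (lit 1) (bitOf P)
        (if≤ (lit 1) (bitOf X)
          (single (seg (bitOf P) (add c₀ w) n (preOf P) (postOf P ⊕ (preOf X ⊕ postOf X))))
          nil)
        nil)
      (if≤ (lit 1) (bitOf X)
        (if≤ (lit 1) (bitOf P)
          (single (seg (bitOf P) (add c₀ (add w w)) n (preOf P ⊕ cons p (preOf X ⊕ postOf X)) (postOf P)))
          nil)
        (single (seg (bitOf P) c₀ n (preOf P) (postOf P)))))
  where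
  x p w s t c₀ n : Tm (MergeIn 0 ∷ []) nat
  P X : Tm (MergeIn 0 ∷ []) Seg
  x = fst (fst v0)
  p = fst (snd (fst v0))
  w = snd (snd (fst v0))
  s = fst (fst (snd v0))
  t = snd (fst (snd v0))
  P = fst (snd (snd v0))
  X = snd (snd (snd v0))
  c₀ = add (costOf P) (costOf X)
  n  = add (countOf P) (countOf X)

merge : ∀ k → Tm (MergeIn k ∷ []) (list (Tup k Seg))
merge zero    = mergeSeg
merge (suc k) =
  caseL (call mergeSeg (pair (fst v0) (pair (fst (fst (snd v0)))
                         (pair (fst (fst (snd (snd v0)))) (fst (snd (snd (snd v0))))))))
    nil
    (caseL (call (merge k) (pair (fst v2) (pair (snd (fst (snd v2)))
                         (pair (snd (fst (snd (snd v2)))) (snd (snd (snd (snd v2))))))))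
      nil
      (single (pair v2 v0)))

contractOne : Tm (EdgeT ⊗ nat ∷ []) nat
contractOne = ifEq (snd v0) (fst (fst v0)) (fst (snd (fst v0))) (snd v0)

contractAll : ∀ k → Tm (EdgeT ⊗ Tup k (nat ⊗ nat) ∷ []) (Tup k (nat ⊗ nat))
contractAll zero    = pair (call contractOne (pair (fst v0) (fst (snd v0))))
                           (call contractOne (pair (fst v0) (snd (snd v0))))
contractAll (suc k) = pair (pair (call contractOne (pair (fst v0) (fst (fst (snd v0)))))
                                 (call contractOne (pair (fst v0) (snd (fst (snd v0))))))
                           (call (contractAll k) (pair (fst v0) (snd (snd v0))))

sameKey : Tm (Seg ⊗ Seg ∷ []) nat
sameKey =
  ifEq (bitOf (fst v0)) (bitOf (snd v0))
    (ifEq (costOf (fst v0)) (costOf (snd v0))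
      (ifEq (countOf (fst v0)) (countOf (snd v0)) (lit 1) (lit 0)) (lit 0)) (lit 0)

sameKeys : ∀ k → Tm (Tup k Seg ⊗ Tup k Seg ∷ []) nat
sameKeys zero    = sameKey
sameKeys (suc k) =
  let′ (call sameKey (pair (fst (fst v0)) (fst (snd v0))))
    (if≤ (lit 1) v0 (call (sameKeys k) (pair (snd (fst v1)) (snd (snd v1)))) (lit 0))

covered : ∀ k → Tm (Entry k ⊗ list (Entry k) ∷ []) nat
covered k =
  foldL (snd v0) (lit 0)
    (ifEq (fst v0) (fst (fst v2))
      (let′ (call (sameKeys k) (pair (snd v0) (snd (fst v2))))
        (if≤ (lit 1) v0 (lit 1) v2))
      v1)

dedupe : ∀ k → Tm (list (Entry k) ∷ []) (list (Entry k))
dedupe k =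
  foldL v0 nil
    (let′ (call (covered k) (pair v0 v1))
      (if≤ (lit 1) v0 v2 (cons v1 v2)))

State : ℕ → Ty
State k = list (Entry k) ⊗ Tup k (nat ⊗ nat)

candidates : ∀ k → Tm (EdgeT ⊗ State k ∷ []) (list (Entry k))
candidates k =
  foldL (fst (snd v0)) nil
    (ifEq (fst v0) (fst (fst v2)) v1
      (ifEq (fst v0) (fst (snd (fst v2)))
        (foldL (fst (snd v2)) v1
          (ifEq (fst v0) (fst (fst v4))
            (caseL (call (merge k) (pair (fst v4) (pair (snd (snd v4)) (pair (snd v2) (snd v0)))))
              v1
              (cons (pair (fst (snd (fst v6)))
                          v0)
                    v3))
            v1))
        (cons v0 v1)))

contractStep : ∀ k → Tm (EdgeT ⊗ State k ∷ []) (State k)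
contractStep k =
  pair (call (dedupe k) (call (candidates k) v0))
       (call (contractAll k) (pair (fst v0) (snd (snd v0))))

-- (cost so far , segments , limits)
assemble : ∀ k → Tm (nat ⊗ Tup k Seg ⊗ Tup k (nat ⊗ nat) ∷ []) (list (list nat))
assemble zero =
  if≤ (add (fst v0) (costOf (fst (snd v0)))) (fst (snd (snd v0)))
    (if≤ (snd (snd (snd v0))) (countOf (fst (snd v0)))
      (single (preOf (fst (snd v0)) ⊕ postOf (fst (snd v0))))
      nil)
    nil
assemble (suc k) =
  if≤ (add (fst v0) (costOf (fst (fst (snd v0))))) (fst (fst (snd (snd v0))))
    (if≤ (snd (fst (snd (snd v0)))) (countOf (fst (fst (snd v0))))
      (caseL (call (assemble k) (pair (add (fst v0) (costOf (fst (fst (snd v0)))))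
                                  (pair (snd (fst (snd v0))) (snd (snd (snd v0))))))
        nil
        (single ((preOf (fst (fst (snd v2))) ⊕ postOf (fst (fst (snd v2)))) ⊕ v0)))
      nil)
    nil

-- (R , vertices , V , root , limits , guess)
RunIn : ℕ → Ty
RunIn k = list EdgeT ⊗ list nat ⊗ list nat ⊗ nat ⊗ Tup k (nat ⊗ nat) ⊗ Tup k nat

run : ∀ k → Tm (RunIn k ∷ []) (list (list nat))
run k =
  let′ (call (chain k) (pair root (pair root (snd (snd (snd (snd (snd v0))))))))
  (let′ (call (initTable k) (pair (fst (snd (snd v1))) (pair (fst (snd v1)) v0)))
  (let′ (foldL (fst v2) (pair v0 v1) (call (contractStep k) (pair v0 v1)))
  (foldL (fst v0) nil
    (caseL (call (assemble k) (pair (lit 0) (pair (snd v0) (fst (snd (snd (snd (snd v5))))))))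
      v1
      (single v0)))))
  where
  root : Tm (RunIn k ∷ []) nat
  root = fst (snd (snd (snd v0)))

solver : ∀ k → Program
solver k =
  let′ (call growAll (pair (fst v0) (pair (fst (snd v0)) (fst (snd (snd (snd v0)))))))
  (let′ (call (fromList k) (snd (snd (snd (snd v1)))))
  (let′ (call (tuples k) (fst v1))
  (caseL
    (foldL v0 nil
      (caseL (call (run k) (pair (snd v4) (pair (fst v4) (pair (fst (snd (snd v5)))
               (pair (fst (snd (snd (snd v5)))) (pair v3 v0))))))
        v1
        (single v0)))
    nil
    (cons (fst (snd (snd (snd v5)))) (v0 ⊕ single (fst (snd (snd (snd v5)))))))))

-- Nesting depth.

-- Recursion on `k` lengthens the programs without nesting loops more deeply. So `k` enters the cost
-- through `coef` and `N` only, and the power of `N` stays fixed.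
merge-depth : ∀ k → depth (merge k) ≡ 1
merge-depth zero    = refl
merge-depth (suc k) rewrite merge-depth k = refl

tuples-depth : ∀ k → depth (tuples (suc k)) ≡ 2
tuples-depth zero = refl
tuples-depth (suc k) rewrite tuples-depth k = refl

chain-depth : ∀ k → depth (chain k) ≡ 0
chain-depth zero = refl
chain-depth (suc k) rewrite chain-depth k = refl

fromList-depth : ∀ k → depth (fromList k) ≡ 0
fromList-depth zero = refl
fromList-depth (suc k) rewrite fromList-depth k = refl

initSegs-depth : ∀ k → depth (initSegs (suc k)) ≡ 1
initSegs-depth zero = refl
initSegs-depth (suc k) rewrite initSegs-depth k = refl

contractAll-depth : ∀ k → depth (contractAll k) ≡ 0
contractAll-depth zero = refl
contractAll-depth (suc k) rewrite contractAll-depth k = refl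

sameKeys-depth : ∀ k → depth (sameKeys k) ≡ 0
sameKeys-depth zero = refl
sameKeys-depth (suc k) rewrite sameKeys-depth k = refl

assemble-depth : ∀ k → depth (assemble k) ≡ 1
assemble-depth zero = refl
assemble-depth (suc k) rewrite assemble-depth k = refl

-- The deepest nesting is: guesses, rooted edges, entries at `p`, entries at `x`, and the
-- concatenation of walks in `mergeSeg`.
solver-depth : ∀ k → depth (solver k) ≡ 5
solver-depth zero    = refl
solver-depth (suc k)
  rewrite merge-depth k | tuples-depth k | chain-depth k | fromList-depth k | initSegs-depth k
        | contractAll-depth k | sameKeys-depth k | assemble-depth k = refl

-- Walks with their vertices and lengths.

module Trails {A : Set} (L : A → A → ℕ → Set) where

  -- A path lists its vertices without the last one, a trail with it.
  data Path : A → List A → A → ℕ → Set where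
    []  : ∀ {a} → Path a [] a 0
    _∷_ : ∀ {a b z W w c} → L a b w → Path b W z c → Path a (a ∷ W) z (w + c)

  data Trail : A → List A → A → ℕ → Set where
    stop : ∀ {a} → Trail a (a ∷ []) a 0
    _∷_  : ∀ {a b z W w c} → L a b w → Trail b W z c → Trail a (a ∷ W) z (w + c)

  path-path : ∀ {a b z U W c d} → Path a U b c → Path b W z d → Path a (U ++ W) z (c + d)
  path-path []                q = q
  path-path (_∷_ {w = w} l p) q = subst (Path _ _ _) (sym (+-assoc w _ _)) (l ∷ path-path p q)

  path-trail : ∀ {a b z U W c d} → Path a U b c → Trail b W z d → Trail a (U ++ W) z (c + d)
  path-trail []                q = q
  path-trail (_∷_ {w = w} l p) q = subst (Trail _ _ _) (sym (+-assoc w _ _)) (l ∷ path-trail p q)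

  trail-link : ∀ {a b z W c w} → Trail a W z c → L z b w → Path a W b (c + w)
  trail-link {w = w} stop              l = subst (Path _ _ _) (+-identityʳ w) (l ∷ [])
  trail-link         (_∷_ {w = v} k p) l = subst (Path _ _ _) (sym (+-assoc v _ _)) (k ∷ trail-link p l)


  trail-first : ∀ {a z W c} → Trail a W z c → a ∈ˡ W
  trail-first stop    = here refl
  trail-first (_ ∷ _) = here refl

  trail-last : ∀ {a z W c} → Trail a W z c → z ∈ˡ W
  trail-last stop    = here refl
  trail-last (_ ∷ p) = there (trail-last p)

-- Contraction of rooted edges

E3 : Set
E3 = ⟦ EdgeT ⟧

children : List E3 → List ℕ
children = map proj₁

contract : ℕ → ℕ → ℕ → ℕ
contract x p r with r ≟ x
... | yes _ = p
... | no  _ = r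

contract-≡ : ∀ {x p r} → r ≡ x → contract x p r ≡ p
contract-≡ {x} {p} {r} e with r ≟ x
... | yes _ = refl
... | no ne = contradiction e ne

contract-≢ : ∀ {x p r} → r ≢ x → contract x p r ≡ r
contract-≢ {x} {p} {r} ne with r ≟ x
... | yes e = contradiction e ne
... | no _  = refl

-- `Q` lists the contracted edges, the latest one first, and is always a suffix of the rooted tree.
-- The value is the vertex into whose block `y` has been contracted.
rep : List E3 → ℕ → ℕ
rep []                y = y
rep ((x , p , _) ∷ Q) y = contract x p (rep Q y)

-- The order from the leaves upwards: when `x` is contracted into `p`, neither has been contracted
-- before. For the edges in front of (x , p , w) the same condition says that `x` is not an end of
-- any of them.
data Valid : List E3 → Set where
  []  : Valid []
  _∷_ : ∀ {x p w Q} → x ∉ children Q × p ≢ x × p ∉ children Q → Valid Q → Valid ((x , p , w) ∷ Q)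

valid-suffix : ∀ zs {Q} → Valid (zs ++ Q) → Valid Q
valid-suffix []       v       = v
valid-suffix (_ ∷ zs) (_ ∷ v) = valid-suffix zs v

children-suffix : ∀ zs {Q y} → y ∈ˡ children Q → y ∈ˡ children (zs ++ Q)
children-suffix []       h = h
children-suffix (_ ∷ zs) h = there (children-suffix zs h)

valid-prefix : ∀ zs {Q x p w} → Valid (zs ++ Q) → (x , p , w) ∈ˡ zs → x ∉ children Q × p ∉ children Q
valid-prefix (_ ∷ zs) ((a , _ , b) ∷ v) (here refl) =
  (λ h → a (children-suffix zs h)) , (λ h → b (children-suffix zs h))
valid-prefix (_ ∷ zs) (_ ∷ v) (there h) = valid-prefix zs v h

rep-fix : ∀ Q {y} → y ∉ children Q → rep Q y ≡ y
rep-fix []                h = refl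
rep-fix ((x , p , w) ∷ Q) h =
  trans (contract-≢ (λ e → h (here (trans (sym (rep-fix Q (h ∘ there))) e)))) (rep-fix Q (h ∘ there))

rep-avoids : ∀ {Q} y → Valid Q → rep Q y ∉ children Q
rep-avoids y [] ()
rep-avoids {(x , p , _) ∷ Q} y ((a , b , c) ∷ v) h with rep Q y ≟ x
rep-avoids {(x , p , _) ∷ Q} y ((a , b , c) ∷ v) (here e)  | yes _ = b e
rep-avoids {(x , p , _) ∷ Q} y ((a , b , c) ∷ v) (there h) | yes _ = c h
rep-avoids {(x , p , _) ∷ Q} y (_ ∷ v) (here e)  | no ne = ne e
rep-avoids {(x , p , _) ∷ Q} y (_ ∷ v) (there h) | no ne = rep-avoids y v h

rep-edge : ∀ {Q x p w} → Valid Q → (x , p , w) ∈ˡ Q → rep Q x ≡ rep Q p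
rep-edge {_ ∷ Q} ((a , b , c) ∷ v) (here refl) =
  trans (contract-≡ (rep-fix Q a))
        (sym (trans (contract-≢ (λ e → b (trans (sym (rep-fix Q c)) e))) (rep-fix Q c)))
rep-edge {(x , p , _) ∷ Q} (_ ∷ v) (there h) = cong (contract x p) (rep-edge v h)

data Link³ (R : List E3) (a b w : ℕ) : Set where
  up   : (a , b , w) ∈ˡ R → Link³ R a b w
  down : (b , a , w) ∈ˡ R → Link³ R a b w

-- How a link meets the cut between the block of x and that of its parent p
-- at the time when x is contracted.
data CutView (Q : List E3) (x p w : ℕ) (a b w′ : ℕ) : Set where
  inner : rep Q a ≡ rep Q b → CutView Q x p w a b w′
  outer : rep Q a ≢ x → rep Q b ≢ x → CutView Q x p w a b w′
  rise  : a ≡ x → b ≡ p → w′ ≡ w → CutView Q x p w a b w′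
  fall  : a ≡ p → b ≡ x → w′ ≡ w → CutView Q x p w a b w′

-- The ends of an edge in `Q` already share a block; those of an edge in `zs` are uncontracted and
-- differ from `x`. So `xp` alone joins the block of `x` to the rest.
cutView : ∀ zs {x p w Q a b w′} → Valid (zs ++ (x , p , w) ∷ Q) →
          Link³ (zs ++ (x , p , w) ∷ Q) a b w′ → CutView Q x p w a b w′
cutView zs {x} {p} {w} {Q} {a} {b} {w′} v l = go l
  where
  away : ∀ {y} → y ∉ x ∷ children Q → rep Q y ≢ x
  away h e = h (here (trans (sym (rep-fix Q (h ∘ there))) e))
  entry : ∀ {a b w′} → (a , b , w′) ∈ˡ zs ++ (x , p , w) ∷ Q →
          (rep Q a ≡ rep Q b) ⊎ (rep Q a ≢ x × rep Q b ≢ x) ⊎ (a ≡ x × b ≡ p × w′ ≡ w)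
  entry h with ∈-++⁻ zs h
  ... | inj₁ h′ = let ha , hb = valid-prefix zs v h′ in inj₂ (inj₁ (away ha , away hb))
  ... | inj₂ (here refl) = inj₂ (inj₂ (refl , refl , refl))
  ... | inj₂ (there h′) with valid-suffix zs v
  ...   | _ ∷ vQ = inj₁ (rep-edge vQ h′)
  go : Link³ (zs ++ (x , p , w) ∷ Q) a b w′ → CutView Q x p w a b w′
  go (up h) with entry h
  ... | inj₁ e                    = inner e
  ... | inj₂ (inj₁ (o , o′))      = outer o o′
  ... | inj₂ (inj₂ (e , e′ , e″)) = rise e e′ e″
  go (down h) with entry h
  ... | inj₁ e                    = inner (sym e)
  ... | inj₂ (inj₁ (o , o′))      = outer o′ o
  ... | inj₂ (inj₂ (e , e′ , e″)) = fall e′ e e″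

-- Weights of the parts of a trail

when : ∀ {P : Set} → Dec P → ℕ → ℕ
when (yes _) w = w
when (no _)  w = 0

both : ℕ → ℕ → ℕ → ℕ → ℕ
both u a b w with a ≟ u | b ≟ u
... | yes _ | yes _ = w
... | _     | _     = 0

cut : ℕ → ℕ → ℕ → ℕ → ℕ
cut x a b w with a ≟ x | b ≟ x
... | yes _ | no _  = w
... | no _  | yes _ = w
... | _     | _     = 0

both-≤ : ∀ u a b w → both u a b w ≤ w
both-≤ u a b w with a ≟ u | b ≟ u
... | yes _ | yes _ = ≤-refl
... | yes _ | no _  = z≤n
... | no _  | _     = z≤n

both-yes : ∀ {u a b w} → a ≡ u → b ≡ u → both u a b w ≡ w
both-yes {u} {a} {b} e e′ with a ≟ u | b ≟ u
... | yes _ | yes _ = refl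
... | no n  | _     = contradiction e n
... | yes _ | no n  = contradiction e′ n

cut-≢ : ∀ {x a b w} → a ≢ x → b ≢ x → cut x a b w ≡ 0
cut-≢ {x} {a} {b} n n′ with a ≟ x | b ≟ x
... | no _  | no _  = refl
... | yes e | _     = contradiction e n
... | no _  | yes e = contradiction e n′

cut-≡ : ∀ {x a b w} → a ≡ b → cut x a b w ≡ 0
cut-≡ {x} {a} refl with a ≟ x
... | no _  = refl
... | yes e = refl

cut-rise : ∀ {x a b w} → a ≡ x → b ≢ x → cut x a b w ≡ w
cut-rise {x} {a} {b} e n with a ≟ x | b ≟ x
... | yes _ | no _  = refl
... | no n′ | _     = contradiction e n′
... | yes _ | yes e′ = contradiction e′ n

cut-fall : ∀ {x a b w} → a ≢ x → b ≡ x → cut x a b w ≡ w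
cut-fall {x} {a} {b} n e with a ≟ x | b ≟ x
... | no _  | yes _ = refl
... | yes e′ | _    = contradiction e′ n
... | no _ | no n′  = contradiction e n′

both-no : ∀ {u a b w} → a ≢ u ⊎ b ≢ u → both u a b w ≡ 0
both-no {u} {a} {b} h with a ≟ u | b ≟ u
... | yes e | yes e′ = ⊥-elim ([ (λ n → n e) , (λ n → n e′) ] h)
... | yes _ | no _   = refl
... | no _  | _      = refl

eqs : ∀ {A B C D a b c d : ℕ} → A ≡ a → B ≡ b → C ≡ c → D ≡ d → a + b + c ≤ d → A + B + C ≤ D
eqs refl refl refl refl h = h

-- At most one term on the left is nonzero: a link lies in the block of `p`, in that of `x`, or
-- across the cut, the last only along `xp`. In each case it lies inside the merged block.
split-link : ∀ {x p} a b w → p ≢ x →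
             (a ≡ b) ⊎ (a ≢ x × b ≢ x) ⊎ ((a ≡ x × b ≡ p) ⊎ (a ≡ p × b ≡ x)) →
             both p a b w + both x a b w + cut x a b w ≤ both p (contract x p a) (contract x p b) w
split-link {x} {p} a b w p≢x (inj₁ refl) = same (a ≟ x)
  where
  same : Dec (a ≡ x) → both p a a w + both x a a w + cut x a a w ≤ both p (contract x p a) (contract x p a) w
  same (yes refl) = eqs (both-no (inj₁ (p≢x ∘ sym))) refl (cut-≡ {x} {x} refl)
    (both-yes (contract-≡ {x} {p} {x} refl) (contract-≡ {x} {p} {x} refl))
    (≤-trans (≤-reflexive (+-identityʳ _)) (both-≤ x x x w))
  same (no n) = eqs refl (both-no {x} (inj₁ n)) (cut-≡ {x} {a} refl)
    (cong (λ a → both p a a w) (contract-≢ n))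
    (≤-reflexive (trans (+-identityʳ _) (+-identityʳ _)))
split-link {x} {p} a b w p≢x (inj₂ (inj₁ (n , n′))) =
  eqs refl (both-no {x} (inj₁ n)) (cut-≢ n n′) (cong₂ (λ a b → both p a b w) (contract-≢ n) (contract-≢ n′))
      (≤-reflexive (trans (+-identityʳ _) (+-identityʳ _)))
split-link {x} {p} a b w p≢x (inj₂ (inj₂ (inj₁ (refl , refl)))) =
  eqs (both-no (inj₁ (p≢x ∘ sym))) (both-no {x} {x} {p} (inj₂ p≢x)) (cut-rise refl p≢x)
      (both-yes {p} (contract-≡ {x} {p} {x} refl) (contract-≢ p≢x)) ≤-refl
split-link {x} {p} a b w p≢x (inj₂ (inj₂ (inj₂ (refl , refl)))) =
  eqs (both-no {p} {p} {x} (inj₂ (p≢x ∘ sym))) (both-no {x} {p} {x} (inj₁ p≢x)) (cut-fall p≢x refl)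
      (both-yes {p} (contract-≢ p≢x) (contract-≡ {x} {p} {x} refl)) ≤-refl

module _ {R : List E3} where
  open Trails (Link³ R)

  inside : List E3 → ℕ → ∀ {a W z c} → Trail a W z c → ℕ
  inside Q u stop = 0
  inside Q u (_∷_ {a = a} {b = b} {w = w} l t) = both u (rep Q a) (rep Q b) w + inside Q u t

  crossing : List E3 → ℕ → ∀ {a W z c} → Trail a W z c → ℕ
  crossing Q x stop = 0
  crossing Q x (_∷_ {a = a} {b = b} {w = w} l t) = cut x (rep Q a) (rep Q b) w + crossing Q x t

  inside-≤ : ∀ Q u {a W z c} (t : Trail a W z c) → inside Q u t ≤ c
  inside-≤ Q u stop    = z≤n
  inside-≤ Q u (l ∷ t) = +-mono-≤ (both-≤ u _ _ _) (inside-≤ Q u t)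

  module Cut (zs : List E3) (x p w : ℕ) (Q : List E3)
             (R≡ : zs ++ (x , p , w) ∷ Q ≡ R) (v : Valid R) where

    view : ∀ {a b w′} → Link³ R a b w′ → CutView Q x p w a b w′
    view rewrite sym R≡ = cutView zs v

    private
      v′ : Valid ((x , p , w) ∷ Q)
      v′ = valid-suffix zs (subst Valid (sym R≡) v)

    parent≢ : p ≢ x
    parent≢ with v′
    ... | (_ , n , _) ∷ _ = n

    rep-x : rep Q x ≡ x
    rep-x with v′
    ... | (n , _ , _) ∷ _ = rep-fix Q n

    rep-p : rep Q p ≡ p
    rep-p with v′
    ... | (_ , _ , n) ∷ _ = rep-fix Q n

    -- This is where a compared trail pays for crossings: the inside weights of the two blocks and
    -- the crossing weight together fit into the inside weight of the merged block.
    inside-split : ∀ {a W z c} (t : Trail a W z c) →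
                   inside Q p t + inside Q x t + crossing Q x t ≤ inside ((x , p , w) ∷ Q) p t
    inside-split stop = z≤n
    inside-split (_∷_ {a = a} {b = b} {w = w′} l t) = begin
      (A + iP) + (B + iX) + (C + iC) ≡⟨ shuffle A iP B iX C iC ⟩
      (A + B + C) + (iP + iX + iC)   ≤⟨ +-mono-≤ (split-link (rep Q a) (rep Q b) w′ parent≢ (cases (view l))) (inside-split t) ⟩
      both p (rep ((x , p , w) ∷ Q) a) (rep ((x , p , w) ∷ Q) b) w′ + inside ((x , p , w) ∷ Q) p t ∎
      where
      open ≤-Reasoning
      A B C iP iX iC : ℕ
      A = both p (rep Q a) (rep Q b) w′
      B = both x (rep Q a) (rep Q b) w′
      C = cut x (rep Q a) (rep Q b) w′
      iP = inside Q p t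
      iX = inside Q x t
      iC = crossing Q x t
      shuffle : ∀ a b c d e f → (a + b) + (c + d) + (e + f) ≡ (a + c + e) + (b + d + f)
      shuffle = solve-∀
      cases : CutView Q x p w a b w′ →
              (rep Q a ≡ rep Q b) ⊎ (rep Q a ≢ x × rep Q b ≢ x) ⊎
              ((rep Q a ≡ x × rep Q b ≡ p) ⊎ (rep Q a ≡ p × rep Q b ≡ x))
      cases (inner e)          = inj₁ e
      cases (outer n n′)       = inj₂ (inj₁ (n , n′))
      cases (rise refl refl _) = inj₂ (inj₂ (inj₁ (rep-x , rep-p)))
      cases (fall refl refl _) = inj₂ (inj₂ (inj₂ (rep-p , rep-x)))

    Below : ℕ → Set
    Below y = rep Q y ≡ x

    Crosses : ℕ → ∀ {a W z c} → Trail a W z c → Set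
    Crosses d {W = W} t = d ≤ crossing Q x t × x ∈ˡ W × p ∈ˡ W

    private
      later : ∀ {d a b z W c w′} (l : Link³ R a b w′) (t : Trail b W z c) → Crosses d t → Crosses d (l ∷ t)
      later l t (h , i , j) = ≤-trans h (m≤n+m _ _) , there i , there j

      p≢x′ : rep Q p ≢ x
      p≢x′ e = parent≢ (trans (sym rep-p) e)

    -- By `view`, the block of `x` is left and entered only along the edge between `x` and `p`, so
    -- the trail pays `w` and visits both ends.
    leave : ∀ {a W z c} (t : Trail a W z c) → Below a → ¬ Below z → Crosses w t
    enter : ∀ {a W z c} (t : Trail a W z c) → ¬ Below a → Below z → Crosses w t

    leave stop    ba nz = contradiction ba nz
    leave (l ∷ t) ba nz with view l
    ... | inner e            = later l t (leave t (trans (sym e) ba) nz)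
    ... | outer n _          = contradiction ba n
    ... | rise refl refl refl =
      ≤-trans (≤-reflexive (sym (cut-rise rep-x p≢x′))) (m≤m+n _ _) , here refl , there (trail-first t)
    ... | fall refl refl _   = contradiction ba p≢x′

    enter stop    na bz = contradiction bz na
    enter (l ∷ t) na bz with view l
    ... | inner e            = later l t (enter t (λ b → na (trans e b)) bz)
    ... | outer _ n          = later l t (enter t n bz)
    ... | rise refl refl _   = contradiction rep-x na
    ... | fall refl refl refl =
      ≤-trans (≤-reflexive (sym (cut-fall p≢x′ rep-x))) (m≤m+n _ _) , there (trail-first t) , here refl

    -- A visit outside forces a climb to `p`; from there `enter` supplies the way back, so `w` is
    -- paid twice.
    leave-return : ∀ {a W z c y} (t : Trail a W z c) → Below a → Below z → y ∈ˡ W → ¬ Below y →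
                   Crosses (w + w) t
    leave-return stop    ba bz (here refl) ny = contradiction ba ny
    leave-return (l ∷ t) ba bz (here refl) ny = contradiction ba ny
    leave-return (l ∷ t) ba bz (there h)   ny with view l
    ... | inner e            = later l t (leave-return t (trans (sym e) ba) bz h ny)
    ... | outer n _          = contradiction ba n
    ... | rise refl refl refl =
      +-mono-≤ (≤-reflexive (sym (cut-rise rep-x p≢x′))) (proj₁ (enter t p≢x′ bz)) ,
      here refl , there (trail-first t)
    ... | fall refl refl _   = contradiction ba p≢x′

    enter-return : ∀ {a W z c y} (t : Trail a W z c) → ¬ Below a → ¬ Below z → y ∈ˡ W → Below y →
                   Crosses (w + w) t
    enter-return stop    na nz (here refl) by = contradiction by na
    enter-return (l ∷ t) na nz (here refl) by = contradiction by na
    enter-return (l ∷ t) na nz (there h)   by with view l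
    ... | inner e            = later l t (enter-return t (λ b → na (trans e b)) nz h by)
    ... | outer _ n          = later l t (enter-return t n nz h by)
    ... | rise refl refl _   = contradiction rep-x na
    ... | fall refl refl refl =
      +-mono-≤ (≤-reflexive (sym (cut-fall p≢x′ rep-x))) (proj₁ (leave t rep-x nz)) ,
      there (trail-first t) , here refl

-- Segments in a block and their combination at a contracted edge.

bit cost count size : ⟦ Seg ⟧ → ℕ
bit   y = proj₁ (proj₁ y)
cost  y = proj₁ (proj₂ (proj₁ y))
count y = proj₂ (proj₂ (proj₁ y))
size  (_ , pre , post) = length pre + length post

route : ⟦ Seg ⟧ → List ℕ
route (_ , pre , post) = pre ++ post

-- What a trail with these bits must satisfy at the cut if `D` is the weight it spends on crossing.
-- It links the lower bounds on trails to the cases of `mergeSeg`: in each, either the extra cost is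
-- at most `D` or the bits contradict a demand.
record Demand (rs rt x bp bx w D : ℕ) : Set where
  field
    neither : rs ≢ x → rt ≢ x → bx ≡ 1 → bp ≡ 1 × w + w ≤ D
    starts  : rs ≡ x → rt ≢ x → bp ≡ 1 × bx ≡ 1 × w ≤ D
    ends    : rs ≢ x → rt ≡ x → bp ≡ 1 × bx ≡ 1 × w ≤ D
    closed  : rs ≡ x → rt ≡ x → bp ≡ 1 → bx ≡ 1 × w + w ≤ D

module Segments (R : List E3) where
  open Trails (Link³ R)

  -- The terminal s, currently contracted to r, as seen from the block of u:
  -- outside the block, u takes its place.
  data Seen (r s u : ℕ) : ℕ → Set where
    in-block  : r ≡ u → Seen r s u s
    off-block : r ≢ u → Seen r s u u

  -- A segment that misses `u` cannot pass between the block and the rest of the tree: it lies in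
  -- the block with both terminals (`complete`) or has nothing there (`absent`). One that visits `u`
  -- is cut at `u`, so that a detour out of the block can be spliced in there.
  data Good (rs rt s t u : ℕ) : ⟦ Seg ⟧ → Set where
    through  : ∀ {a z c c₁ c₂ n pre post} → Seen rs s u a → Seen rt t u z →
               Path a pre u c₁ → Trail u post z c₂ → c ≡ c₁ + c₂ →
               Good rs rt s t u ((1 , c , n) , pre , post)
    complete : ∀ {c n pre post} → rs ≡ u → rt ≡ u → Trail s (pre ++ post) t c →
               Good rs rt s t u ((0 , c , n) , pre , post)
    absent   : ∀ {c n pre post} → rs ≢ u → rt ≢ u → pre ≡ [] → post ≡ [] → c ≡ 0 →
               Good rs rt s t u ((0 , c , n) , pre , post)

  -- `good`, `fromP` and `fromX` serve soundness, `thrifty` serves completeness, and `cost≤` and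
  -- `size≤` keep keys and walks within the bounds on the loops.
  record Merged (x p w rs rt s t : ℕ) (P X y : ⟦ Seg ⟧) : Set where
    field
      good   : Good (contract x p rs) (contract x p rt) s t p y
      bit≡   : bit y ≡ bit P
      count≡ : count y ≡ count P + count X
      cost≤  : cost y ≤ cost P + cost X + (w + w)
      size≤  : size y ≤ suc (size P + size X)
      fromP  : ∀ {v} → v ∈ˡ route P → v ∈ˡ route y
      fromX  : ∀ {v} → v ∈ˡ route X → v ∈ˡ route y
      thrifty : ∀ {D} → Demand rs rt x (bit P) (bit X) w D → cost y ≤ cost P + cost X + D

  module Merging {x p w : ℕ} (p≢x : p ≢ x) (climb : Link³ R x p w) (fall : Link³ R p x w)
                 {rs rt s t cp np cx nx : ℕ} {pP qP pX qX : List ℕ} where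

    seen-no : ∀ {r s a} → r ≡ x → Seen r s p a → a ≡ p
    seen-no e (in-block e′) = contradiction (trans (sym e′) e) p≢x
    seen-no e (off-block _) = refl

    seen-yes : ∀ {r s a} → r ≡ x → Seen r s x a → a ≡ s
    seen-yes e (in-block _)  = refl
    seen-yes e (off-block n) = contradiction e n

    seen-off : ∀ {r s a} → r ≢ x → Seen r s x a → a ≡ x
    seen-off n (in-block e)  = contradiction e n
    seen-off n (off-block _) = refl

    seen-keep : ∀ {r s a} → r ≢ x → Seen r s p a → Seen (contract x p r) s p a
    seen-keep n (in-block e)  = in-block (trans (contract-≢ n) e)
    seen-keep n (off-block e) = off-block (λ e′ → e (trans (sym (contract-≢ n)) e′))

    seen-new : ∀ {r s} → r ≡ x → Seen (contract x p r) s p s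
    seen-new e = in-block (contract-≡ e)

    private
      swap : ∀ {A : Set} {v : A} (as : List A) {bs cs : List A} → v ∈ˡ as ++ cs → v ∈ˡ (as ++ bs) ++ cs
      swap as {bs} {cs} h with ∈-++⁻ as h
      ... | inj₁ h′ = ∈-++⁺ˡ (∈-++⁺ˡ h′)
      ... | inj₂ h′ = ∈-++⁺ʳ (as ++ bs) h′

      len3 : ∀ {A : Set} (as bs cs : List A) →
             length ((as ++ bs) ++ cs) ≡ length as + length bs + length cs
      len3 as bs cs = trans (length-++ (as ++ bs)) (cong (_+ length cs) (length-++ as))

      arith₁ : ∀ a b c d → a + suc (b + c) + d ≡ suc (a + d + (b + c))
      arith₁ = solve-∀
      arith₂ : ∀ a b c d → a + suc b + (c + d) ≡ suc ((b + c) + (a + d))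
      arith₂ = solve-∀
      arith₃ : ∀ a b c d → a + b + c + d ≡ c + d + (a + b)
      arith₃ = solve-∀
      arith₄ : ∀ a b c d → a + (b + (c + d)) ≡ a + b + (c + d)
      arith₄ = solve-∀

    -- In the child block the walk is closed at `x`, which stands in for both outer terminals. It
    -- becomes a detour from the visit to `p`, placed before the cut so that `post` still begins
    -- with `p`.
    merge-neither : rs ≢ x → rt ≢ x →
      Good rs rt s t p ((1 , cp , np) , pP , qP) → Good rs rt s t x ((1 , cx , nx) , pX , qX) →
      Merged x p w rs rt s t ((1 , cp , np) , pP , qP) ((1 , cx , nx) , pX , qX)
        ((1 , cp + cx + (w + w) , np + nx) , pP ++ p ∷ (pX ++ qX) , qP)
    merge-neither ns nt (through {c₁ = c₁} {c₂} sa sz π τ refl) (through {c₁ = d₁} {d₂} sa′ sz′ π′ τ′ refl)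
      with refl ← seen-off ns sa′ | refl ← seen-off nt sz′ = record
      { good = through (seen-keep ns sa) (seen-keep nt sz)
                 (path-path π (fall ∷ trail-link (path-trail π′ τ′) climb)) τ (arith c₁ c₂ d₁ d₂ w)
      ; bit≡ = refl
      ; count≡ = refl
      ; cost≤ = ≤-refl
      ; size≤ = ≤-reflexive (trans (cong (_+ length qP) (trans (length-++ pP) (cong (λ l → length pP + suc l) (length-++ pX))))
                              (arith₁ (length pP) (length pX) (length qX) (length qP)))
      ; fromP = swap pP
      ; fromX = λ h → ∈-++⁺ˡ (∈-++⁺ʳ pP (there h))
      ; thrifty = λ d → +-monoʳ-≤ (c₁ + c₂ + (d₁ + d₂)) (proj₂ (Demand.neither d ns nt refl))
      }
      where
      arith : ∀ a b c d w → a + b + (c + d) + (w + w) ≡ a + (w + (c + d + w)) + b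
      arith = solve-∀

    -- The child block contributes a walk from `s` to `x`, the stand-in for the outer terminal, and
    -- the parent block one from the stand-in `p` onwards; the edge joins the two.
    merge-starts : rs ≡ x → rt ≢ x →
      Good rs rt s t p ((1 , cp , np) , pP , qP) → Good rs rt s t x ((1 , cx , nx) , pX , qX) →
      Merged x p w rs rt s t ((1 , cp , np) , pP , qP) ((1 , cx , nx) , pX , qX)
        ((1 , cp + cx + w , np + nx) , (pX ++ qX) ++ pP , qP)
    merge-starts es nt (through {c₁ = c₁} {c₂} sa sz π τ refl) (through {c₁ = d₁} {d₂} sa′ sz′ π′ τ′ refl)
      with refl ← seen-yes es sa′ | refl ← seen-off nt sz′ | refl ← seen-no es sa = record
      { good = through (seen-new es) (seen-keep nt sz)
                 (path-path (trail-link (path-trail π′ τ′) climb) π) τ (arith c₁ c₂ d₁ d₂ w)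
      ; bit≡ = refl
      ; count≡ = refl
      ; cost≤ = +-monoʳ-≤ _ (m≤m+n w w)
      ; size≤ = ≤-trans (≤-reflexive (trans (cong (_+ length qP) (len3 pX qX pP))
                  (arith₃ (length pX) (length qX) (length pP) (length qP)))) (n≤1+n _)
      ; fromP = λ h → subst (_ ∈ˡ_) (sym (++-assoc (pX ++ qX) pP qP)) (∈-++⁺ʳ (pX ++ qX) h)
      ; fromX = λ h → ∈-++⁺ˡ (∈-++⁺ˡ h)
      ; thrifty = λ d → +-monoʳ-≤ (c₁ + c₂ + (d₁ + d₂)) (proj₂ (proj₂ (Demand.starts d es nt)))
      }
      where
      arith : ∀ a b c d w → a + b + (c + d) + w ≡ c + d + w + a + b
      arith = solve-∀

    merge-ends : rs ≢ x → rt ≡ x →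
      Good rs rt s t p ((1 , cp , np) , pP , qP) → Good rs rt s t x ((1 , cx , nx) , pX , qX) →
      Merged x p w rs rt s t ((1 , cp , np) , pP , qP) ((1 , cx , nx) , pX , qX)
        ((1 , cp + cx + w , np + nx) , pP , qP ++ (pX ++ qX))
    merge-ends ns et (through {c₁ = c₁} {c₂} sa sz π τ refl) (through {c₁ = d₁} {d₂} sa′ sz′ π′ τ′ refl)
      with refl ← seen-off ns sa′ | refl ← seen-yes et sz′ | refl ← seen-no et sz = record
      { good = through (seen-keep ns sa) (seen-new et)
                 π (path-trail (trail-link τ fall) (path-trail π′ τ′)) (arith c₁ c₂ d₁ d₂ w)
      ; bit≡ = refl
      ; count≡ = refl
      ; cost≤ = +-monoʳ-≤ _ (m≤m+n w w)
      ; size≤ = ≤-trans (≤-reflexive (trans (cong (length pP +_) (trans (length-++ qP) (cong (length qP +_) (length-++ pX))))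
                  (arith₄ (length pP) (length qP) (length pX) (length qX)))) (n≤1+n _)
      ; fromP = λ h → subst (_ ∈ˡ_) (++-assoc pP qP _) (∈-++⁺ˡ h)
      ; fromX = λ h → ∈-++⁺ʳ pP (∈-++⁺ʳ qP h)
      ; thrifty = λ d → +-monoʳ-≤ (c₁ + c₂ + (d₁ + d₂)) (proj₂ (proj₂ (Demand.ends d ns et)))
      }
      where
      arith : ∀ a b c d w → a + b + (c + d) + w ≡ a + (b + w + (c + d))
      arith = solve-∀

    merge-closed : rs ≡ x → rt ≡ x →
      Good rs rt s t p ((1 , cp , np) , pP , qP) → Good rs rt s t x ((1 , cx , nx) , pX , qX) →
      Merged x p w rs rt s t ((1 , cp , np) , pP , qP) ((1 , cx , nx) , pX , qX)
        ((1 , cp + cx + (w + w) , np + nx) , pX ++ x ∷ pP , qP ++ qX)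
    merge-closed es et (through {c₁ = c₁} {c₂} sa sz π τ refl) (through {c₁ = d₁} {d₂} sa′ sz′ π′ τ′ refl)
      with refl ← seen-yes es sa′ | refl ← seen-yes et sz′ | refl ← seen-no es sa | refl ← seen-no et sz = record
      { good = through (seen-new es) (seen-new et)
                 (path-path π′ (climb ∷ π)) (path-trail (trail-link τ fall) τ′) (arith c₁ c₂ d₁ d₂ w)
      ; bit≡ = refl
      ; count≡ = refl
      ; cost≤ = ≤-refl
      ; size≤ = ≤-reflexive (trans (cong₂ _+_ (length-++ pX) (length-++ qP))
                              (arith₂ (length pX) (length pP) (length qP) (length qX)))
      ; fromP = λ h → [ (λ h′ → ∈-++⁺ˡ (∈-++⁺ʳ pX (there h′))) , (λ h′ → ∈-++⁺ʳ (pX ++ x ∷ pP) (∈-++⁺ˡ h′)) ] (∈-++⁻ pP h)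
      ; fromX = λ h → [ (λ h′ → ∈-++⁺ˡ (∈-++⁺ˡ h′)) , (λ h′ → ∈-++⁺ʳ (pX ++ x ∷ pP) (∈-++⁺ʳ qP h′)) ] (∈-++⁻ pX h)
      ; thrifty = λ d → +-monoʳ-≤ (c₁ + c₂ + (d₁ + d₂)) (proj₂ (Demand.closed d es et refl))
      }
      where
      arith : ∀ a b c d w → a + b + (c + d) + (w + w) ≡ c + (w + a) + (b + w + d)
      arith = solve-∀

    keep-parent : ∀ {b} → rs ≢ x → rt ≢ x →
      Good rs rt s t p ((b , cp , np) , pP , qP) → Good rs rt s t x ((0 , cx , nx) , pX , qX) →
      Merged x p w rs rt s t ((b , cp , np) , pP , qP) ((0 , cx , nx) , pX , qX)
        ((b , cp + cx , np + nx) , pP , qP)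
    keep-parent ns nt g (complete e _ _) = contradiction e ns
    keep-parent ns nt g (absent _ _ refl refl refl) = record
      { good = kept g
      ; bit≡ = refl
      ; count≡ = refl
      ; cost≤ = m≤m+n _ _
      ; size≤ = ≤-trans (≤-reflexive (sym (+-identityʳ _))) (n≤1+n _)
      ; fromP = id
      ; fromX = λ ()
      ; thrifty = λ _ → m≤m+n _ _
      }
      where
      kept : ∀ {b} → Good rs rt s t p ((b , cp , np) , pP , qP) →
             Good (contract x p rs) (contract x p rt) s t p ((b , cp + 0 , np + nx) , pP , qP)
      kept (through sa sz π τ e) =
        through (seen-keep ns sa) (seen-keep nt sz) π τ (trans (+-identityʳ cp) e)
      kept (complete e e′ τ) = complete (trans (contract-≢ ns) e) (trans (contract-≢ nt) e′)
        (subst (Trail _ _ _) (sym (+-identityʳ cp)) τ)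
      kept (absent n n′ e e′ refl) =
        absent (λ e → n (trans (sym (contract-≢ ns)) e)) (λ e → n′ (trans (sym (contract-≢ nt)) e)) e e′ refl

    -- Both terminals lie in the block of `x`, so bit 0 at `p` means that nothing happens in the
    -- parent block: the walk is complete and is never extended again.
    keep-child : ∀ {b} → rs ≡ x → rt ≡ x →
      Good rs rt s t p ((0 , cp , np) , pP , qP) → Good rs rt s t x ((b , cx , nx) , pX , qX) →
      Merged x p w rs rt s t ((0 , cp , np) , pP , qP) ((b , cx , nx) , pX , qX)
        ((0 , cp + cx , np + nx) , pX , qX)
    keep-child es et (complete e _ _) g = contradiction (trans (sym e) es) p≢x
    keep-child es et (absent _ _ refl refl refl) g = record
      { good = complete (contract-≡ es) (contract-≡ et) (whole g)
      ; bit≡ = refl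
      ; count≡ = refl
      ; cost≤ = m≤m+n _ _
      ; size≤ = n≤1+n _
      ; fromP = λ ()
      ; fromX = id
      ; thrifty = λ _ → m≤m+n _ _
      }
      where
      whole : ∀ {b} → Good rs rt s t x ((b , cx , nx) , pX , qX) → Trail s (pX ++ qX) t cx
      whole (through sa sz π τ refl) with refl ← seen-yes es sa | refl ← seen-yes et sz = path-trail π τ
      whole (complete _ _ τ)         = τ
      whole (absent n _ _ _ _)       = contradiction es n

-- Verification of the elementary procedures and of `mergeSeg`.

module Procedures (N : ℕ) (1≤N : 1 ≤ N) where
  open Logic N 1≤N public

  wp-ifEq : ∀ {Γ a} {s t : Tm Γ nat} {x y : Tm Γ a} {ρ Q} {_ : T (flat s)} {_ : T (flat t)} →
            (eval s ρ ≡ eval t ρ → WP x ρ Q) → (eval s ρ ≢ eval t ρ → WP y ρ Q) →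
            WP (ifEq s t x y) ρ Q
  wp-ifEq {s = s} {t} {x} {y} {_} {_} {fs} {ft} hx hy =
    wp-if {s = s} {t} {_} {_} {_} {_} {fs} {ft}
      (λ s≤t → wp-if {s = t} {s} {_} {_} {_} {_} {ft} {fs}
        (λ t≤s → hx (≤-antisym s≤t t≤s)) (λ s<t → hy (λ e → <⇒≢ s<t e)))
      (λ t<s → hy (λ e → <⇒≢ t<s (sym e)))

  wp-append : ∀ {Γ a} {s t : Tm Γ (list a)} {ρ Q} →
              WP s ρ (λ xs → length xs ≤ N × WP t ρ (λ ys → Q (xs ++ ys))) → WP (s ⊕ t) ρ Q
  wp-append {a = a} {Q = Q} h =
    wp-call (wp-pair (wp-conseq h (λ xs (l , h′) → wp-conseq h′ (λ ys q →
      wp-fold (λ zs r → r ≡ zs ++ ys)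
        (wp-flat (l , wp-flat refl , (λ _ x zs r _ e → wp-flat (cong (x ∷_) e)) , (λ r e → subst Q (sym e) q)))))))

  Flag : Set → ℕ → Set
  Flag A r = (r ≡ 1 × A) ⊎ (r ≡ 0 × ¬ A)

  wp-member : ∀ {Γ} {s : Tm Γ nat} {t : Tm Γ (list nat)} {ρ Q} →
              WP s ρ (λ x → WP t ρ (λ xs → length xs ≤ N × (∀ r → Flag (x ∈ˡ xs) r → Q r))) →
              WP (call member (pair s t)) ρ Q
  wp-member h = wp-call (wp-pair (wp-conseq h (λ x h′ → wp-conseq h′ (λ xs (l , q) →
    wp-fold (λ ys r → Flag (x ∈ˡ ys) r)
      (wp-flat (l , wp-flat (inj₂ (refl , λ ())) ,
        (λ _ y ys r _ f → wp-ifEq (λ e → wp-flat (inj₁ (refl , here (sym e))))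
                                  (λ ne → wp-flat (next ne f))) , q))))))
    where
    next : ∀ {x y ys r} → y ≢ x → Flag (x ∈ˡ ys) r → Flag (x ∈ˡ (y ∷ ys)) r
    next ne (inj₁ (e , h)) = inj₁ (e , there h)
    next ne (inj₂ (e , h)) = inj₂ (e , λ { (here e′) → ne (sym e′) ; (there h′) → h h′ })

  module _ {R : List E3} {x p w : ℕ} (p≢x : p ≢ x) (climb : Link³ R x p w) (fall : Link³ R p x w) where
    open Segments R

    -- The second component is completeness: an empty result is allowed only if no `D` meets the
    -- demands.
    MergePost : ℕ → ℕ → ℕ → ℕ → ⟦ Seg ⟧ → ⟦ Seg ⟧ → List ⟦ Seg ⟧ → Set
    MergePost rs rt s t P X r =
      (∀ {y} → y ∈ˡ r → Merged x p w rs rt s t P X y) ×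
      (∀ {D} → Demand rs rt x (bit P) (bit X) w D → ∃[ y ] y ∈ˡ r)

    private
      one : ∀ {rs rt s t P X y} → Merged x p w rs rt s t P X y → MergePost rs rt s t P X (y ∷ [])
      one m = (λ { (here refl) → m }) , (λ _ → _ , here refl)

      none : ∀ {rs rt s t P X} →
             (∀ {D} → ¬ Demand rs rt x (bit P) (bit X) w D) → MergePost rs rt s t P X []
      none h = (λ ()) , (λ d → contradiction d h)

      is-one : ∀ {rs rt s t u y} → Good rs rt s t u y → 1 ≤ bit y → bit y ≡ 1
      is-one (through _ _ _ _ _) _ = refl

      is-zero : ∀ {rs rt s t u y} → Good rs rt s t u y → bit y < 1 → bit y ≡ 0
      is-zero _ (s≤s z≤n) = refl

    mergeSeg-wp : ∀ {rs rt s t P X} → Good rs rt s t p P → Good rs rt s t x X → size P + size X ≤ N →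
                  WP mergeSeg (((x , p , w) , (rs , rt) , P , X) ∷ []) (MergePost rs rt s t P X)
    mergeSeg-wp {rs} {rt} {s} {t} {P = (bp , cp , np) , pP , qP} {X = (bx , cx , nx) , pX , qX} gP gX l =
      wp-ifEq
        (λ es → wp-ifEq
          (λ et → wp-if
            (λ hp → wp-if
              (λ hx → wp-cons (wp-pair (wp-flat (wp-pair
                (wp-append (wp-flat (lpX , wp-flat (wp-append (wp-flat (lqP , wp-flat (wp-flat
                  (closed es et hp hx))))))))))))
              (λ hx → wp-flat (none λ d → 0≢1+n (trans (sym (is-zero gX hx)) (proj₁ (Demand.closed d es et (is-one gP hp)))))))
            (λ hp → wp-flat (childOnly es et hp)))
          (λ nt → wp-if
            (λ hp → wp-if
              (λ hx → wp-cons (wp-pair (wp-flat (wp-pair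
                (wp-append (wp-append (wp-flat (lpX , wp-flat (lX , wp-flat (wp-flat (wp-flat
                  (starts es nt hp hx))))))))))))
              (λ hx → wp-flat (none λ d → 0≢1+n (trans (sym (is-zero gX hx)) (proj₁ (proj₂ (Demand.starts d es nt)))))))
            (λ hp → wp-flat (none λ d → 0≢1+n (trans (sym (is-zero gP hp)) (proj₁ (Demand.starts d es nt)))))))
        (λ ns → wp-ifEq
          (λ et → wp-if
            (λ hp → wp-if
              (λ hx → wp-cons (wp-pair (wp-flat (wp-pair
                (wp-flat (wp-append (wp-flat (lqP , wp-append (wp-flat (lpX , wp-flat (wp-flat
                  (ends ns et hp hx)))))))))))
              )
              (λ hx → wp-flat (none λ d → 0≢1+n (trans (sym (is-zero gX hx)) (proj₁ (proj₂ (Demand.ends d ns et)))))))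
            (λ hp → wp-flat (none λ d → 0≢1+n (trans (sym (is-zero gP hp)) (proj₁ (Demand.ends d ns et))))))
          (λ nt → wp-if
            (λ hx → wp-if
              (λ hp → wp-cons (wp-pair (wp-flat (wp-pair
                (wp-append (wp-flat (lpP , wp-cons (wp-flat (wp-append (wp-flat (lpX , wp-flat (wp-flat (wp-flat
                  (neither ns nt hp hx))))))))))))))
              (λ hp → wp-flat (none λ d → 0≢1+n (trans (sym (is-zero gP hp)) (proj₁ (Demand.neither d ns nt (is-one gX hx)))))))
            (λ hx → wp-flat (parentOnly ns nt hx))))
      where
      lP : length pP + length qP ≤ N
      lP = ≤-trans (m≤m+n _ _) l
      lpP : length pP ≤ N
      lpP = ≤-trans (m≤m+n _ _) lP
      lqP : length qP ≤ N
      lqP = ≤-trans (m≤n+m _ _) lP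
      lX′ : length pX + length qX ≤ N
      lX′ = ≤-trans (m≤n+m _ (length pP + length qP)) l
      lpX : length pX ≤ N
      lpX = ≤-trans (m≤m+n _ _) lX′
      lX : length (pX ++ qX) ≤ N
      lX = subst (_≤ N) (sym (length-++ pX)) lX′
      Result : List ⟦ Seg ⟧ → Set
      Result = MergePost rs rt s t ((bp , cp , np) , pP , qP) ((bx , cx , nx) , pX , qX)
      open Merging p≢x climb fall
      closed : rs ≡ x → rt ≡ x → 1 ≤ bp → 1 ≤ bx →
        Result (((bp , cp + cx + (w + w) , np + nx) , pX ++ x ∷ pP , qP ++ qX) ∷ [])
      closed es et hp hx with refl ← is-one gP hp | refl ← is-one gX hx = one (merge-closed es et gP gX)
      starts : rs ≡ x → rt ≢ x → 1 ≤ bp → 1 ≤ bx →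
        Result (((bp , cp + cx + w , np + nx) , (pX ++ qX) ++ pP , qP) ∷ [])
      starts es nt hp hx with refl ← is-one gP hp | refl ← is-one gX hx = one (merge-starts es nt gP gX)
      ends : rs ≢ x → rt ≡ x → 1 ≤ bp → 1 ≤ bx →
        Result (((bp , cp + cx + w , np + nx) , pP , qP ++ (pX ++ qX)) ∷ [])
      ends ns et hp hx with refl ← is-one gP hp | refl ← is-one gX hx = one (merge-ends ns et gP gX)
      neither : rs ≢ x → rt ≢ x → 1 ≤ bp → 1 ≤ bx →
        Result (((bp , cp + cx + (w + w) , np + nx) , pP ++ p ∷ (pX ++ qX) , qP) ∷ [])
      neither ns nt hp hx with refl ← is-one gP hp | refl ← is-one gX hx = one (merge-neither ns nt gP gX)
      childOnly : rs ≡ x → rt ≡ x → bp < 1 → Result (((bp , cp + cx , np + nx) , pX , qX) ∷ [])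
      childOnly es et hp with refl ← is-zero gP hp = one (keep-child es et gP gX)
      parentOnly : rs ≢ x → rt ≢ x → bx < 1 → Result (((bp , cp + cx , np + nx) , pP , qP) ∷ [])
      parentOnly ns nt hx with refl ← is-zero gX hx = one (keep-parent ns nt gP gX)

-- Tuples and the procedures on them.

-- Bounds the table after deduplication, the vertices of the grown tree, the edges of the given tree
-- and the vertices of a simple walk.
pigeonhole : ∀ {A : Set} {xs ys : List A} → Unique xs → (∀ {x} → x ∈ˡ xs → x ∈ˡ ys) → length xs ≤ length ys
pigeonhole {xs = []} u h = z≤n
pigeonhole {xs = x ∷ xs} (x∉ ∷ u) h with ∈-∃++ (h (here refl))
... | as , bs , refl = begin
  suc (length xs)              ≤⟨ s≤s (pigeonhole u rest) ⟩
  suc (length (as ++ bs))      ≡⟨ cong suc (length-++ as) ⟩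
  suc (length as + length bs)  ≡⟨ sym (+-suc (length as) (length bs)) ⟩
  length as + length (x ∷ bs)  ≡⟨ sym (length-++ as) ⟩
  length (as ++ x ∷ bs)        ∎
  where
  open ≤-Reasoning
  rest : ∀ {y} → y ∈ˡ xs → y ∈ˡ as ++ bs
  rest y∈ with ∈-++⁻ as (h (there y∈))
  ... | inj₁ i         = ∈-++⁺ˡ i
  ... | inj₂ (here e)  = contradiction (sym e) (All-lookup x∉ y∈)
  ... | inj₂ (there i) = ∈-++⁺ʳ as i

length-cartesianProduct : ∀ {A B : Set} (xs : List A) (ys : List B) →
                          length (cartesianProduct xs ys) ≡ length xs * length ys
length-cartesianProduct []       ys = refl
length-cartesianProduct (x ∷ xs) ys =
  trans (length-++ (map (x ,_) ys)) (cong₂ _+_ (length-map (x ,_) ys) (length-cartesianProduct xs ys))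

-- Functions on the indices of a tuple

cat : ∀ k → (Fin (suc k) → List ℕ) → List ℕ
cat zero    W = W zero
cat (suc k) W = W zero ++ cat k (W ∘ suc)

upTill : ∀ k → (Fin (suc k) → List ℕ) → Fin (suc k) → List ℕ
upTill zero    W zero    = W zero
upTill (suc k) W zero    = W zero
upTill (suc k) W (suc h) = W zero ++ upTill k (W ∘ suc) h

total : ∀ k → (Fin (suc k) → ℕ) → Fin (suc k) → ℕ
total zero    c zero    = c zero
total (suc k) c zero    = c zero
total (suc k) c (suc h) = c zero + total k (c ∘ suc) h

upTill-mono : ∀ k {W W′ : Fin (suc k) → List ℕ} → (∀ h {v} → v ∈ˡ W h → v ∈ˡ W′ h) →
              ∀ h {v} → v ∈ˡ upTill k W h → v ∈ˡ upTill k W′ h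
upTill-mono zero    i zero    = i zero
upTill-mono (suc k) i zero    = i zero
upTill-mono (suc k) {W} {W′} i (suc h) m with ∈-++⁻ (W zero) m
... | inj₁ m′ = ∈-++⁺ˡ (i zero m′)
... | inj₂ m′ = ∈-++⁺ʳ (W′ zero) (upTill-mono k (i ∘ suc) h m′)

total-mono : ∀ k {c d : Fin (suc k) → ℕ} → (∀ h → c h ≤ d h) → ∀ h → total k c h ≤ total k d h
total-mono zero    i zero    = i zero
total-mono (suc k) i zero    = i zero
total-mono (suc k) i (suc h) = +-mono-≤ (i zero) (total-mono k (i ∘ suc) h)

mark : List ℕ → ℕ → ℕ
mark L y = when (y ∈ˡ? L) 1

seen : List ℕ → List ℕ → ℕ → ℕ
seen V L y = when (y ∈ˡ? V) (mark L y)

mark-yes : ∀ L {y} → y ∈ˡ L → mark L y ≡ 1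
mark-yes L {y} h with y ∈ˡ? L
... | yes _ = refl
... | no n  = contradiction h n

mark-no : ∀ L {y} → y ∉ L → mark L y ≡ 0
mark-no L {y} h with y ∈ˡ? L
... | yes i = contradiction i h
... | no n  = refl

mark-1 : ∀ L {y} → mark L y ≡ 1 → y ∈ˡ L
mark-1 L {y} e with y ∈ˡ? L
... | yes i = i
mark-1 L {y} () | no _

mark-≤1 : ∀ L {y} → mark L y ≤ 1
mark-≤1 L {y} with y ∈ˡ? L
... | yes _ = ≤-refl
... | no _  = z≤n

mark-mono : ∀ {L L′ y} → (y ∈ˡ L → y ∈ˡ L′) → mark L y ≤ mark L′ y
mark-mono {L} {L′} {y} i with y ∈ˡ? L
... | no _  = z≤n
... | yes h = ≤-reflexive (sym (mark-yes L′ (i h)))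

seen-mono : ∀ {V L L′ y} → (y ∈ˡ L → y ∈ˡ L′) → seen V L y ≤ seen V L′ y
seen-mono {V} {L} {L′} {y} i with y ∈ˡ? V
... | no _  = z≤n
... | yes _ = mark-mono i

seen-≤1 : ∀ V L y → seen V L y ≤ 1
seen-≤1 V L y with y ∈ˡ? V
... | no _  = z≤n
... | yes _ = mark-≤1 L

keys : ∀ k → ⟦ Tup k Seg ⟧ → ⟦ Tup k Key ⟧
keys zero    y       = proj₁ y
keys (suc k) (y , z) = proj₁ y , keys k z

get-keys : ∀ k y h → get k (keys k y) h ≡ proj₁ (get k y h)
get-keys zero    y zero    = refl
get-keys (suc k) y zero    = refl
get-keys (suc k) y (suc h) = get-keys k (proj₂ y) h

code : ∀ {k} → ⟦ Entry k ⟧ → ℕ × ⟦ Tup k Key ⟧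
code {k} (u , y) = u , keys k y

tupleBox : ∀ k {A : Ty} → List ⟦ A ⟧ → List ⟦ Tup k A ⟧
tupleBox zero    xs = xs
tupleBox (suc k) xs = cartesianProduct xs (tupleBox k xs)

length-tupleBox : ∀ k {A : Ty} (xs : List ⟦ A ⟧) → length (tupleBox k {A} xs) ≡ length xs ^ suc k
length-tupleBox zero    xs = sym (*-identityʳ _)
length-tupleBox (suc k) {A} xs =
  trans (length-cartesianProduct xs (tupleBox k {A} xs)) (cong (length xs *_) (length-tupleBox k {A} xs))

∈-tupleBox : ∀ k {A : Ty} (xs : List ⟦ A ⟧) (y : ⟦ Tup k A ⟧) → (∀ h → get k y h ∈ˡ xs) → y ∈ˡ tupleBox k {A} xs
∈-tupleBox zero    xs y       i = i zero
∈-tupleBox (suc k) {A} xs (y , z) i = ∈-cartesianProduct⁺ (i zero) (∈-tupleBox k {A} xs z (i ∘ suc))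

-- The count in `seg₀`: a point that this segment misses counts iff an earlier one visits it.
count₀ : ℕ → ℕ → ℕ
count₀ f v with 1 ≤? f
... | yes _ = v
... | no _  = 0

chainOf : ∀ k → ℕ → ℕ → ⟦ Tup k nat ⟧ → ⟦ Tup k (nat ⊗ nat) ⟧
chainOf zero    r s g       = s , r
chainOf (suc k) r s (v , g) = (s , v) , chainOf k r v g

module TupleProcedures (N : ℕ) (1≤N : 1 ≤ N) where
  open Procedures N 1≤N public

  chain-wp : ∀ k {r s g} → WP (chain k) ((r , s , g) ∷ []) (_≡ chainOf k r s g)
  chain-wp zero    = wp-flat refl
  chain-wp (suc k) = wp-pair (wp-flat (wp-call (wp-flat
    (wp-conseq (chain-wp k) (λ _ e → cong (_ ,_) e)))))

  fromList-wp : ∀ k (f : Fin (suc k) → ℕ × ℕ) →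
                WP (fromList k) (tabulate f ∷ []) (λ r → ∀ h → get k r h ≡ f h)
  fromList-wp zero    f = wp-flat λ { zero → refl }
  fromList-wp (suc k) f = wp-case (wp-flat ((λ ()) , λ { x xs refl →
    wp-pair (wp-flat (wp-call (wp-flat (wp-conseq (fromList-wp k (f ∘ suc))
      (λ r e → λ { zero → refl ; (suc h) → e h }))))) }))

  tuples-wp : ∀ k {vs} → 1 ≤ length vs → length vs ^ suc k ≤ N →
              WP (tuples k) (vs ∷ []) (λ r → length r ≤ length vs ^ suc k ×
                (∀ {g} → g ∈ˡ r → ∀ h → get k g h ∈ˡ vs) ×
                (∀ {g} → (∀ h → get k g h ∈ˡ vs) → g ∈ˡ r))
  tuples-wp zero    {vs} _ l = wp-flat (≤-reflexive (sym (*-identityʳ _)) , (λ { i zero → i }) , (λ i → i zero))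
  tuples-wp (suc k) {vs} 1≤ l =
    wp-let (wp-call (wp-flat (wp-conseq (tuples-wp k {vs} 1≤ (≤-trans (m≤n*m _ _ ⦃ >-nonZero 1≤ ⦄) l)) (λ r (lr , sound , cmp) →
      wp-fold (λ ys acc → length acc ≤ length ys * length vs ^ suc k ×
                 (∀ {g} → g ∈ˡ acc → proj₁ g ∈ˡ ys × proj₂ g ∈ˡ r) ×
                 (∀ {x z} → x ∈ˡ ys → z ∈ˡ r → (x , z) ∈ˡ acc))
        (wp-flat ( ≤-trans (≤-trans (≤-reflexive (sym (*-identityʳ _))) (^-monoʳ-≤ (length vs) ⦃ >-nonZero 1≤ ⦄ {1} {suc (suc k)} (s≤s z≤n))) l
                 , wp-flat (z≤n , (λ ()) , (λ ()))
                 , (λ _ x ys acc _ (la , si , ci) →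
                     wp-fold (λ zs acc′ → length acc′ ≤ length zs + length acc ×
                                (∀ {g} → g ∈ˡ acc′ → (proj₁ g ≡ x × proj₂ g ∈ˡ zs) ⊎ g ∈ˡ acc) ×
                                (∀ {z} → z ∈ˡ zs → (x , z) ∈ˡ acc′) ×
                                (∀ {g} → g ∈ˡ acc → g ∈ˡ acc′))
                       (wp-flat ( ≤-trans lr (≤-trans (m≤n*m _ _ ⦃ >-nonZero 1≤ ⦄) l)
                                , wp-flat (≤-refl , inj₂ , (λ ()) , id)
                                , (λ _ z zs acc′ _ (la′ , si′ , ci′ , ki′) → wp-flat
                                    ( s≤s la′
                                    , (λ { (here refl) → inj₁ (refl , here refl)
                                         ; (there i) → [ (λ (e , j) → inj₁ (e , there j)) , inj₂ ] (si′ i) })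
                                    , (λ { (here refl) → here refl ; (there i) → there (ci′ i) })
                                    , (λ i → there (ki′ i))))
                                , (λ acc′ (la′ , si′ , ci′ , ki′) →
                                    ≤-trans la′ (+-mono-≤ lr la)
                                    , (λ i → [ (λ (e , j) → here e , j) , (λ j → let a , b = si j in there a , b) ] (si′ i))
                                    , (λ { (here refl) j → ci′ j ; (there i) j → ki′ (ci i j) })))))
                 , (λ acc (la , si , ci) → la
                     , (λ i → λ { zero → proj₁ (si i) ; (suc h) → sound (proj₂ (si i)) h })
                     , (λ i → ci (i zero) (cmp (i ∘ suc))))))))))

  contractOne-wp : ∀ {x p w r} → WP contractOne (((x , p , w) , r) ∷ []) (_≡ contract x p r)
  contractOne-wp = wp-ifEq (λ e → wp-flat (sym (contract-≡ e))) (λ n → wp-flat (sym (contract-≢ n)))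

  contractAll-wp : ∀ k {x p w ST} → WP (contractAll k) (((x , p , w) , ST) ∷ [])
    (λ r → ∀ h → get k r h ≡ (contract x p (proj₁ (get k ST h)) , contract x p (proj₂ (get k ST h))))
  contractAll-wp zero = wp-pair (wp-call (wp-flat (wp-conseq contractOne-wp λ _ e →
    wp-call (wp-flat (wp-conseq contractOne-wp λ _ e′ → λ { zero → cong₂ _,_ e e′ })))))
  contractAll-wp (suc k) = wp-pair (wp-pair (wp-call (wp-flat (wp-conseq contractOne-wp λ _ e →
    wp-call (wp-flat (wp-conseq contractOne-wp λ _ e′ →
    wp-call (wp-flat (wp-conseq (contractAll-wp k) λ _ i →
      λ { zero → cong₂ _,_ e e′ ; (suc h) → i h }))))))))

  sameKey-wp : ∀ {y z} → WP sameKey ((y , z) ∷ []) (Flag (proj₁ y ≡ proj₁ z))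
  sameKey-wp = wp-ifEq
    (λ e → wp-ifEq
      (λ e′ → wp-ifEq (λ e″ → wp-flat (inj₁ (refl , cong₂ _,_ e (cong₂ _,_ e′ e″))))
                      (λ n → wp-flat (inj₂ (refl , n ∘ cong (proj₂ ∘ proj₂)))))
      (λ n → wp-flat (inj₂ (refl , n ∘ cong (proj₁ ∘ proj₂)))))
    (λ n → wp-flat (inj₂ (refl , n ∘ cong proj₁)))

  sameKeys-wp : ∀ k {y z} → WP (sameKeys k) ((y , z) ∷ []) (Flag (keys k y ≡ keys k z))
  sameKeys-wp zero    = sameKey-wp
  sameKeys-wp (suc k) = wp-let (wp-call (wp-flat (wp-conseq sameKey-wp λ
    { _ (inj₁ (refl , e)) → wp-if
        (λ _ → wp-call (wp-flat (wp-conseq (sameKeys-wp k) λ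
          { _ (inj₁ (e′ , e″)) → inj₁ (e′ , cong₂ _,_ e e″)
          ; _ (inj₂ (e′ , n)) → inj₂ (e′ , n ∘ cong proj₂) })))
        (λ { (s≤s ()) })
    ; _ (inj₂ (refl , n)) → wp-if (λ ()) (λ _ → wp-flat (inj₂ (refl , n ∘ cong proj₁))) })))

  covered-wp : ∀ k {e F} → length F ≤ N →
               WP (covered k) ((e , F) ∷ []) (Flag (code {k} e ∈ˡ map (code {k}) F))
  covered-wp k {e} {F} l = wp-fold (λ ys r → Flag (code {k} e ∈ˡ map (code {k}) ys) r)
    (wp-flat (l , wp-flat (inj₂ (refl , λ ())) ,
      (λ _ y ys r _ f → wp-ifEq
        (λ u≡ → wp-let (wp-call (wp-flat (wp-conseq (sameKeys-wp k) λ
          { _ (inj₁ (refl , e′)) → wp-if (λ _ → wp-flat (inj₁ (refl , here (sym (cong₂ _,_ u≡ e′))))) (λ { (s≤s ()) })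
          ; _ (inj₂ (refl , n)) → wp-if (λ ()) (λ _ → wp-flat (next (λ q → n (cong proj₂ q)) f)) }))))
        (λ u≢ → wp-flat (next (u≢ ∘ cong proj₁) f))) ,
      (λ _ f → f)))
    where
    next : ∀ {y ys r} → code {k} y ≢ code {k} e → Flag (code {k} e ∈ˡ map (code {k}) ys) r →
           Flag (code {k} e ∈ˡ map (code {k}) (y ∷ ys)) r
    next n (inj₁ (q , i)) = inj₁ (q , there i)
    next n (inj₂ (q , i)) = inj₂ (q , λ { (here q′) → n (sym q′) ; (there j) → i j })

  -- The keys kept are distinct and lie in the box, so the pigeonhole principle applies; it is also
  -- needed during the loop, for the search through the accumulator. Entries get lost, but no keys.
  dedupe-wp : ∀ k {F} (box : List (ℕ × ⟦ Tup k Key ⟧)) → length F ≤ N → length box ≤ N →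
              (∀ {e} → e ∈ˡ F → code {k} e ∈ˡ box) →
              WP (dedupe k) (F ∷ []) (λ r → length r ≤ length box × (∀ {e} → e ∈ˡ r → e ∈ˡ F) ×
                                            (∀ {e} → e ∈ˡ F → code {k} e ∈ˡ map (code {k}) r))
  dedupe-wp k {F} box l lb inbox = wp-fold
    (λ ys r → Unique (map (code {k}) r) × (∀ {e} → e ∈ˡ r → e ∈ˡ F) × (∀ {e} → e ∈ˡ ys → code {k} e ∈ˡ map (code {k}) r))
    (wp-flat (l , wp-flat ([] , (λ ()) , (λ ())) ,
      (λ zs y ys r split (un , sound , cmp) →
        wp-let (wp-call (wp-flat (wp-conseq (covered-wp k (≤-trans (small un sound) lb)) λ
          { _ (inj₁ (refl , i)) → wp-if (λ _ → wp-flat (un , sound , (λ { (here refl) → i ; (there j) → cmp j }))) (λ { (s≤s ()) })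
          ; _ (inj₂ (refl , n)) → wp-if (λ ()) (λ _ → wp-flat
              ( All-tabulate (λ {z} j q → n (subst (_∈ˡ map (code {k}) r) (sym q) j)) ∷ un
              , (λ { (here refl) → subst (y ∈ˡ_) split (∈-++⁺ʳ zs (here refl)) ; (there j) → sound j })
              , (λ { (here refl) → here refl ; (there j) → there (cmp j) }))) })))) ,
      (λ r (un , sound , cmp) → small un sound , sound , cmp)))
    where
    small : ∀ {r} → Unique (map (code {k}) r) → (∀ {e} → e ∈ˡ r → e ∈ˡ F) → length r ≤ length box
    small {r} un sound = subst (_≤ length box) (length-map (code {k}) r) (pigeonhole un λ i →
      let e , e∈ , q = ∈-map⁻ (code {k}) i in subst (_∈ˡ box) (sym q) (inbox (sound e∈)))

  module _ {R : List E3} {x p w : ℕ} (p≢x : p ≢ x) (climb : Link³ R x p w) (fall : Link³ R p x w) where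
    open Segments R

    MergedAll : ∀ k → (s t : Fin (suc k) → ℕ) → ⟦ Tup k (nat ⊗ nat) ⟧ → (P X y : ⟦ Tup k Seg ⟧) → Set
    MergedAll k s t ST P X y = ∀ h →
      Merged x p w (proj₁ (get k ST h)) (proj₂ (get k ST h)) (s h) (t h) (get k P h) (get k X h) (get k y h)

    DemandAll : ∀ k → ⟦ Tup k (nat ⊗ nat) ⟧ → (P X : ⟦ Tup k Seg ⟧) → (Fin (suc k) → ℕ) → Set
    DemandAll k ST P X D = ∀ h →
      Demand (proj₁ (get k ST h)) (proj₂ (get k ST h)) x (bit (get k P h)) (bit (get k X h)) w (D h)

    -- Taking the head of each partial result is enough: every result is sound, and completeness
    -- asks only for one.
    merge-wp : ∀ k {ST P X} {s t : Fin (suc k) → ℕ} →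
      (∀ h → Good (proj₁ (get k ST h)) (proj₂ (get k ST h)) (s h) (t h) p (get k P h)) →
      (∀ h → Good (proj₁ (get k ST h)) (proj₂ (get k ST h)) (s h) (t h) x (get k X h)) →
      (∀ h → size (get k P h) + size (get k X h) ≤ N) →
      WP (merge k) (((x , p , w) , ST , P , X) ∷ [])
        (λ r → (∀ {y} → y ∈ˡ r → MergedAll k s t ST P X y) ×
               (∀ {D} → DemandAll k ST P X D → ∃[ y ] y ∈ˡ r))
    merge-wp zero gP gX l = wp-conseq (mergeSeg-wp p≢x climb fall (gP zero) (gX zero) (l zero))
      (λ r (sound , cmp) → (λ { i zero → sound i }) , (λ {D} d → cmp {D zero} (d zero)))
    merge-wp (suc k) gP gX l =
      wp-case (wp-call (wp-flat (wp-conseq (mergeSeg-wp p≢x climb fall (gP zero) (gX zero) (l zero)) λ r (sound , cmp) →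
        (λ { refl → wp-flat ((λ ()) , (λ {D} d → contradiction (proj₂ (cmp {D zero} (d zero))) (λ ()))) }) ,
        (λ { y ys refl →
          wp-case (wp-call (wp-flat (wp-conseq (merge-wp k (gP ∘ suc) (gX ∘ suc) (l ∘ suc)) λ r′ (sound′ , cmp′) →
            (λ { refl → wp-flat ((λ ()) , (λ d → contradiction (proj₂ (cmp′ (d ∘ suc))) (λ ()))) }) ,
            (λ { z zs refl → wp-flat
              ( (λ { (here refl) → λ { zero → sound (here refl) ; (suc h) → sound′ (here refl) h } })
              , (λ _ → _ , here refl)) }))))
          }))))

  Fits : ∀ k → ℕ → ⟦ Tup k Seg ⟧ → ⟦ Tup k (nat ⊗ nat) ⟧ → Set
  Fits k a y lims = ∀ h →
    a + total k (cost ∘ get k y) h ≤ proj₁ (get k lims h) × proj₂ (get k lims h) ≤ count (get k y h)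

  assemble-wp : ∀ k {a y lims} → (∀ h → size (get k y h) ≤ N) →
    WP (assemble k) ((a , y , lims) ∷ [])
      (λ r → (∀ {z} → z ∈ˡ r → z ≡ cat k (route ∘ get k y) × Fits k a y lims) ×
             (Fits k a y lims → ∃[ z ] z ∈ˡ r))
  assemble-wp zero l = wp-if
    (λ ca → wp-if
      (λ cb → wp-cons (wp-append (wp-flat (≤-trans (m≤m+n _ _) (l zero) , wp-flat (wp-flat
        ( (λ { (here refl) → refl , (λ { zero → ca , cb }) }) , (λ _ → _ , here refl)))))))
      (λ nb → wp-flat ((λ ()) , (λ f → contradiction (proj₂ (f zero)) (<⇒≱ nb)))))
    (λ na → wp-flat ((λ ()) , (λ f → contradiction (proj₁ (f zero)) (<⇒≱ na))))
  assemble-wp (suc k) {a} {(y@(_ , pre , post) , ys)} {(lim , lims)} l = wp-if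
    (λ ca → wp-if
      (λ cb → wp-case (wp-call (wp-flat (wp-conseq (assemble-wp k {a + cost y} {ys} {lims} (l ∘ suc)) λ r (sound , cmp) →
        (λ { refl → wp-flat ((λ ()) , (λ f → contradiction (proj₂ (cmp (later f))) (λ ()))) }) ,
        (λ { z zs refl → wp-cons (wp-append (wp-append (wp-flat (≤-trans (m≤m+n _ _) (l zero) , wp-flat
          ( ≤-trans (≤-reflexive (length-++ pre)) (l zero)
          , wp-flat (wp-flat
            ( (λ { (here refl) → cong ((pre ++ post) ++_) (proj₁ (sound (here refl))) ,
                   (λ { zero → ca , cb
                      ; (suc h) → subst (_≤ proj₁ (get k lims h)) (+-assoc a _ _) (proj₁ (proj₂ (sound (here refl)) h)) , proj₂ (proj₂ (sound (here refl)) h) }) })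
            , (λ _ → _ , here refl)))))))) })))))
      (λ nb → wp-flat ((λ ()) , (λ f → contradiction (proj₂ (f zero)) (<⇒≱ nb)))))
    (λ na → wp-flat ((λ ()) , (λ f → contradiction (proj₁ (f zero)) (<⇒≱ na))))
    where
    later : Fits (suc k) a (y , ys) (lim , lims) → Fits k (a + cost y) ys lims
    later f h = subst (_≤ proj₁ (get k lims h)) (sym (+-assoc a _ _)) (proj₁ (f (suc h))) , proj₂ (f (suc h))

-- Counting vertices and keys.

sum< : ℕ → (ℕ → ℕ) → ℕ
sum< zero    f = 0
sum< (suc m) f = f 0 + sum< m (f ∘ suc)

sum<-mono : ∀ m {f g : ℕ → ℕ} → (∀ {y} → y < m → f y ≤ g y) → sum< m f ≤ sum< m g
sum<-mono zero    i = z≤n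
sum<-mono (suc m) i = +-mono-≤ (i (s≤s z≤n)) (sum<-mono m (λ l → i (s≤s l)))

sum<-cong : ∀ m {f g : ℕ → ℕ} → (∀ y → f y ≡ g y) → sum< m f ≡ sum< m g
sum<-cong zero    i = refl
sum<-cong (suc m) i = cong₂ _+_ (i 0) (sum<-cong m (i ∘ suc))

sum<-+ : ∀ m (f g : ℕ → ℕ) → sum< m f + sum< m g ≡ sum< m (λ y → f y + g y)
sum<-+ zero    f g = refl
sum<-+ (suc m) f g =
  trans (interchange (f 0) _ (g 0) _) (cong (f 0 + g 0 +_) (sum<-+ m (f ∘ suc) (g ∘ suc)))
  where
  interchange : ∀ a b c d → a + b + (c + d) ≡ a + c + (b + d)
  interchange = solve-∀

sum<-≤ : ∀ m {f : ℕ → ℕ} → (∀ y → f y ≤ 1) → sum< m f ≤ m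
sum<-≤ zero    i = z≤n
sum<-≤ (suc m) i = +-mono-≤ (i 0) (sum<-≤ m (i ∘ suc))

when-≤ : ∀ {P : Set} (d : Dec P) n → when d n ≤ n
when-≤ (yes _) n = ≤-refl
when-≤ (no _)  n = z≤n

when-yes : ∀ {P : Set} (d : Dec P) {n} → P → when d n ≡ n
when-yes (yes _) h = refl
when-yes (no n)  h = contradiction h n

when-no : ∀ {P : Set} (d : Dec P) {n} → ¬ P → when d n ≡ 0
when-no (yes h) n = contradiction h n
when-no (no _)  n = refl

when-mono : ∀ {P : Set} (d : Dec P) {n n′} → n ≤ n′ → when d n ≤ when d n′
when-mono (yes _) h = h
when-mono (no _)  h = z≤n

-- Before any contraction the block of `u` is `u` alone. This lemma and its converse evaluate sums
-- over such a block.
sum<-point : ∀ m {u} (g : ℕ → ℕ) → u < m → g u ≤ sum< m (λ y → when (y ≟ u) (g y))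
sum<-point (suc m) {zero}  g _       = ≤-trans (≤-reflexive (sym (when-yes (0 ≟ 0) refl))) (m≤m+n _ _)
sum<-point (suc m) {suc u} g (s≤s l) =
  ≤-trans (sum<-point m (g ∘ suc) l)
    (≤-trans (sum<-mono m (λ {y} _ → shift y)) (m≤n+m _ _))
  where
  shift : ∀ y → when (y ≟ u) (g (suc y)) ≤ when (suc y ≟ suc u) (g (suc y))
  shift y with y ≟ u
  ... | no _     = z≤n
  ... | yes refl = ≤-reflexive (sym (when-yes (suc y ≟ suc y) refl))

sum<-point⁻ : ∀ m u (g : ℕ → ℕ) → sum< m (λ y → when (y ≟ u) (g y)) ≤ g u
sum<-point⁻ zero    u       g = z≤n
sum<-point⁻ (suc m) zero    g =
  ≤-trans (+-mono-≤ (when-≤ (0 ≟ 0) (g 0)) (≤-trans (sum<-mono m {g = λ _ → 0} (λ _ → z≤n)) (≤-reflexive (zeros m))))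
          (≤-reflexive (+-identityʳ _))
  where
  zeros : ∀ m → sum< m (λ _ → 0) ≡ 0
  zeros zero    = refl
  zeros (suc m) = zeros m
sum<-point⁻ (suc m) (suc u) g =
  +-mono-≤ z≤n
    (≤-trans (sum<-mono m (λ {y} _ → shift y)) (sum<-point⁻ m u (g ∘ suc)))
  where
  shift : ∀ y → when (suc y ≟ suc u) (g (suc y)) ≤ when (y ≟ u) (g (suc y))
  shift y with suc y ≟ suc u
  ... | no _     = z≤n
  ... | yes refl = ≤-reflexive (sym (when-yes (y ≟ y) refl))

record Rooted (m M root : ℕ) (vs : List ℕ) (R : List E3) : Set where
  field
    valid  : Valid R
    edge   : ∀ {x p w} → (x , p , w) ∈ˡ R → x ∈ˡ vs × p ∈ˡ vs × w ≤ M
    vertex : ∀ {v} → v ∈ˡ vs → v < m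
    all    : ∀ {v} → v < m → v ∈ˡ vs
    root∈  : root ∈ˡ vs
    covers : ∀ {v} → v ∈ˡ vs → v ≡ root ⊎ v ∈ˡ children R
    length-vs : length vs ≤ m
    length-R  : length R ≤ m

-- A cost is at most two crossings of fewer than `m` edges of weight at most `M`, and a count is at
-- most `m`.
keyBox : ℕ → ℕ → List ⟦ Key ⟧
keyBox m M = cartesianProduct (upTo 2) (cartesianProduct (upTo (suc (2 * M * m))) (upTo (suc m)))

entryBox : ∀ k → ℕ → ℕ → List (ℕ × ⟦ Tup k Key ⟧)
entryBox k m M = cartesianProduct (upTo m) (tupleBox k {Key} (keyBox m M))

boxSize : ℕ → ℕ → ℕ → ℕ
boxSize k m M = m * (2 * (suc (2 * M * m) * suc m)) ^ suc k

length-entryBox : ∀ k m M → length (entryBox k m M) ≡ boxSize k m M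
length-entryBox k m M =
  trans (length-cartesianProduct (upTo m) (tupleBox k {Key} (keyBox m M))) (cong₂ _*_ (length-upTo m)
    (trans (length-tupleBox k {Key} (keyBox m M)) (cong (_^ suc k)
      (trans (length-cartesianProduct (upTo 2) pairs) (cong (2 *_)
        (trans (length-cartesianProduct costs counts′)
               (cong₂ _*_ (length-upTo (suc (2 * M * m))) (length-upTo (suc m)))))))))
  where
  costs counts′ : List ℕ
  costs  = upTo (suc (2 * M * m))
  counts′ = upTo (suc m)
  pairs : List (ℕ × ℕ)
  pairs = cartesianProduct costs counts′

-- The table for one-vertex blocks.

module Table (N : ℕ) (1≤N : 1 ≤ N) where
  open TupleProcedures N 1≤N public

  wp-seg₀ : ∀ {Γ a} {i : (nat ⊗ nat ⊗ nat ⊗ a) ∈ˡ Γ} {ρ Q} →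
            Q ((0 , 0 , count₀ (eval (fst (var i)) ρ) (eval (fst (snd (var i))) ρ)) , [] , []) →
            WP (seg₀ (var i)) ρ Q
  wp-seg₀ {i = i} {ρ} {Q} q = wp-pair (wp-pair (wp-flat (wp-pair (wp-flat (wp-if
    (λ h → wp-flat (wp-flat (subst (λ n → Q ((0 , 0 , n) , [] , [])) (yes-case h) q)))
    (λ h → wp-flat (wp-flat (subst (λ n → Q ((0 , 0 , n) , [] , [])) (no-case h) q))))))))
    where
    yes-case : ∀ {f v} → 1 ≤ f → count₀ f v ≡ v
    yes-case {f} h with 1 ≤? f
    ... | yes _ = refl
    ... | no n  = contradiction h n
    no-case : ∀ {f v} → f < 1 → count₀ f v ≡ 0
    no-case {f} h with 1 ≤? f
    ... | yes l = contradiction l (<⇒≱ h)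
    ... | no _  = refl

  module _ (R : List E3) (V : List ℕ) where
    open Segments R
    open Trails (Link³ R)

    record Initial (s t u : ℕ) (L : List ℕ) (y : ⟦ Seg ⟧) : Set where
      field
        good   : Good s t s t u y
        free   : cost y ≡ 0
        short  : size y ≤ 1
        counts : count y ≤ seen V L u

    -- `L` holds the vertices visited by earlier segments. Counts must not exceed what the walks of
    -- the entry itself visit; in `InitMatch` they must not fall below what the compared walks `W`
    -- visit.
    InitSound : ∀ k → ℕ → ⟦ Tup k (nat ⊗ nat) ⟧ → List ℕ → ⟦ Tup k Seg ⟧ → Set
    InitSound k u ST L y = ∀ h →
      Initial (proj₁ (get k ST h)) (proj₂ (get k ST h)) u (L ++ upTill k (route ∘ get k y) h) (get k y h)

    InitMatch : ∀ k → ℕ → List ℕ → (Fin (suc k) → List ℕ) → ⟦ Tup k Seg ⟧ → Set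
    InitMatch k u L W y = ∀ h → bit (get k y h) ≡ mark (W h) u × cost (get k y h) ≡ 0 ×
                                seen V (L ++ upTill k W h) u ≤ count (get k y h)

    InitPost : ∀ k → ℕ → ℕ → ⟦ Tup k (nat ⊗ nat) ⟧ → List ⟦ Tup k Seg ⟧ → Set
    InitPost k f u ST r =
      length r ≤ 2 ^ suc k ×
      (∀ {L} → Flag (u ∈ˡ L) f → ∀ {y} → y ∈ˡ r → InitSound k u ST L y) ×
      (∀ {L W} → Flag (u ∈ˡ L) f → (∀ h → proj₁ (get k ST h) ≡ u → u ∈ˡ W h) →
                 (∀ h → proj₂ (get k ST h) ≡ u → u ∈ˡ W h) → ∃[ y ] y ∈ˡ r × InitMatch k u L W y)

    seen-V : ∀ {u v L} → Flag (u ∈ˡ V) v → seen V L u ≤ v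
    seen-V {u} {L = L} (inj₁ (refl , i)) = seen-≤1 V L u
    seen-V {u} (inj₂ (refl , n)) = ≤-reflexive (when-no (u ∈ˡ? V) n)

    V-seen : ∀ {u v L} → Flag (u ∈ˡ V) v → u ∈ˡ L → v ≤ seen V L u
    V-seen {u} {L = L} (inj₁ (refl , i)) j =
      ≤-reflexive (sym (trans (when-yes (u ∈ˡ? V) i) (mark-yes L j)))
    V-seen (inj₂ (refl , n)) j = z≤n

    seen-∉ : ∀ {u L} → u ∉ L → seen V L u ≡ 0
    seen-∉ {u} {L} n with u ∈ˡ? V
    ... | yes _ = mark-no L n
    ... | no _  = refl

    count₀-≤ : ∀ {f u v L L′} → Flag (u ∈ˡ V) v → Flag (u ∈ˡ L) f → count₀ f v ≤ seen V (L ++ L′) u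
    count₀-≤ fv (inj₁ (refl , i)) = V-seen fv (∈-++⁺ˡ i)
    count₀-≤ fv (inj₂ (refl , n)) = z≤n

    ≤-count₀ : ∀ {f u v L L′} → Flag (u ∈ˡ V) v → Flag (u ∈ˡ L) f → u ∉ L′ → seen V (L ++ L′) u ≤ count₀ f v
    ≤-count₀ {L = L} {L′} fv (inj₁ (refl , i)) n = seen-V {L = L ++ L′} fv
    ≤-count₀ {L = L} fv (inj₂ (refl , n′)) n =
      ≤-reflexive (seen-∉ (λ i → [ n′ , n ] (∈-++⁻ L i)))

    extend : ∀ {f} {u : ℕ} {L L′ : List ℕ} → Flag (u ∈ˡ L) f → u ∉ L′ → Flag (u ∈ˡ L ++ L′) f
    extend         (inj₁ (e , i)) n  = inj₁ (e , ∈-++⁺ˡ i)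
    extend {L = L} (inj₂ (e , n)) n′ = inj₂ (e , λ i → [ n , n′ ] (∈-++⁻ L i))

    σ₁ : ℕ → ℕ → ⟦ Seg ⟧
    σ₁ v u = (1 , 0 , v) , [] , u ∷ []

    σ₀ : ℕ → ℕ → ⟦ Seg ⟧
    σ₀ f v = (0 , 0 , count₀ f v) , [] , []

    start-seen : ∀ s u → Seen s s u u
    start-seen s u with s ≟ u
    ... | yes refl = in-block refl
    ... | no n     = off-block n

    sound₁ : ∀ {s t u v} L → Flag (u ∈ˡ V) v → Initial s t u (L ++ u ∷ []) (σ₁ v u)
    sound₁ {s} {t} {u} L fv = record
      { good = through (start-seen s u) (start-seen t u) [] stop refl
      ; free = refl ; short = ≤-refl ; counts = V-seen fv (∈-++⁺ʳ L (here refl)) }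

    sound₀ : ∀ {s t u f v L} → s ≢ u → t ≢ u → Flag (u ∈ˡ V) v → Flag (u ∈ˡ L) f →
             Initial s t u (L ++ []) (σ₀ f v)
    sound₀ n n′ fv fL = record
      { good = absent n n′ refl refl refl ; free = refl ; short = z≤n ; counts = count₀-≤ fv fL }

    match₁ : ∀ {u v} L L′ → Flag (u ∈ˡ V) v → u ∈ˡ L′ → 1 ≡ mark L′ u × 0 ≡ 0 × seen V (L ++ L′) u ≤ v
    match₁ L L′ fv i = sym (mark-yes L′ i) , refl , seen-V {L = L ++ L′} fv

    match₀ : ∀ {f u v} L L′ → Flag (u ∈ˡ V) v → Flag (u ∈ˡ L) f → u ∉ L′ →
             0 ≡ mark L′ u × 0 ≡ 0 × seen V (L ++ L′) u ≤ count₀ f v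
    match₀ L L′ fv fL n = sym (mark-no L′ n) , refl , ≤-count₀ fv fL n

    cons-sound : ∀ k {u st ST L y ys} → Initial (proj₁ st) (proj₂ st) u (L ++ route y) y →
                 InitSound k u ST (L ++ route y) ys → InitSound (suc k) u (st , ST) L (y , ys)
    cons-sound k i is zero    = i
    cons-sound k {u} {ST = ST} {L} {y} {ys} i is (suc h) =
      subst (λ L → Initial _ _ u L (get k ys h)) (++-assoc L (route y) _) (is h)

    cons-match : ∀ k {u L} {W : Fin (suc (suc k)) → List ℕ} {y ys} →
                 bit y ≡ mark (W zero) u × cost y ≡ 0 × seen V (L ++ W zero) u ≤ count y →
                 InitMatch k u (L ++ W zero) (W ∘ suc) ys → InitMatch (suc k) u L W (y , ys)
    cons-match k i is zero = i
    cons-match k {u} {L} {W} {y} {ys} i is (suc h) =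
      let a , b , c = is h
      in a , b , subst (λ L → seen V L u ≤ count (get k ys h)) (++-assoc L (W zero) _) c

    -- The choice that matches `W` lets segment `h` visit `u` iff `u` is in `W h`. As the compared
    -- walks contain their terminals, the choices that the program omits never arise. Two choices
    -- per segment give the power of 2.
    initSegs-wp : ∀ k {f v u ST} → Flag (u ∈ˡ V) v → 2 ^ suc k ≤ N →
                  WP (initSegs k) ((f , v , u , ST) ∷ []) (InitPost k f u ST)
    initSegs-wp zero {f} {v} {u} {s , t} fv _ = wp-ifEq
      (λ es → wp-flat (only λ {W} i j → i es))
      (λ ns → wp-ifEq
        (λ et → wp-flat (only λ {W} i j → j et))
        (λ nt → wp-cons (wp-flat (wp-cons (wp-seg₀ (wp-flat
          ( ≤-refl
          , (λ { {L} fL (here refl) zero → sound₁ L fv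
               ; {L} fL (there (here refl)) zero → sound₀ ns nt fv fL })
          , (λ {L} {W} fL i j → choose {L} {W} fL)))))))
        )
      where
      only : (∀ {W : Fin 1 → List ℕ} → (s ≡ u → u ∈ˡ W zero) → (t ≡ u → u ∈ˡ W zero) → u ∈ˡ W zero) →
             InitPost 0 f u (s , t) (σ₁ v u ∷ [])
      only i = s≤s z≤n
             , (λ { {L} fL (here refl) zero → sound₁ L fv })
             , (λ {L} {W} fL a b → _ , here refl , λ { zero → match₁ L (W zero) fv (i {W} (a zero) (b zero)) })
      choose : ∀ {L} {W : Fin 1 → List ℕ} → Flag (u ∈ˡ L) f →
               ∃[ y ] y ∈ˡ (σ₁ v u ∷ σ₀ f v ∷ []) × InitMatch 0 u L W y
      choose {L} {W} fL with u ∈ˡ? W zero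
      ... | yes i = _ , here refl , λ { zero → match₁ L (W zero) fv i }
      ... | no n  = _ , there (here refl) , λ { zero → match₀ L (W zero) fv fL n }
    initSegs-wp (suc k) {f} {v} {u} {(s , t) , ST} fv l =
      wp-let (wp-call (wp-flat (wp-conseq (initSegs-wp k {1} {v} {u} {ST} fv lk) λ r₁ post₁ →
        wp-let (wp-fold (λ ys acc → acc ≡ map (σ₁ v u ,_) ys)
          (wp-flat (≤-trans (proj₁ post₁) lk , wp-flat refl ,
            (λ _ y ys acc _ e → wp-flat (cong (_ ∷_) e)) ,
            (λ { acc refl → wp-ifEq
              (λ es → wp-flat (only post₁ λ {W} i j → i es))
              (λ ns → wp-ifEq
                (λ et → wp-flat (only post₁ λ {W} i j → j et))
                (λ nt → wp-let (wp-call (wp-flat (wp-conseq (initSegs-wp k {f} {v} {u} {ST} fv lk) λ r₀ post₀ →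
                  wp-fold (λ ys acc → acc ≡ map (σ₀ f v ,_) ys ++ map (σ₁ v u ,_) r₁)
                    (wp-flat (≤-trans (proj₁ post₀) lk , wp-flat refl ,
                      (λ _ y ys acc _ e → wp-cons (wp-pair (wp-seg₀ (wp-flat (wp-flat (cong (_ ∷_) e)))))) ,
                      (λ { acc refl → either ns nt post₁ post₀ })))))))) })))))))
      where
      lk : 2 ^ suc k ≤ N
      lk = ≤-trans (^-monoʳ-≤ 2 {suc k} {suc (suc k)} (n≤1+n (suc k))) l

      sound-in₁ : ∀ {r₁ L y} → InitPost k 1 u ST r₁ → y ∈ˡ map (σ₁ v u ,_) r₁ →
                  InitSound (suc k) u ((s , t) , ST) L y
      sound-in₁ {L = L} (_ , snd₁ , _) i with ∈-map⁻ (σ₁ v u ,_) i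
      ... | ys , j , refl = cons-sound k (sound₁ L fv) (snd₁ (inj₁ (refl , ∈-++⁺ʳ L (here refl))) j)

      match-in₁ : ∀ {r₁ L W} → InitPost k 1 u ST r₁ → u ∈ˡ W zero →
                  (∀ h → proj₁ (get k ST h) ≡ u → u ∈ˡ W (suc h)) →
                  (∀ h → proj₂ (get k ST h) ≡ u → u ∈ˡ W (suc h)) →
                  ∃[ y ] y ∈ˡ map (σ₁ v u ,_) r₁ × InitMatch (suc k) u L W y
      match-in₁ {L = L} {W} (_ , _ , cmp₁) i a b =
        let ys , j , q = cmp₁ {L ++ W zero} {W ∘ suc} (inj₁ (refl , ∈-++⁺ʳ L i)) a b
        in _ , ∈-map⁺ _ j , cons-match k (match₁ L (W zero) fv i) q

      double : ∀ {a b} → a ≤ 2 ^ suc k → b ≤ 2 ^ suc k → a + b ≤ 2 ^ suc (suc k)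
      double p q = ≤-trans (+-mono-≤ p q) (≤-reflexive (cong (2 ^ suc k +_) (sym (+-identityʳ _))))

      only : ∀ {r₁} → InitPost k 1 u ST r₁ →
             (∀ {W : Fin (suc (suc k)) → List ℕ} → (s ≡ u → u ∈ˡ W zero) → (t ≡ u → u ∈ˡ W zero) → u ∈ˡ W zero) →
             InitPost (suc k) f u ((s , t) , ST) (map (σ₁ v u ,_) r₁)
      only {r₁} post₁ i =
        subst (_≤ 2 ^ suc (suc k)) (sym (length-map _ r₁)) (≤-trans (m≤m+n _ 0) (double (proj₁ post₁) z≤n)) ,
        (λ _ j → sound-in₁ post₁ j) ,
        (λ {L} {W} fL a b → match-in₁ {L = L} {W} post₁ (i {W} (a zero) (b zero)) (a ∘ suc) (b ∘ suc))

      either : ∀ {r₁ r₀} → s ≢ u → t ≢ u → InitPost k 1 u ST r₁ → InitPost k f u ST r₀ →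
               InitPost (suc k) f u ((s , t) , ST) (map (σ₀ f v ,_) r₀ ++ map (σ₁ v u ,_) r₁)
      either {r₁} {r₀} ns nt post₁ (l₀ , snd₀ , cmp₀) =
        subst (_≤ 2 ^ suc (suc k))
              (sym (trans (length-++ (map _ r₀)) (cong₂ _+_ (length-map _ r₀) (length-map _ r₁))))
              (double l₀ (proj₁ post₁)) ,
        (λ {L} fL j → sound-both {L} fL (∈-++⁻ (map (σ₀ f v ,_) r₀) j)) ,
        (λ {L} {W} fL a b → match-both {L} {W} fL a b)
        where
        sound-both : ∀ {L} → Flag (u ∈ˡ L) f → ∀ {y} → y ∈ˡ map (σ₀ f v ,_) r₀ ⊎ y ∈ˡ map (σ₁ v u ,_) r₁ →
                     InitSound (suc k) u ((s , t) , ST) L y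
        sound-both fL (inj₂ j) = sound-in₁ post₁ j
        sound-both {L} fL (inj₁ j) with ∈-map⁻ (σ₀ f v ,_) j
        ... | ys , j′ , refl = cons-sound k (sound₀ ns nt fv fL) (snd₀ {L ++ []} (extend {L = L} {[]} fL (λ ())) j′)
        match-both : ∀ {L} {W : Fin (suc (suc k)) → List ℕ} → Flag (u ∈ˡ L) f →
                     (∀ h → proj₁ (get (suc k) ((s , t) , ST) h) ≡ u → u ∈ˡ W h) →
                     (∀ h → proj₂ (get (suc k) ((s , t) , ST) h) ≡ u → u ∈ˡ W h) →
                     ∃[ y ] y ∈ˡ (map (σ₀ f v ,_) r₀ ++ map (σ₁ v u ,_) r₁) × InitMatch (suc k) u L W y
        match-both {L} {W} fL a b with u ∈ˡ? W zero
        ... | yes i = let y , j , q = match-in₁ {L = L} {W} post₁ i (a ∘ suc) (b ∘ suc)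
                      in y , ∈-++⁺ʳ _ j , q
        ... | no n  = let ys , j , q = cmp₀ {L ++ W zero} {W ∘ suc} (extend fL n) (a ∘ suc) (b ∘ suc)
                      in _ , ∈-++⁺ˡ (∈-map⁺ (σ₀ f v ,_) j) , cons-match k {L = L} {W} (match₀ L (W zero) fv fL n) q

-- The table during contraction.

-- What `N` has to exceed: the walks in a block, the table, and the candidates before deduplication.
-- `start` fits the initial table into the bound for all later ones.
record Room (k m M N : ℕ) : Set where
  field
    double : 2 * m ≤ N
    box    : boxSize k m M ≤ N
    square : boxSize k m M * boxSize k m M ≤ N
    start  : m * 2 ^ suc k ≤ boxSize k m M

module Blocks (m : ℕ) where

  blockSum : List E3 → ℕ → (ℕ → ℕ) → ℕ
  blockSum Q u g = sum< m (λ y → when (rep Q y ≟ u) (g y))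

  blockSum-mono : ∀ {Q u f g} → (∀ y → f y ≤ g y) → blockSum Q u f ≤ blockSum Q u g
  blockSum-mono {Q} {u} i = sum<-mono m (λ {y} _ → when-mono (rep Q y ≟ u) (i y))

  blockSum-≤ : ∀ Q u g → blockSum Q u g ≤ sum< m g
  blockSum-≤ Q u g = sum<-mono m (λ {y} _ → when-≤ (rep Q y ≟ u) (g y))

  blockSum-merge : ∀ Q {x p} w g → p ≢ x →
                   blockSum Q p g + blockSum Q x g ≡ blockSum ((x , p , w) ∷ Q) p g
  blockSum-merge Q {x} {p} w g p≢x =
    trans (sum<-+ m _ _) (sum<-cong m (λ y → pointwise (rep Q y) (g y)))
    where
    pointwise : ∀ r n → when (r ≟ p) n + when (r ≟ x) n ≡ when (contract x p r ≟ p) n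
    pointwise r n with r ≟ x
    ... | yes refl = trans (cong (_+ n) (when-no (r ≟ p) (p≢x ∘ sym))) (sym (when-yes (p ≟ p) refl))
    ... | no _     = +-identityʳ _

  blockSum-keep : ∀ Q {x p} w {u} g → u ≢ x → u ≢ p →
                  blockSum ((x , p , w) ∷ Q) u g ≡ blockSum Q u g
  blockSum-keep Q {x} {p} w {u} g u≢x u≢p = sum<-cong m (λ y → pointwise (rep Q y) (g y))
    where
    pointwise : ∀ r n → when (contract x p r ≟ u) n ≡ when (r ≟ u) n
    pointwise r n with r ≟ x
    ... | yes refl = trans (when-no (p ≟ u) (u≢p ∘ sym)) (sym (when-no (r ≟ u) (u≢x ∘ sym)))
    ... | no _     = refl

module Solve (N : ℕ) (1≤N : 1 ≤ N) (k m M root : ℕ) (vs : List ℕ) (R : List E3) (rooted : Rooted m M root vs R)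
             (V : List ℕ) (V≤N : length V ≤ N) (room : Room k m M N)
             (ST₀ lims : ⟦ Tup k (nat ⊗ nat) ⟧) where
  open Table N 1≤N public
  open Segments R
  open Trails (Link³ R)
  open Blocks m
  open Rooted rooted
  open Room room

  s t : Fin (suc k) → ℕ
  s h = proj₁ (get k ST₀ h)
  t h = proj₂ (get k ST₀ h)

  visits : (Fin (suc k) → List ℕ) → Fin (suc k) → ℕ → ℕ
  visits W h = seen V (upTill k W h)

  record Feasible (W : Fin (suc k) → List ℕ) (c : Fin (suc k) → ℕ) : Set where
    field
      trail   : ∀ h → Trail (s h) (W h) (t h) (c h)
      in-time : ∀ h → total k c h ≤ proj₁ (get k lims h)
      enough  : ∀ h → proj₂ (get k lims h) ≤ sum< m (visits W h)

  -- A block of b vertices has b - 1 edges, each crossed at most twice by a segment. So costs are at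
  -- most 2 M (b - 1) and walks list at most 2 b - 1 vertices; with the subtracted terms moved to
  -- the left, both bounds simply add up under merging.
  record GoodEntry (Q : List E3) (u : ℕ) (y : ⟦ Tup k Seg ⟧) : Set where
    field
      good   : ∀ h → Good (rep Q (s h)) (rep Q (t h)) (s h) (t h) u (get k y h)
      cost≤  : ∀ h → cost (get k y h) + 2 * M ≤ 2 * M * blockSum Q u (λ _ → 1)
      size≤  : ∀ h → suc (size (get k y h)) ≤ 2 * blockSum Q u (λ _ → 1)
      count≤ : ∀ h → count (get k y h) ≤ blockSum Q u (visits (route ∘ get k y) h)

  Sound : List E3 → List ⟦ Entry k ⟧ → Set
  Sound Q F = ∀ {u y} → (u , y) ∈ˡ F → u ∈ˡ vs × u ∉ children Q × GoodEntry Q u y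

  -- Stated for the key of an entry, hence invariant under deduplication
  Matches : ∀ {W c} → Feasible W c → List E3 → ℕ → ⟦ Tup k Key ⟧ → Set
  Matches {W} f Q u κ = ∀ h →
    proj₁ (get k κ h) ≡ mark (W h) u ×
    proj₁ (proj₂ (get k κ h)) ≤ inside Q u (Feasible.trail f h) ×
    blockSum Q u (visits W h) ≤ proj₂ (proj₂ (get k κ h))

  -- The exchange argument: an entry is only compared with a feasible family, by equal bits, no
  -- greater costs and no smaller counts, and may come from entirely different walks.
  Matched : List E3 → List ⟦ Entry k ⟧ → Set
  Matched Q F = ∀ {W c} (f : Feasible W c) {u} → u ∈ˡ vs → u ∉ children Q →
                ∃[ y ] (u , y) ∈ˡ F × Matches f Q u (keys k y)

  record Inv (Q : List E3) (state : ⟦ State k ⟧) : Set where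
    field
      terminals : ∀ h → get k (proj₂ state) h ≡ (rep Q (s h) , rep Q (t h))
      sound     : Sound Q (proj₁ state)
      small     : length (proj₁ state) ≤ boxSize k m M
      matched   : Matched Q (proj₁ state)

  block≤m : ∀ Q u → blockSum Q u (λ _ → 1) ≤ m
  block≤m Q u = ≤-trans (blockSum-≤ Q u _) (sum<-≤ m (λ _ → ≤-refl))

  bit≤1 : ∀ {rs rt s t u y} → Good rs rt s t u y → bit y ≤ 1
  bit≤1 (through _ _ _ _ _) = ≤-refl
  bit≤1 (complete _ _ _)    = z≤n
  bit≤1 (absent _ _ _ _ _)  = z≤n

  in-box : ∀ {Q u y} → u ∈ˡ vs → GoodEntry Q u y → code {k} (u , y) ∈ˡ entryBox k m M
  in-box {Q} {u} {y} u∈ g = ∈-cartesianProduct⁺ (∈-upTo⁺ (vertex u∈))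
    (∈-tupleBox k {Key} (keyBox m M) (keys k y) λ h → subst (_∈ˡ keyBox m M) (sym (get-keys k y h))
      (∈-cartesianProduct⁺ (∈-upTo⁺ (s≤s (bit≤1 (good h))))
        (∈-cartesianProduct⁺
          (∈-upTo⁺ (s≤s (≤-trans (≤-trans (m≤m+n _ _) (cost≤ h)) (*-monoʳ-≤ (2 * M) (block≤m Q u)))))
          (∈-upTo⁺ (s≤s (≤-trans (count≤ h) (≤-trans (blockSum-≤ Q u _) (sum<-≤ m (seen-≤1 V _)))))))))
    where open GoodEntry g

  initTable-wp : WP (initTable k) ((V , vs , ST₀) ∷ []) (λ F → Inv [] (F , ST₀))
  initTable-wp = wp-fold
    (λ ys acc → length acc ≤ length ys * 2 ^ suc k ×
      (∀ {u y} → (u , y) ∈ˡ acc → u ∈ˡ vs × InitSound R V k u ST₀ [] y) ×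
      (∀ {u W} → u ∈ˡ ys → (∀ h → s h ≡ u → u ∈ˡ W h) → (∀ h → t h ≡ u → u ∈ˡ W h) →
        ∃[ y ] (u , y) ∈ˡ acc × InitMatch R V k u [] W y))
    (wp-flat ( ≤-trans length-vs m≤N , wp-flat (z≤n , (λ ()) , (λ ()))
    , (λ zs u ys acc split (l , snds , cmp) →
        let u∈ = subst (u ∈ˡ_) split (∈-++⁺ʳ zs (here refl)) in
        wp-let (wp-member (wp-flat (wp-flat (V≤N , λ v fv →
          wp-fold (λ zs acc′ → length acc′ ≤ length zs + length acc ×
                     (∀ {e} → e ∈ˡ acc′ → (proj₁ e ≡ u × InitSound R V k u ST₀ [] (proj₂ e)) ⊎ e ∈ˡ acc) ×
                     (∀ {z} → z ∈ˡ zs → (u , z) ∈ˡ acc′) ×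
                     (∀ {e} → e ∈ˡ acc → e ∈ˡ acc′))
            (wp-call (wp-flat (wp-conseq (initSegs-wp R V k fv 2^k≤N) λ r (lr , sndr , cmpr) →
              ≤-trans lr 2^k≤N , wp-flat (≤-refl , inj₂ , (λ ()) , id)
              , (λ zs z ys acc′ split′ (l′ , snds′ , new′ , old′) → wp-flat
                  ( s≤s l′
                  , (λ { (here refl) → inj₁ (refl , sndr (inj₂ (refl , λ ())) (subst (z ∈ˡ_) split′ (∈-++⁺ʳ zs (here refl))))
                       ; (there i) → snds′ i })
                  , (λ { (here refl) → here refl ; (there i) → there (new′ i) })
                  , (λ i → there (old′ i))))
              , (λ acc′ (l′ , snds′ , new′ , old′) →
                  ≤-trans l′ (+-mono-≤ lr l)
                  , (λ i → [ (λ { (refl , q) → u∈ , q }) , snds ] (snds′ i))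
                  , (λ { (here refl) a b → let y , i , q = cmpr (inj₂ (refl , λ ())) a b in y , new′ i , q
                       ; (there j) a b → let y , i , q = cmp j a b in y , old′ i , q })))))
          )))))
    , (λ F (l , snds , cmp) → record
        { terminals = λ h → refl
        ; sound     = λ i → let u∈ , q = snds i in u∈ , (λ ()) , initial (vertex u∈) q
        ; small     = ≤-trans l (≤-trans (*-monoˡ-≤ (2 ^ suc k) length-vs) start)
        ; matched   = λ {W} f {u} u∈ _ →
            let y , i , q = cmp {u} {W} u∈ (λ h e → subst (_∈ˡ W h) e (trail-first (Feasible.trail f h)))
                                           (λ h e → subst (_∈ˡ W h) e (trail-last (Feasible.trail f h)))
            in y , i , λ h → subst (Compares f u h) (sym (get-keys k y h))
                 (let a , b , c = q h in
                  a , ≤-trans (≤-reflexive b) z≤n , ≤-trans (sum<-point⁻ m u (visits W h)) c)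
        })))
    where
    Compares : ∀ {W c} (f : Feasible W c) (u : ℕ) (h : Fin (suc k)) → ⟦ Key ⟧ → Set
    Compares {W} f u h κ = proj₁ κ ≡ mark (W h) u × proj₁ (proj₂ κ) ≤ inside [] u (Feasible.trail f h) ×
                           blockSum [] u (visits W h) ≤ proj₂ (proj₂ κ)
    m≤N : m ≤ N
    m≤N = ≤-trans (m≤m+n m _) double
    1≤m : 1 ≤ m
    1≤m = ≤-trans (s≤s z≤n) (vertex root∈)
    2^k≤N : 2 ^ suc k ≤ N
    2^k≤N = ≤-trans (≤-trans (m≤n*m _ m ⦃ >-nonZero 1≤m ⦄) start) box
    initial : ∀ {u y} → u < m → InitSound R V k u ST₀ [] y → GoodEntry [] u y
    initial {u} {y} u<m i = record
      { good   = λ h → Initial.good (i h)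
      ; cost≤  = λ h → subst (λ c → c + 2 * M ≤ 2 * M * blockSum [] u (λ _ → 1)) (sym (Initial.free (i h)))
                   (≤-trans (≤-reflexive (sym (*-identityʳ (2 * M)))) (*-monoʳ-≤ (2 * M) one))
      ; size≤  = λ h → ≤-trans (s≤s (Initial.short (i h))) (*-monoʳ-≤ 2 one)
      ; count≤ = λ h → ≤-trans (Initial.counts (i h)) (sum<-point m (visits (route ∘ get k y) h) u<m)
      }
      where
      one : 1 ≤ blockSum [] u (λ _ → 1)
      one = sum<-point m (λ _ → 1) u<m

  module Step (zs : List E3) (x p w : ℕ) (Q : List E3) (R≡ : zs ++ (x , p , w) ∷ Q ≡ R) where
    open Cut zs x p w Q R≡ valid

    Q⁺ : List E3
    Q⁺ = (x , p , w) ∷ Q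

    e∈ : (x , p , w) ∈ˡ R
    e∈ = subst ((x , p , w) ∈ˡ_) R≡ (∈-++⁺ʳ zs (here refl))

    w≤M : w ≤ M
    w≤M = proj₂ (proj₂ (edge e∈))

    x∉Q : x ∉ children Q
    x∉Q with valid-suffix zs {Q⁺} (subst Valid (sym R≡) valid)
    ... | (n , _ , _) ∷ _ = n

    p∉Q⁺ : p ∉ children Q⁺
    p∉Q⁺ with valid-suffix zs {Q⁺} (subst Valid (sym R≡) valid)
    ... | (_ , n , n′) ∷ _ = λ { (here e) → n e ; (there i) → n′ i }

    avoid⁺ : ∀ {u} → u ∉ children Q → u ≢ x → u ∉ children Q⁺
    avoid⁺ n ne (here e)  = ne e
    avoid⁺ n ne (there i) = n i

    -- The contraction leaves all other blocks unchanged, and a terminal that moves from `x` to `p`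
    -- stays outside the block of `u`.
    kept : ∀ {u y} → u ≢ x → u ≢ p → GoodEntry Q u y → GoodEntry Q⁺ u y
    kept {u} {y} u≢x u≢p g = record
      { good   = λ h → transport (get k y h) (GoodEntry.good g h)
      ; cost≤  = λ h → ≤-trans (GoodEntry.cost≤ g h) (≤-reflexive (cong (2 * M *_) (sym (same _))))
      ; size≤  = λ h → ≤-trans (GoodEntry.size≤ g h) (≤-reflexive (cong (2 *_) (sym (same _))))
      ; count≤ = λ h → ≤-trans (GoodEntry.count≤ g h) (≤-reflexive (sym (same _)))
      }
      where
      same : ∀ f → blockSum Q⁺ u f ≡ blockSum Q u f
      same f = blockSum-keep Q w f u≢x u≢p
      moved : ∀ {r} → r ≡ u → contract x p r ≡ u
      moved {r} refl = contract-≢ u≢x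
      moved⁻ : ∀ {r} → contract x p r ≡ u → r ≡ u
      moved⁻ {r} e with r ≟ x
      ... | yes _ = contradiction (sym e) u≢p
      ... | no _  = e
      see : ∀ {r s a} → Seen r s u a → Seen (contract x p r) s u a
      see (in-block e)  = in-block (moved e)
      see (off-block n) = off-block (n ∘ moved⁻)
      transport : ∀ {rs rt s t} y → Good rs rt s t u y → Good (contract x p rs) (contract x p rt) s t u y
      transport _ (through sa sz π τ e)  = through (see sa) (see sz) π τ e
      transport _ (complete e e′ τ)      = complete (moved e) (moved e′) τ
      transport _ (absent n n′ a b c)    = absent (n ∘ moved⁻) (n′ ∘ moved⁻) a b c

    module _ {ST : ⟦ Tup k (nat ⊗ nat) ⟧} (terms : ∀ h → get k ST h ≡ (rep Q (s h) , rep Q (t h))) where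

      MergedAt : (P X y : ⟦ Tup k Seg ⟧) → Set
      MergedAt = MergedAll parent≢ (up e∈) (down e∈) k s t ST

      merged : ∀ {P X y} → GoodEntry Q p P → GoodEntry Q x X → MergedAt P X y → GoodEntry Q⁺ p y
      merged {P} {X} {y} gP gX mg = record
        { good   = λ h → Merged.good (at h)
        -- Each of the two blocks has a slack of `2 * M`: one pays for crossing the new edge twice,
        -- the other remains.
        ; cost≤  = λ h → begin
            cost (get k y h) + 2 * M
              ≤⟨ +-monoˡ-≤ (2 * M) (Merged.cost≤ (at h)) ⟩
            cost (get k P h) + cost (get k X h) + (w + w) + 2 * M
              ≤⟨ +-monoˡ-≤ (2 * M) (+-monoʳ-≤ (cost (get k P h) + cost (get k X h)) (+-mono-≤ w≤M w≤M)) ⟩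
            cost (get k P h) + cost (get k X h) + (M + M) + 2 * M
              ≡⟨ arith (cost (get k P h)) (cost (get k X h)) M ⟩
            (cost (get k P h) + 2 * M) + (cost (get k X h) + 2 * M)
              ≤⟨ +-mono-≤ (GoodEntry.cost≤ gP h) (GoodEntry.cost≤ gX h) ⟩
            2 * M * blockSum Q p (λ _ → 1) + 2 * M * blockSum Q x (λ _ → 1)
              ≡⟨ sym (*-distribˡ-+ (2 * M) (blockSum Q p (λ _ → 1)) _) ⟩
            2 * M * (blockSum Q p (λ _ → 1) + blockSum Q x (λ _ → 1))
              ≡⟨ cong (2 * M *_) (blockSum-merge Q w (λ _ → 1) parent≢) ⟩
            2 * M * blockSum Q⁺ p (λ _ → 1) ∎
        ; size≤  = λ h → begin
            suc (size (get k y h))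
              ≤⟨ s≤s (Merged.size≤ (at h)) ⟩
            suc (suc (size (get k P h) + size (get k X h)))
              ≡⟨ cong suc (sym (+-suc (size (get k P h)) _)) ⟩
            suc (size (get k P h)) + suc (size (get k X h))
              ≤⟨ +-mono-≤ (GoodEntry.size≤ gP h) (GoodEntry.size≤ gX h) ⟩
            2 * blockSum Q p (λ _ → 1) + 2 * blockSum Q x (λ _ → 1)
              ≡⟨ sym (*-distribˡ-+ 2 (blockSum Q p (λ _ → 1)) _) ⟩
            2 * (blockSum Q p (λ _ → 1) + blockSum Q x (λ _ → 1))
              ≡⟨ cong (2 *_) (blockSum-merge Q w (λ _ → 1) parent≢) ⟩
            2 * blockSum Q⁺ p (λ _ → 1) ∎
        ; count≤ = λ h → begin
            count (get k y h)
              ≡⟨ Merged.count≡ (at h) ⟩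
            count (get k P h) + count (get k X h)
              ≤⟨ +-mono-≤ (GoodEntry.count≤ gP h) (GoodEntry.count≤ gX h) ⟩
            blockSum Q p (visits (route ∘ get k P) h) + blockSum Q x (visits (route ∘ get k X) h)
              ≤⟨ +-mono-≤ (blockSum-mono {Q} {p} (λ v → seen-mono {V} {upTill k (route ∘ get k P) h} {upTill k (route ∘ get k y) h} {v} (upTill-mono k (λ h → Merged.fromP (mg h)) h)))
                          (blockSum-mono {Q} {x} (λ v → seen-mono {V} {upTill k (route ∘ get k X) h} {upTill k (route ∘ get k y) h} {v} (upTill-mono k (λ h → Merged.fromX (mg h)) h))) ⟩
            blockSum Q p (visits (route ∘ get k y) h) + blockSum Q x (visits (route ∘ get k y) h)
              ≡⟨ blockSum-merge Q w (visits (route ∘ get k y) h) parent≢ ⟩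
            blockSum Q⁺ p (visits (route ∘ get k y) h) ∎
        }
        where
        open ≤-Reasoning
        arith : ∀ a b M → a + b + (M + M) + 2 * M ≡ a + 2 * M + (b + 2 * M)
        arith = solve-∀
        at : ∀ h → Merged x p w (rep Q (s h)) (rep Q (t h)) (s h) (t h) (get k P h) (get k X h) (get k y h)
        at h = subst (λ st → Merged x p w (proj₁ st) (proj₂ st) (s h) (t h) (get k P h) (get k X h) (get k y h))
                     (terms h) (mg h)

      -- Equal bits translate visits of the trail to `x` and `p` into bits of `X` and `P`; the four
      -- demands are then the four lower bounds of `Cut`.
      demand : ∀ {W c} (f : Feasible W c) {P X} → Matches f Q p (keys k P) → Matches f Q x (keys k X) →
               DemandAll parent≢ (up e∈) (down e∈) k ST P X (λ h → crossing Q x (Feasible.trail f h))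
      demand {W} f {P} {X} mP mX h =
        subst (λ st → Demand (proj₁ st) (proj₂ st) x (bit (get k P h)) (bit (get k X h)) w (crossing Q x τ))
              (sym (terms h)) (record
          { neither = λ ns nt b → let d , _ , p∈ = enter-return τ ns nt (x∈ b) rep-x in bP p∈ , d
          ; starts  = λ es nt → let d , x∈ , p∈ = leave τ es nt in bP p∈ , bX x∈ , d
          ; ends    = λ ns et → let d , x∈ , p∈ = enter τ ns et in bP p∈ , bX x∈ , d
          ; closed  = λ es et b → let d , x∈ , _ = leave-return τ es et (p∈ b) (λ e → parent≢ (trans (sym rep-p) e)) in bX x∈ , d
          })
        where
        τ : Trail (s h) (W h) (t h) _
        τ = Feasible.trail f h
        bitP : bit (get k P h) ≡ mark (W h) p
        bitP = trans (cong proj₁ (sym (get-keys k P h))) (proj₁ (mP h))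
        bitX : bit (get k X h) ≡ mark (W h) x
        bitX = trans (cong proj₁ (sym (get-keys k X h))) (proj₁ (mX h))
        x∈ : bit (get k X h) ≡ 1 → x ∈ˡ W h
        x∈ e = mark-1 (W h) (trans (sym bitX) e)
        p∈ : bit (get k P h) ≡ 1 → p ∈ˡ W h
        p∈ e = mark-1 (W h) (trans (sym bitP) e)
        bX : x ∈ˡ W h → bit (get k X h) ≡ 1
        bX i = trans bitX (mark-yes (W h) i)
        bP : p ∈ˡ W h → bit (get k P h) ≡ 1
        bP i = trans bitP (mark-yes (W h) i)

      -- With the crossing weight as `D`, `thrifty` bounds the new cost by the two inside weights
      -- plus the crossing weight, and `inside-split` absorbs these into the merged block.
      matches-merged : ∀ {W c} (f : Feasible W c) {P X y} → Matches f Q p (keys k P) → Matches f Q x (keys k X) →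
                       MergedAt P X y → Matches f Q⁺ p (keys k y)
      matches-merged {W} f {P} {X} {y} mP mX mg h
        rewrite get-keys k y h =
          trans (Merged.bit≡ (mg h)) (trans (cong proj₁ (sym (get-keys k P h))) (proj₁ (mP h)))
        , ≤-trans (Merged.thrifty (mg h) (demand f mP mX h))
            (≤-trans (+-monoˡ-≤ (crossing Q x (Feasible.trail f h)) (+-mono-≤
              (subst (λ κ → proj₁ (proj₂ κ) ≤ inside Q p (Feasible.trail f h)) (get-keys k P h) (proj₁ (proj₂ (mP h))))
              (subst (λ κ → proj₁ (proj₂ κ) ≤ inside Q x (Feasible.trail f h)) (get-keys k X h) (proj₁ (proj₂ (mX h))))))
              (inside-split (Feasible.trail f h)))
        , ≤-trans (≤-reflexive (sym (blockSum-merge Q w (visits W h) parent≢)))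
            (≤-trans (+-mono-≤
              (subst (λ κ → blockSum Q p (visits W h) ≤ proj₂ (proj₂ κ)) (get-keys k P h) (proj₂ (proj₂ (mP h))))
              (subst (λ κ → blockSum Q x (visits W h) ≤ proj₂ (proj₂ κ)) (get-keys k X h) (proj₂ (proj₂ (mX h)))))
              (≤-reflexive (sym (Merged.count≡ (mg h)))))

-- Verification of a contraction step and of the run for one guess.

module Run (N : ℕ) (1≤N : 1 ≤ N) (k m M root : ℕ) (vs : List ℕ) (R : List E3) (rooted : Rooted m M root vs R)
           (V : List ℕ) (V≤N : length V ≤ N) (room : Room k m M N)
           (ST₀ lims : ⟦ Tup k (nat ⊗ nat) ⟧) where
  open Solve N 1≤N k m M root vs R rooted V V≤N room ST₀ lims public
  open Segments R
  open Trails (Link³ R)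
  open Blocks m
  open Rooted rooted
  open Room room

  module _ (zs : List E3) (x p w : ℕ) (Q : List E3) (R≡ : zs ++ (x , p , w) ∷ Q ≡ R) where
    open Cut zs x p w Q R≡ valid using (parent≢)
    open Step zs x p w Q R≡

    module _ {F : List ⟦ Entry k ⟧} {ST : ⟦ Tup k (nat ⊗ nat) ⟧} (inv : Inv Q (F , ST)) where
      open Inv inv

      Offspring : List ⟦ Entry k ⟧ → List ⟦ Entry k ⟧ → ⟦ Tup k Seg ⟧ → Set
      Offspring acc zs P = ∀ {X} → (x , X) ∈ˡ zs → ∀ {D} → DemandAll parent≢ (up e∈) (down e∈) k ST P X D →
                           ∃[ y ] (p , y) ∈ˡ acc × MergedAt terminals P X y

      -- An entry at `p` yields at most `length F` candidates, any other entry at most one; this is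
      -- the source of the square in `Room`.
      Processed : List ⟦ Entry k ⟧ → List ⟦ Entry k ⟧ → Set
      Processed ys acc =
        length acc ≤ length ys * length F × Sound Q⁺ acc ×
        (∀ {e} → e ∈ˡ ys → proj₁ e ≢ x → proj₁ e ≢ p → e ∈ˡ acc) ×
        (∀ {P} → (p , P) ∈ˡ ys → Offspring acc F P)

      Combined : ⟦ Tup k Seg ⟧ → List ⟦ Entry k ⟧ → List ⟦ Entry k ⟧ → List ⟦ Entry k ⟧ → Set
      Combined P acc zs acc′ =
        length acc′ ≤ length zs + length acc × Sound Q⁺ acc′ × (∀ {e} → e ∈ˡ acc → e ∈ˡ acc′) × Offspring acc′ zs P

      private
        F≤N : length F ≤ N
        F≤N = ≤-trans small box

        skip : ∀ {ys acc u y} → u ≡ x → Processed ys acc → Processed ((u , y) ∷ ys) acc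
        skip e (l , snds , old , new) =
          ≤-trans l (m≤n+m _ _) , snds ,
          (λ { (here refl) nx _ → contradiction e nx ; (there i) → old i }) ,
          (λ { (here refl) → contradiction e parent≢ ; (there i) → new i })

        keep : ∀ {ys acc u y} → 1 ≤ length F → u ≢ x → u ≢ p → (u , y) ∈ˡ F → Processed ys acc →
               Processed ((u , y) ∷ ys) ((u , y) ∷ acc)
        keep l₁ nx np e∈F (l , snds , old , new) =
          +-mono-≤ l₁ l ,
          (λ { (here refl) → let u∈ , u∉ , g = sound e∈F in u∈ , avoid⁺ u∉ nx , kept nx np g
             ; (there i) → snds i }) ,
          (λ { (here refl) _ _ → here refl ; (there i) a b → there (old i a b) }) ,
          (λ { (here refl) → contradiction refl np
             ; (there i) j d → let y , a , b = new i j d in y , there a , b })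

        finish : ∀ {ys acc acc′ P} → Processed ys acc → Combined P acc F acc′ → Processed ((p , P) ∷ ys) acc′
        finish (l , snds , old , new) (l′ , snds′ , incl , off) =
          ≤-trans l′ (+-monoʳ-≤ (length F) l) , snds′ ,
          (λ { (here refl) _ np → contradiction refl np ; (there i) a b → incl (old i a b) }) ,
          (λ { (here refl) → off ; (there i) j d → let y , a , b = new i j d in y , incl a , b })

        pass : ∀ {P acc zs acc′ u X} → u ≢ x → Combined P acc zs acc′ → Combined P acc ((u , X) ∷ zs) acc′
        pass nx (l , snds , incl , off) =
          ≤-trans l (n≤1+n _) , snds , incl , (λ { (here refl) → contradiction refl nx ; (there i) → off i })

        barren : ∀ {P acc zs acc′ X} → (∀ {D} → ¬ DemandAll parent≢ (up e∈) (down e∈) k ST P X D) →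
                 Combined P acc zs acc′ → Combined P acc ((x , X) ∷ zs) acc′
        barren n (l , snds , incl , off) =
          ≤-trans l (n≤1+n _) , snds , incl , (λ { (here refl) d → contradiction d n ; (there i) → off i })

        bear : ∀ {P acc zs acc′ X y} → (p , P) ∈ˡ F → (x , X) ∈ˡ F → MergedAt terminals P X y →
               Combined P acc zs acc′ → Combined P acc ((x , X) ∷ zs) ((p , y) ∷ acc′)
        bear P∈ X∈ mg (l , snds , incl , off) =
          s≤s l ,
          (λ { (here refl) → let p∈ , _ , gP = sound P∈ ; _ , _ , gX = sound X∈ in
                             p∈ , p∉Q⁺ , merged terminals gP gX mg
             ; (there i) → snds i }) ,
          there ∘ incl ,
          (λ { (here refl) _ → _ , here refl , mg ; (there i) d → let y , a , b = off i d in y , there a , b })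

        member-F : ∀ {e : ⟦ Entry k ⟧} zs {ys} → zs ++ e ∷ ys ≡ F → e ∈ˡ F
        member-F zs split = subst (_ ∈ˡ_) split (∈-++⁺ʳ zs (here refl))

        good-at : ∀ {u y} → (u , y) ∈ˡ F → ∀ h →
                  Good (proj₁ (get k ST h)) (proj₂ (get k ST h)) (s h) (t h) u (get k y h)
        good-at {u} {y} i h = subst (λ st → Good (proj₁ st) (proj₂ st) (s h) (t h) u (get k y h))
                                (sym (terminals h)) (GoodEntry.good (proj₂ (proj₂ (sound i))) h)

        sizes : ∀ {P X} → (p , P) ∈ˡ F → (x , X) ∈ˡ F → ∀ h → size (get k P h) + size (get k X h) ≤ N
        sizes {P} {X} i j h = begin
          size (get k P h) + size (get k X h)
            ≤⟨ +-mono-≤ (≤-trans (n≤1+n _) (GoodEntry.size≤ (proj₂ (proj₂ (sound i))) h))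
                        (≤-trans (n≤1+n _) (GoodEntry.size≤ (proj₂ (proj₂ (sound j))) h)) ⟩
          2 * blockSum Q p (λ _ → 1) + 2 * blockSum Q x (λ _ → 1)
            ≡⟨ sym (*-distribˡ-+ 2 (blockSum Q p (λ _ → 1)) _) ⟩
          2 * (blockSum Q p (λ _ → 1) + blockSum Q x (λ _ → 1))
            ≡⟨ cong (2 *_) (blockSum-merge Q w (λ _ → 1) parent≢) ⟩
          2 * blockSum Q⁺ p (λ _ → 1)
            ≤⟨ *-monoʳ-≤ 2 (block≤m Q⁺ p) ⟩
          2 * m
            ≤⟨ double ⟩
          N ∎
          where open ≤-Reasoning

      candidates-wp : WP (candidates k) (((x , p , w) , F , ST) ∷ [])
        (λ r → length r ≤ length F * length F × Sound Q⁺ r × Matched Q⁺ r)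
      candidates-wp = wp-fold Processed
        (wp-flat ( F≤N , wp-flat (z≤n , (λ ()) , (λ ()) , (λ ()))
        , (λ { zs (u , P) ys acc split done → wp-ifEq
            (λ u≡x → wp-flat (skip u≡x done))
            (λ u≢x → wp-ifEq
              (λ { refl → wp-fold (Combined P acc)
                (wp-flat ( F≤N
                , wp-flat (≤-refl , proj₁ (proj₂ done) , id , (λ ()))
                , (λ { zs′ (u′ , X) ys′ acc′ split′ comb → wp-ifEq
                    (λ { refl → wp-case (wp-call (wp-flat (wp-conseq
                        (merge-wp parent≢ (up e∈) (down e∈) k (good-at (member-F zs split)) (good-at (member-F zs′ split′))
                                  (sizes (member-F zs split) (member-F zs′ split′)))
                        λ r (snds , cmp) →
                          (λ { refl → wp-flat (barren (λ d → contradiction (proj₂ (cmp d)) (λ ())) comb) }) ,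
                          (λ { y ys refl → wp-flat (bear (member-F zs split) (member-F zs′ split′) (snds (here refl)) comb) })))) })
                    (λ u′≢x → wp-flat (pass u′≢x comb)) })
                , (λ acc′ comb → finish done comb))) })
              (λ u≢p → wp-flat (keep (∈-length (member-F zs split)) u≢x u≢p (member-F zs split) done))) })
        , (λ r (l , snds , old , new) → l , snds , all-matched old new)))
        where
        all-matched : ∀ {acc} → (∀ {e} → e ∈ˡ F → proj₁ e ≢ x → proj₁ e ≢ p → e ∈ˡ acc) →
                      (∀ {P} → (p , P) ∈ˡ F → Offspring acc F P) → Matched Q⁺ acc
        all-matched {acc} old new {W} f {u} u∈ u∉ = go (u ≟ p)
          where
          same : ∀ {u a} → u ≢ x → u ≢ p → rep Q a ≡ u → rep Q⁺ a ≡ u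
          same u≢x u≢p refl = contract-≢ u≢x
          inside-keep : ∀ {a W z c} (τ : Trail a W z c) {u} → u ≢ x → u ≢ p → inside Q u τ ≤ inside Q⁺ u τ
          inside-keep stop nx np = z≤n
          inside-keep (_∷_ {a = a} {b = b} {w = w′} l τ) {u} nx np =
            +-mono-≤ (link (rep Q a) (rep Q b)) (inside-keep τ nx np)
            where
            link : ∀ a b → both u a b w′ ≤ both u (contract x p a) (contract x p b) w′
            link a b with a ≟ u | b ≟ u
            ... | yes refl | yes refl = ≤-reflexive (sym (both-yes {u} (contract-≢ nx) (contract-≢ nx)))
            ... | yes _    | no _     = z≤n
            ... | no _     | _        = z≤n
          go : Dec (u ≡ p) → ∃[ y ] (u , y) ∈ˡ acc × Matches f Q⁺ u (keys k y)
          -- The same trails match an entry at `p` and one at `x`; they meet the demands of this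
          -- pair, so the pair does merge.
          go (yes refl) =
            let P , P∈ , mP = matched f u∈ (λ i → u∉ (there i))
                X , X∈ , mX = matched f (proj₁ (edge e∈)) x∉Q
                y , y∈ , mg = new P∈ X∈ (demand terminals f mP mX)
            in y , y∈ , matches-merged terminals f mP mX mg
          go (no u≢p) =
            let u≢x = λ e → u∉ (here e)
                y , y∈ , mt = matched f u∈ (λ i → u∉ (there i))
            in y , old y∈ u≢x u≢p , λ h → let a , b , c = mt h in
                 a , ≤-trans b (inside-keep (Feasible.trail f h) u≢x u≢p) ,
                 ≤-trans (≤-reflexive (blockSum-keep Q w (visits W h) u≢x u≢p)) c

      contractStep-wp : WP (contractStep k) (((x , p , w) , F , ST) ∷ []) (Inv Q⁺)
      contractStep-wp = wp-pair (wp-call (wp-call (wp-flat (wp-conseq candidates-wp λ C (l , snds , mtc) →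
        wp-conseq (dedupe-wp k (entryBox k m M)
                    (≤-trans l (≤-trans (*-mono-≤ small small) square))
                    (subst (_≤ N) (sym (length-entryBox k m M)) box)
                    (λ i → let u∈ , _ , g = snds i in in-box u∈ g))
          λ F′ (l′ , incl , cov) →
          wp-call (wp-flat (wp-conseq (contractAll-wp k) λ ST′ ts → record
            { terminals = λ h → trans (ts h) (cong (λ st → contract x p (proj₁ st) , contract x p (proj₂ st)) (terminals h))
            ; sound     = λ i → snds (incl i)
            ; small     = ≤-trans l′ (≤-reflexive (length-entryBox k m M))
            ; matched   = λ {W} f u∈ u∉ → let y , y∈ , mt = mtc f u∈ u∉ in recover {W} f (cov y∈) mt
            }))))))
        where
        -- A different entry with the same key may have been kept, but `Matches` reads only the key.
        recover : ∀ {W c} (f : Feasible W c) {F′ u y} → code {k} (u , y) ∈ˡ map (code {k}) F′ → Matches f Q⁺ u (keys k y) →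
                  ∃[ y′ ] (u , y′) ∈ˡ F′ × Matches f Q⁺ u (keys k y′)
        recover f {u = u} {y} i mt with ∈-map⁻ (code {k}) i
        ... | (u′ , y′) , j , e with refl ← cong proj₁ e = y′ , j , subst (Matches f Q⁺ u) (cong proj₂ e) mt

  length-cat : ∀ k {W : Fin (suc k) → List ℕ} {b} → (∀ h → length (W h) ≤ b) → length (cat k W) ≤ suc k * b
  length-cat zero    l = ≤-trans (l zero) (m≤m+n _ 0)
  length-cat (suc k) {W} l = ≤-trans (≤-reflexive (length-++ (W zero))) (+-mono-≤ (l zero) (length-cat k (l ∘ suc)))

  at-root : ∀ {y} → y ∈ˡ vs → y ∉ children R → y ≡ root
  at-root i n = [ id , (λ j → contradiction j n) ] (covers i)

  rep-in : ∀ Q → (∀ {e} → e ∈ˡ Q → e ∈ˡ R) → ∀ {y} → y ∈ˡ vs → rep Q y ∈ˡ vs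
  rep-in []                incl i = i
  rep-in ((x , p , w) ∷ Q) incl {y} i with rep Q y ≟ x
  ... | yes _ = proj₁ (proj₂ (edge (incl (here refl))))
  ... | no _  = rep-in Q (incl ∘ there) i

  -- Representatives are vertices and never children, and the root is the only vertex that is no
  -- child.
  rep-root : ∀ {y} → y ∈ˡ vs → rep R y ≡ root
  rep-root {y} i = at-root (rep-in R id i) (rep-avoids y valid)

  Tour : List ℕ → Set
  Tour z = ∃[ W ] ∃[ c ] Feasible W c × z ≡ cat k W × length z ≤ suc k * (2 * m)

  RunPost : List (List ℕ) → Set
  RunPost r = (∀ {z} → z ∈ˡ r → Tour z) × (∀ {W c} → Feasible W c → ∃[ z ] z ∈ˡ r)

  module _ (s∈ : ∀ h → s h ∈ˡ vs) (t∈ : ∀ h → t h ∈ˡ vs) where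

    whole : ∀ {rs rt s t y} → rs ≡ root → rt ≡ root → Good rs rt s t root y → Trail s (route y) t (cost y)
    whole es et (through (in-block _) (in-block _) π τ refl) = path-trail π τ
    whole es et (through (off-block n) _ _ _ _) = contradiction es n
    whole es et (through (in-block _) (off-block n) _ _ _) = contradiction et n
    whole es et (complete _ _ τ) = τ
    whole es et (absent n _ _ _ _) = contradiction es n

    feasible : ∀ {y} → GoodEntry R root y → Fits k 0 y lims → Feasible (route ∘ get k y) (cost ∘ get k y)
    feasible {y} g fit = record
      { trail   = λ h → whole (rep-root (s∈ h)) (rep-root (t∈ h)) (GoodEntry.good g h)
      ; in-time = λ h → proj₁ (fit h)
      ; enough  = λ h → ≤-trans (proj₂ (fit h)) (≤-trans (GoodEntry.count≤ g h) (blockSum-≤ R root _))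
      }

    -- The final block is the whole tree: weights inside it are at most the trail lengths, and block
    -- sums run over all vertices.
    fits : ∀ {W c} (f : Feasible W c) {y} → Matches f R root (keys k y) → Fits k 0 y lims
    fits {W} {c} f {y} mt h =
      ≤-trans (total-mono k (λ h → ≤-trans
                 (subst (λ κ → proj₁ (proj₂ κ) ≤ inside R root (Feasible.trail f h)) (get-keys k y h) (proj₁ (proj₂ (mt h))))
                 (inside-≤ R root (Feasible.trail f h))) h)
              (Feasible.in-time f h) ,
      ≤-trans (Feasible.enough f h) (≤-trans
        (sum<-mono m (λ {v} l → ≤-reflexive (sym (when-yes (rep R v ≟ root) (rep-root (all l))))))
        (subst (λ κ → blockSum R root (visits W h) ≤ proj₂ (proj₂ κ)) (get-keys k y h) (proj₂ (proj₂ (mt h)))))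

    run-wp : ∀ {g} → ST₀ ≡ chainOf k root root g → WP (run k) ((R , vs , V , root , lims , g) ∷ []) RunPost
    run-wp {g} refl =
      wp-let (wp-call (wp-flat (wp-conseq (chain-wp k {root} {root} {g}) λ { _ refl →
      wp-let (wp-call (wp-flat (wp-conseq initTable-wp λ F₀ inv₀ →
      wp-let (wp-fold (λ Q st → Inv Q st)
        (wp-flat ( ≤-trans length-R (≤-trans (m≤m+n m _) double)
        , wp-flat inv₀
        , (λ { zs (x , p , w) Q st R≡ inv → wp-call (wp-flat (contractStep-wp zs x p w Q R≡ inv)) })
        , (λ { (F , ST) inv →
          wp-fold (λ ys r → (∀ {z} → z ∈ˡ r → Tour z) ×
                            (∀ {y} → (root , y) ∈ˡ ys → Fits k 0 y lims → ∃[ z ] z ∈ˡ r))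
            (wp-flat ( ≤-trans (Inv.small inv) box
            , wp-flat ((λ ()) , (λ ()))
            , (λ { zs (u , y) ys r F≡ (snds , cmp) →
                let u∈ , u∉ , g = Inv.sound inv (subst (_ ∈ˡ_) F≡ (∈-++⁺ʳ zs (here refl)))
                in body u∈ u∉ g snds cmp })
            , (λ r (snds , cmp) → snds , λ f →
                let y , i , mt = Inv.matched inv f root∈ (λ i → rep-avoids root valid
                                   (subst (_∈ˡ children R) (sym (rep-root root∈)) i))
                in cmp i (fits f {y} mt)))) }))))))) })))
      where
      body : ∀ {u y ys r} {F₀ F : ⟦ list (Entry k) ⟧} {ST : ⟦ Tup k (nat ⊗ nat) ⟧} {g′ : ⟦ Tup k nat ⟧} → u ∈ˡ vs → u ∉ children R → GoodEntry R u y →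
             (∀ {z} → z ∈ˡ r → Tour z) →
             (∀ {y} → (root , y) ∈ˡ ys → Fits k 0 y lims → ∃[ z ] z ∈ˡ r) →
             WP {Γ = Entry k ∷ list (list nat) ∷ State k ∷ list (Entry k) ∷ Tup k (nat ⊗ nat) ∷ RunIn k ∷ []}
                (caseL (call (assemble k) (pair (lit 0) (pair (snd v0) (fst (snd (snd (snd (snd v5))))))))
                  v1 (single v0))
                ((u , y) ∷ r ∷ (F , ST) ∷ F₀ ∷ ST₀ ∷ (R , vs , V , root , lims , g′) ∷ [])
                (λ r → (∀ {z} → z ∈ˡ r → Tour z) ×
                       (∀ {y′} → (root , y′) ∈ˡ ((u , y) ∷ ys) → Fits k 0 y′ lims → ∃[ z ] z ∈ˡ r))
      body {u} {y} u∈ u∉ g snds cmp with refl ← at-root u∈ u∉ =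
        wp-case (wp-call (wp-flat (wp-conseq
          (assemble-wp k {0} {y} {lims} (λ h → ≤-trans (≤-trans (n≤1+n _) (GoodEntry.size≤ g h))
                                                (≤-trans (*-monoʳ-≤ 2 (block≤m R root)) double)))
          λ r′ (asnd , acmp) →
            (λ { refl → wp-flat (snds , λ { (here refl) fit → contradiction (proj₂ (acmp fit)) (λ ()) ; (there i) → cmp i }) }) ,
            (λ { z zs refl → wp-flat
              ( (λ { (here refl) → let e , fit = asnd (here refl) in
                  _ , _ , feasible g fit , e ,
                  ≤-trans (≤-reflexive (cong length e)) (length-cat k λ h →
                    ≤-trans (≤-reflexive (length-++ (proj₁ (proj₂ (get k y h))))) (≤-trans (n≤1+n _)
                      (≤-trans (GoodEntry.size≤ g h) (*-monoʳ-≤ 2 (block≤m R root))))) })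
              , (λ _ _ → z , here refl)) }))))

-- Growing a rooted spanning tree

module _ (E : List E3) (root : ℕ) where

  data Grown : List ℕ → List E3 → Set where
    start : Grown (root ∷ []) []
    grow⁺ : ∀ {vs R x p w} → Grown vs R → p ∈ˡ vs → x ∉ vs → Link³ E p x w →
            Grown (x ∷ vs) (R ++ (x , p , w) ∷ [])

  data Reach : ℕ → ℕ → Set where
    base : ∀ {i} → Reach i root
    hop  : ∀ {i a b w} → Reach i a → Link³ E a b w → Reach (suc i) b

reach-mono : ∀ {E root i j v} → i ≤ j → Reach E root i v → Reach E root j v
reach-mono le       base      = base
reach-mono (s≤s le) (hop r l) = hop (reach-mono le r) l

link-flip : ∀ {R a b w} → Link³ R a b w → Link³ R b a w
link-flip (up i)   = down i
link-flip (down i) = up i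

link-incl : ∀ {R R′ a b w} → (∀ {e} → e ∈ˡ R → e ∈ˡ R′) → Link³ R a b w → Link³ R′ a b w
link-incl h (up i)   = up (h i)
link-incl h (down i) = down (h i)

-- The appended edge is contracted first. As its child is new, the conditions on the earlier edges
-- survive.
valid-snoc : ∀ {R x p w} → Valid R → (∀ {x′ p′ w′} → (x′ , p′ , w′) ∈ˡ R → x′ ≢ x × p′ ≢ x) → p ≢ x →
             Valid (R ++ (x , p , w) ∷ [])
valid-snoc [] fresh p≢x = ((λ ()) , p≢x , (λ ())) ∷ []
valid-snoc {(x′ , p′ , _) ∷ R} {x} {p} {w} ((a , b , c) ∷ v) fresh p≢x =
  (avoid a (proj₁ (fresh (here refl))) , b , avoid c (proj₂ (fresh (here refl)))) ∷
  valid-snoc v (fresh ∘ there) p≢x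
  where
  avoid : ∀ {y R} → y ∉ children R → y ≢ x → y ∉ children (R ++ (x , p , w) ∷ [])
  avoid {R = []}    n ne (here e)  = ne e
  avoid {R = _ ∷ R} n ne (here e)  = n (here e)
  avoid {R = _ ∷ R} n ne (there i) = avoid {R = R} (n ∘ there) ne i

module Growth-facts {E : List E3} {root : ℕ} where

  root∈ : ∀ {vs R} → Grown E root vs R → root ∈ˡ vs
  root∈ start           = here refl
  root∈ (grow⁺ g _ _ _) = there (root∈ g)

  edges : ∀ {vs R} → Grown E root vs R → ∀ {x p w} → (x , p , w) ∈ˡ R →
          x ∈ˡ vs × p ∈ˡ vs × Link³ E x p w
  edges (grow⁺ {R = R} g p∈ x∉ l) i with ∈-++⁻ R i
  ... | inj₁ j           = let a , b , c = edges g j in there a , there b , c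
  ... | inj₂ (here refl) = here refl , there p∈ , link-flip l

  valid : ∀ {vs R} → Grown E root vs R → Valid R
  valid start = []
  valid (grow⁺ g p∈ x∉ l) = valid-snoc (valid g)
    (λ i → let a , b , _ = edges g i in (λ { refl → x∉ a }) , (λ { refl → x∉ b })) (λ { refl → x∉ p∈ })

  covers : ∀ {vs R} → Grown E root vs R → ∀ {v} → v ∈ˡ vs → v ≡ root ⊎ v ∈ˡ children R
  covers start (here e) = inj₁ e
  covers (grow⁺ {R = R} g p∈ x∉ l) (here refl) = inj₂ (∈-map⁺ proj₁ (∈-++⁺ʳ R (here refl)))
  covers (grow⁺ {R = R} g p∈ x∉ l) (there i) with covers g i
  ... | inj₁ e = inj₁ e
  ... | inj₂ j = let e , e∈ , q = ∈-map⁻ proj₁ j in inj₂ (subst (_∈ˡ _) (sym q) (∈-map⁺ proj₁ (∈-++⁺ˡ e∈)))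

  distinct : ∀ {vs R} → Grown E root vs R → Unique vs
  distinct start             = [] ∷ []
  distinct (grow⁺ g _ x∉ _) = All-tabulate (λ { i refl → x∉ i }) ∷ distinct g

  length-tree : ∀ {vs R} → Grown E root vs R → length vs ≡ suc (length R)
  length-tree start                     = refl
  length-tree (grow⁺ {R = R} g _ _ _) =
    cong suc (trans (length-tree g) (trans (cong suc (sym (+-identityʳ _)))
      (trans (sym (+-suc (length R) 0)) (sym (length-++ R)))))

  module _ {m : ℕ} (root<m : root < m) (ends : ∀ {a b w} → (a , b , w) ∈ˡ E → a < m × b < m) where

    vertex : ∀ {vs R} → Grown E root vs R → ∀ {v} → v ∈ˡ vs → v < m
    vertex start (here refl) = root<m
    vertex (grow⁺ g _ _ (up i))   (here refl) = proj₂ (ends i)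
    vertex (grow⁺ g _ _ (down i)) (here refl) = proj₁ (ends i)
    vertex (grow⁺ g _ _ _)        (there j)   = vertex g j

    length-vs : ∀ {vs R} → Grown E root vs R → length vs ≤ m
    length-vs {vs} g = subst (length vs ≤_) (length-upTo m) (pigeonhole (distinct g) (λ i → ∈-upTo⁺ (vertex g i)))

    length-R : ∀ {vs R} → Grown E root vs R → length R ≤ m
    length-R g = ≤-trans (n≤1+n _) (subst (_≤ m) (length-tree g) (length-vs g))

module Discovery (N : ℕ) (1≤N : 1 ≤ N) {E : List E3} {root m : ℕ} (m≤N : m ≤ N) (E≤N : length E ≤ N)
                 (root<m : root < m) (ends : ∀ {a b w} → (a , b , w) ∈ˡ E → a < m × b < m) where
  open Procedures N 1≤N
  open Growth-facts {E} {root}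

  Linked : List ℕ → List ℕ → E3 → Set
  Linked vs vs′ (a , b , _) = (a ∈ˡ vs → b ∈ˡ vs′) × (b ∈ˡ vs → a ∈ˡ vs′)

  grow-wp : ∀ {e vs R} → Grown E root vs R → e ∈ˡ E →
            WP grow ((e , vs , R) ∷ []) (λ (vs′ , R′) → Grown E root vs′ R′ × (∀ {v} → v ∈ˡ vs → v ∈ˡ vs′) × Linked vs vs′ e)
  grow-wp {a , b , w} {vs} {R} g e∈ =
    wp-let (wp-member (wp-flat (wp-flat (lv , λ va fa →
    wp-let (wp-member (wp-flat (wp-flat (lv , λ vb fb → decide fa fb))))))))
    where
    lv : length vs ≤ N
    lv = ≤-trans (length-vs root<m ends g) m≤N
    lR : length R ≤ N
    lR = ≤-trans (length-R root<m ends g) m≤N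
    Result : ⟦ Growth ⟧ → Set
    Result (vs′ , R′) = Grown E root vs′ R′ × (∀ {v} → v ∈ˡ vs → v ∈ˡ vs′) × Linked vs vs′ (a , b , w)
    decide : ∀ {va vb} → Flag (a ∈ˡ vs) va → Flag (b ∈ˡ vs) vb →
             WP {Γ = nat ∷ nat ∷ (EdgeT ⊗ Growth) ∷ []} (if≤ v0 v1
               (if≤ v1 v0 (snd v2)
                 (pair (cons (fst (snd (fst v2))) (fst (snd v2)))
                       (snd (snd v2) ⊕ single (pair (fst (snd (fst v2))) (pair (fst (fst v2)) (snd (snd (fst v2))))))))
               (pair (cons (fst (fst v2)) (fst (snd v2)))
                     (snd (snd v2) ⊕ single (fst v2))))
               (vb ∷ va ∷ ((a , b , w) , vs , R) ∷ []) Result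
    decide (inj₁ (refl , a∈)) (inj₁ (refl , b∈)) =
      wp-if (λ _ → wp-if (λ _ → wp-flat (g , id , (λ _ → b∈) , (λ _ → a∈))) (λ { (s≤s ()) })) (λ { (s≤s ()) })
    decide (inj₂ (refl , a∉)) (inj₂ (refl , b∉)) =
      wp-if (λ _ → wp-if (λ _ → wp-flat (g , id , (λ i → contradiction i a∉) , (λ i → contradiction i b∉))) (λ ())) (λ ())
    decide (inj₁ (refl , a∈)) (inj₂ (refl , b∉)) =
      wp-if (λ _ → wp-if (λ ()) (λ _ → wp-pair (wp-flat (wp-append (wp-flat (lR , wp-flat
        (grow⁺ g a∈ b∉ (up e∈) , there , (λ _ → here refl) , (λ i → contradiction i b∉)))))))) (λ ())
    decide (inj₂ (refl , a∉)) (inj₁ (refl , b∈)) =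
      wp-if (λ ()) (λ _ → wp-pair (wp-flat (wp-append (wp-flat (lR , wp-flat
        (grow⁺ g b∈ a∉ (down e∈) , there , (λ i → contradiction i a∉) , (λ _ → here refl)))))))

  -- After a round, every edge with one end found before has its other end found too, in whatever
  -- order the edges come. So `i` rounds find everything within `i` links of the root.
  growAll-wp : WP growAll ((m , E , root) ∷ [])
    (λ (vs , R) → Grown E root vs R × (∀ {v} → Reach E root m v → v ∈ˡ vs))
  growAll-wp = wp-loop
    (λ i (vs , R) → Grown E root vs R × (∀ {v} → Reach E root i v → v ∈ˡ vs))
    (wp-flat ( m≤N , wp-flat (start , (λ { base → here refl }))
    , (λ { i (vs , R) (g , reach) → wp-fold
        (λ ys (vs′ , R′) → Grown E root vs′ R′ × (∀ {v} → v ∈ˡ vs → v ∈ˡ vs′) × (∀ {e} → e ∈ˡ ys → Linked vs vs′ e))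
        (wp-flat (E≤N , wp-flat (g , id , (λ ()))
        , (λ { zs e ys (vs′ , R′) split (g′ , old , linked) → wp-call (wp-flat (wp-conseq
            (grow-wp g′ (subst (e ∈ˡ_) split (∈-++⁺ʳ zs (here refl))))
            λ (vs″ , R″) (g″ , old′ , l₁ , l₂) →
              g″ , old′ ∘ old ,
              (λ { (here refl) → l₁ ∘ old , l₂ ∘ old
                 ; (there j) → let a , b = linked j in old′ ∘ a , old′ ∘ b }))) })
        , (λ { (vs′ , R′) (g′ , old , linked) → g′ ,
             (λ { base → root∈ g′
                ; (hop r (up j))   → proj₁ (linked j) (reach r)
                ; (hop r (down j)) → proj₂ (linked j) (reach r) }) }))) })
    , (λ _ h → h)))

-- Edge-weighted trees

module Tree {m : ℕ} {E : List (Edge m)} (tree : IsTree E) where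
  open IsTree tree

  enc : Edge m → E3
  enc (u , v , w) = toℕ u , toℕ v , w

  E³ : List E3
  E³ = map enc E

  linkIndex : ∀ {u v} → Link E u v → ℕ
  linkIndex (forward i)  = toℕ (index i)
  linkIndex (backward i) = toℕ (index i)

  -- Turns an equality of walks into one of positions in `E`, even when the first links differ in
  -- weight.
  firstIndex : ∀ {u v} → Walk E u v → ℕ
  firstIndex ε       = 0
  firstIndex (l ◅ _) = linkIndex l

  link-≢ : ∀ {u v} → Link E u v → u ≢ v
  link-≢ (forward i)  = loopless i
  link-≢ (backward i) = loopless i ∘ sym

  -- As its ends differ, a single link is a simple walk, hence the path; its weight is therefore the
  -- distance.
  link-path : ∀ {u v} (l : Link E u v) → l ◅ ε ≡ path u v
  link-path l = unique (l ◅ ε) ((link-≢ l ∷ []) ∷ [] ∷ [])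

  dist-link : ∀ {u v} (l : Link E u v) → dist u v ≡ linkWeight l
  dist-link l = trans (cong weight (sym (link-path l))) (+-identityʳ _)

  dist-self : ∀ u → dist u u ≡ 0
  dist-self u = cong weight (sym (unique ε ([] ∷ [])))

  ends-of : Edge m → Fin m × Fin m
  ends-of (u , v , _) = u , v

  no-parallel : ∀ {u v w w′} (i : (u , v , w) ∈ˡ E) (j : (u , v , w′) ∈ˡ E) → toℕ (index i) ≡ toℕ (index j)
  no-parallel i j = cong firstIndex (trans (link-path (forward i)) (sym (link-path (forward j))))

  -- Two edges with the same ordered ends would be two simple walks, so an edge is determined by its
  -- ends.
  length-E : length E ≤ m * m
  length-E = subst₂ _≤_ (length-map ends-of E) (trans (length-cartesianProduct (allFin m) (allFin m)) (cong₂ _*_ order order))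
    (pigeonhole (separate E no-parallel) (λ _ → ∈-cartesianProduct⁺ (∈-allFin _) (∈-allFin _)))
    where
    order : length (allFin m) ≡ m
    order = length-tabulate id
    separate : ∀ xs → (∀ {u v w w′} (i : (u , v , w) ∈ˡ xs) (j : (u , v , w′) ∈ˡ xs) → toℕ (index i) ≡ toℕ (index j)) →
               Unique (map ends-of xs)
    separate []       h = []
    separate ((u , v , w) ∷ xs) h =
      All-tabulate (λ i e → let (u′ , v′ , w′) , j , q = ∈-map⁻ ends-of i in clash j (trans e q)) ∷
      separate xs (λ i j → cong pred (h (there i) (there j)))
      where
      clash : ∀ {u′ v′ w′} → (u′ , v′ , w′) ∈ˡ xs → (u , v) ≢ (u′ , v′)
      clash j refl with h (here refl) (there j)
      ... | ()

  length-simple : ∀ {u v} {q : Walk E u v} → Simple q → length (vertices q) ≤ m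
  length-simple {q = q} s = subst (length (vertices q) ≤_) (length-tabulate {n = m} id) (pigeonhole s (λ _ → ∈-allFin _))

  enc-link : ∀ {u v} (l : Link E u v) → Link³ E³ (toℕ u) (toℕ v) (linkWeight l)
  enc-link (forward i)  = up (∈-map⁺ enc i)
  enc-link (backward i) = down (∈-map⁺ enc i)

  dec-link : ∀ {a b w} → Link³ E³ a b w → ∃[ u ] ∃[ v ] Σ[ l ∈ Link E u v ] toℕ u ≡ a × toℕ v ≡ b × linkWeight l ≡ w
  dec-link (up i) with ∈-map⁻ enc i
  ... | _ , j , refl = _ , _ , forward j , refl , refl , refl
  dec-link (down i) with ∈-map⁻ enc i
  ... | _ , j , refl = _ , _ , backward j , refl , refl , refl

  ends : ∀ {a b w} → (a , b , w) ∈ˡ E³ → a < m × b < m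
  ends i with ∈-map⁻ enc i
  ... | _ , j , refl = toℕ<n _ , toℕ<n _

  module _ (o : Fin m) where

    reach-along : ∀ {i u v} → Reach E³ (toℕ o) i (toℕ u) → (q : Walk E u v) → Reach E³ (toℕ o) (length (vertices q) + i) (toℕ v)
    reach-along r ε       = reach-mono (n≤1+n _) r
    reach-along {i} r (l ◅ q) = reach-mono (≤-reflexive (+-suc (length (vertices q)) i)) (reach-along (hop r (enc-link l)) q)

    reachable : ∀ {v} → v < m → Reach E³ (toℕ o) m v
    reachable {v} l = subst (Reach E³ (toℕ o) m) (toℕ-fromℕ< l)
      (reach-mono (≤-trans (≤-reflexive (+-identityʳ _)) (length-simple (simple o (fromℕ< l)))) (reach-along base (path o (fromℕ< l))))

  -- Walks along the links of the rooted tree R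

  module _ {R : List E3} where

    -- A link of `E` paired with its copy in `R`, so that `unique`, which speaks of walks in `E`,
    -- applies to walks in the rooted tree.
    InTree : Fin m → Fin m → Set
    InTree u v = Σ[ l ∈ Link E u v ] Link³ R (toℕ u) (toℕ v) (linkWeight l)

    forget : ∀ {u v} → Star InTree u v → Walk E u v
    forget ε             = ε
    forget ((l , _) ◅ q) = l ◅ forget q

    open Trails (Link³ R)

    trail : ∀ {u v} (q : Star InTree u v) → Trail (toℕ u) (map toℕ (vertices (forget q))) (toℕ v) (weight (forget q))
    trail ε             = stop
    trail ((_ , l) ◅ q) = l ∷ trail q

    cutTo : ∀ {a v u} (q : Star InTree a v) → Simple (forget q) → u ∈ˡ vertices (forget q) →
            Σ[ q′ ∈ Star InTree u v ] Simple (forget q′)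
    cutTo ε       s (here refl) = ε , s
    cutTo (l ◅ q) s (here refl) = l ◅ q , s
    cutTo (l ◅ q) (_ ∷ s) (there i) = cutTo q s i

    erase : ∀ {u v} → Star InTree u v → Σ[ q ∈ Star InTree u v ] Simple (forget q)
    erase ε = ε , [] ∷ []
    erase {u} (l ◅ q) with erase q
    ... | q′ , s with any? (u Data.Fin.≟_) (vertices (forget q′))
    ...   | yes i = cutTo q′ s i
    ...   | no n  = l ◅ q′ , All-tabulate (λ { i refl → n i }) ∷ s

    flip : ∀ {u v} → InTree u v → InTree v u
    flip (forward i , l)  = backward i , link-flip l
    flip (backward i , l) = forward i , link-flip l

    back : ∀ {u v w} → Star InTree u v → Star InTree u w → Star InTree v w
    back ε       r = r
    back (l ◅ q) r = back q (flip l ◅ r)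

  enlarge : ∀ {R R′} → (∀ {e} → e ∈ˡ R → e ∈ˡ R′) → ∀ {u v} → Star (InTree {R}) u v → Star (InTree {R′}) u v
  enlarge h ε             = ε
  enlarge h ((l , i) ◅ q) = (l , link-incl h i) ◅ enlarge h q

  to-root : ∀ {o vs R} → Grown E³ (toℕ o) vs R → ∀ {u} → toℕ u ∈ˡ vs → Star (InTree {R}) u o
  to-root start (here e) with refl ← toℕ-injective e = ε
  to-root (grow⁺ g p∈ x∉ l) (there i) = enlarge ∈-++⁺ˡ (to-root g i)
  to-root (grow⁺ {R = R} g p∈ x∉ l) {u} (here refl) with dec-link (link-flip l)
  ... | u′ , v , l′ , e , refl , refl with refl ← toℕ-injective e =
    (l′ , up (∈-++⁺ʳ R (here refl))) ◅ enlarge ∈-++⁺ˡ (to-root g p∈)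

  -- Going through the root and erasing loops gives a simple walk along the rooted tree, and by
  -- uniqueness this is the path. So `R` realises all distances.
  tree-path : ∀ {o vs R} → Grown E³ (toℕ o) vs R → (∀ {v} → v < m → v ∈ˡ vs) → ∀ u v →
              Σ[ q ∈ Star (InTree {R}) u v ] forget q ≡ path u v
  tree-path g all u v =
    let q , s = erase (to-root g (all (toℕ<n u)) ◅◅ back (to-root g (all (toℕ<n v))) ε)
    in q , unique (forget q) s

-- Tours as families of trails.

sum<-≤-card : ∀ {m} (S : Subset m) {f : ℕ → ℕ} → (∀ y → f y ≤ 1) →
              (∀ {v : Fin m} → ¬ v ∈ S → f (toℕ v) ≡ 0) → sum< m f ≤ ∣ S ∣
sum<-≤-card []          one out = z≤n
sum<-≤-card (true ∷ S)  one out = +-mono-≤ (one 0) (sum<-≤-card S (one ∘ suc) (λ n → out (λ { (thereᵛ i) → n i })))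
sum<-≤-card (false ∷ S) one out =
  +-mono-≤ (≤-reflexive (out (λ ()))) (sum<-≤-card S (one ∘ suc) (λ n → out (λ { (thereᵛ i) → n i })))

card-≤-sum< : ∀ {m} (S : Subset m) {f : ℕ → ℕ} → (∀ {v : Fin m} → v ∈ S → 1 ≤ f (toℕ v)) → ∣ S ∣ ≤ sum< m f
card-≤-sum< []          inn = z≤n
card-≤-sum< (true ∷ S)  inn = +-mono-≤ (inn hereᵛ) (card-≤-sum< S (inn ∘ thereᵛ))
card-≤-sum< (false ∷ S) inn = ≤-trans (card-≤-sum< S (inn ∘ thereᵛ)) (m≤n+m _ _)

module Solutions {k : ℕ} (I : Instance k) {vs : List ℕ} {R : List E3}
                 (grown : Grown (Tree.E³ (Instance.isTree I)) (toℕ (Instance.origin I)) vs R)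
                 (all : ∀ {v} → v < Instance.m I → v ∈ˡ vs) where
  open Instance I
  open Tree isTree
  open Growth-facts {E³} {toℕ origin} using (edges)
  open Trails (Link³ R)

  o : ℕ
  o = toℕ origin

  VL : List ℕ
  VL = map toℕ (filter (_∈? V) (allFin m))

  VL⁺ : ∀ {v} → v ∈ V → toℕ v ∈ˡ VL
  VL⁺ i = ∈-map⁺ toℕ (∈-filter⁺ (_∈? V) (∈-allFin _) i)

  VL⁻ : ∀ {v} → toℕ v ∈ˡ VL → v ∈ V
  VL⁻ i with ∈-map⁻ toℕ i
  ... | v′ , j , e with refl ← toℕ-injective e = proj₂ (∈-filter⁻ (_∈? V) {xs = allFin m} j)

  visits : ∀ k → (Fin (suc k) → List ℕ) → Fin (suc k) → ℕ → ℕ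
  visits k W h = seen VL (upTill k W h)

  -- From trails to tours

  module F = Trails (λ (u v : Fin m) w → dist u v ≡ w)

  lift-trail : ∀ {a W z c} → Trail a W z c → ∀ {u} → toℕ u ≡ a →
               ∃[ W′ ] ∃[ z′ ] map toℕ W′ ≡ W × toℕ z′ ≡ z × F.Trail u W′ z′ c
  lift-trail stop {u} refl = u ∷ [] , u , refl , refl , F.stop
  lift-trail (l ∷ t) {u} e with dec-link (original l)
    where
    original : ∀ {a b w} → Link³ R a b w → Link³ E³ a b w
    original (up i)   = proj₂ (proj₂ (edges grown i))
    original (down i) = link-flip (proj₂ (proj₂ (edges grown i)))
  ... | u′ , v , l′ , e₁ , e₂ , refl with refl ← toℕ-injective (trans e₁ (sym e)) =
    let W′ , z′ , p , q , t′ = lift-trail t e₂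
    in u ∷ W′ , z′ , cong₂ _∷_ e p , q , dist-link l′ F.∷ t′

  starts : ∀ {u W z c} → F.Trail u W z c → ∃[ W′ ] W ≡ u ∷ W′
  starts F.stop    = _ , refl
  starts (_ F.∷ _) = _ , refl

  -- Consecutive walks share a vertex, which the tour then lists twice; `dist-self` makes the
  -- repetition free.
  record Follows (c : ℕ) (W rest whole : List (Fin m)) : Set where
    field
      length≡ : tourLength whole ≡ c + tourLength rest
      within  : ∀ τ {v} → v ∈ˡ W → ∃[ t ] (v , t) ∈ˡ arrivals τ whole × t ≤ τ + c
      after   : ∀ τ {e} → e ∈ˡ arrivals (τ + c) rest → e ∈ˡ arrivals τ whole

  follows : ∀ {u W z c} → F.Trail u W z c → ∀ {T} → Follows c W (z ∷ T) (W ++ z ∷ T)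
  follows {z = z} F.stop {T} = record
    { length≡ = cong (_+ tourLength (z ∷ T)) (dist-self z)
    ; within  = λ { τ (here refl) → τ , here refl , m≤m+n τ 0 }
    ; after   = λ τ i → there (subst (λ d → _ ∈ˡ arrivals (τ + d) (z ∷ T)) (sym (dist-self z)) i)
    }
  follows {u} {z = z} (F._∷_ {b = b} {W = W} {w = w} {c = c} l t) {T} with starts t
  ... | W′ , refl = record
    { length≡ = trans (cong₂ _+_ l length≡) (sym (+-assoc w c _))
    ; within  = λ { τ (here refl) → τ , here refl , m≤m+n τ _
                  ; τ (there i) → let t , j , le = within (τ + dist u b) i
                                  in t , there j , ≤-trans le (≤-reflexive (trans (+-assoc τ _ c) (cong (λ d → τ + (d + c)) l))) }
    ; after   = λ τ {e} i → there (after (τ + dist u b)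
                  (subst (λ d → e ∈ˡ arrivals d (z ∷ T)) (trans (sym (+-assoc τ w c)) (cong (λ d → τ + d + c) (sym l))) i))
    }
    where open Follows (follows t {T})

  -- The starting time `τ` is arbitrary because the induction moves along the tour from one segment
  -- to the next.
  assembled : ∀ k u {g W c} →
    (∀ h → Trail (proj₁ (get k (chainOf k o (toℕ u) g) h)) (W h) (proj₂ (get k (chainOf k o (toℕ u) g) h)) (c h)) →
    ∃[ w ] ∃[ T ] map toℕ w ≡ cat k W × w ++ (origin ∷ []) ≡ u ∷ T ×
      tourLength (u ∷ T) ≡ total k c (fromℕ k) ×
      (∀ τ h {v} → toℕ v ∈ˡ upTill k W h → ∃[ t ] (v , t) ∈ˡ arrivals τ (u ∷ T) × t ≤ τ + total k c h)
  assembled zero u {g} {W} {c} trails with lift-trail (trails zero) refl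
  ... | W′ , z , p , q , t with refl ← toℕ-injective q | starts t
  ...   | W″ , refl = W′ , W″ ++ (origin ∷ []) , p , refl
    , trans (Follows.length≡ (follows t {[]})) (+-identityʳ _)
    , λ { τ zero {v} i → let v′ , j , e = ∈-map⁻ toℕ (subst (toℕ v ∈ˡ_) (sym p) i)
                         in Follows.within (follows t {[]}) τ (subst (_∈ˡ W′) (sym (toℕ-injective e)) j) }
  assembled (suc k) u {g} {W} {c} trails with lift-trail (trails zero) refl
  ... | W′ , z , p , q , t
    with assembled k z {proj₂ g} {W ∘ suc} {c ∘ suc}
           (subst (λ a → ∀ h → Trail (proj₁ (get k (chainOf k o a (proj₂ g)) h)) (W (suc h))
                                     (proj₂ (get k (chainOf k o a (proj₂ g)) h)) (c (suc h))) (sym q) (trails ∘ suc))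
  ...   | w , T , p′ , e , len′ , vis with starts t
  ...     | W″ , refl = W′ ++ w , W″ ++ z ∷ T
    , trans (map-++ toℕ W′ w) (cong₂ _++_ p p′)
    , trans (++-assoc W′ w (origin ∷ [])) (cong (W′ ++_) e)
    , trans (Follows.length≡ fol) (cong (c zero +_) len′)
    , reached
    where
    fol : Follows (c zero) W′ (z ∷ T) (W′ ++ z ∷ T)
    fol = follows t {T}
    now : ∀ τ {v} → toℕ v ∈ˡ W zero → ∃[ t ] (v , t) ∈ˡ arrivals τ (W′ ++ z ∷ T) × t ≤ τ + c zero
    now τ {v} i = let v′ , j , e = ∈-map⁻ toℕ (subst (toℕ v ∈ˡ_) (sym p) i)
                  in Follows.within fol τ (subst (_∈ˡ W′) (sym (toℕ-injective e)) j)
    reached : ∀ τ h {v} → toℕ v ∈ˡ upTill (suc k) W h →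
              ∃[ t ] (v , t) ∈ˡ arrivals τ (W′ ++ z ∷ T) × t ≤ τ + total (suc k) c h
    reached τ zero    i = now τ i
    reached τ (suc h) i with ∈-++⁻ (W zero) i
    ... | inj₁ j = let t , a , b = now τ j in t , a , ≤-trans b (+-monoʳ-≤ τ (m≤m+n _ _))
    ... | inj₂ j = let t , a , b = vis (τ + c zero) h j
                   in t , Follows.after fol τ a , ≤-trans b (≤-reflexive (+-assoc τ _ _))

  Good-tour : List ℕ → Set
  Good-tour z = ∃[ tour ] IsSolution tour × o ∷ z ++ (o ∷ []) ≡ map toℕ tour

  to-solution : ∀ {g W c} →
    (∀ h → Trail (proj₁ (get k (chainOf k o o g) h)) (W h) (proj₂ (get k (chainOf k o o g) h)) (c h)) →
    (∀ h → total k c h ≤ len h) → (∀ h → num h ≤ sum< m (visits k W h)) → Good-tour (cat k W)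
  to-solution {g} {W} {c} trails in-time enough with assembled k origin {g} {W} {c} trails
  -- The walks already begin and end in the origin; listing it once more at both ends costs nothing
  -- and gives the required form.
  ... | w , T , p , e , length≡ , reached = origin ∷ w ++ (origin ∷ []) , record
    { closed = w , refl
    ; short  = ≤-trans (≤-reflexive (trans (cong (λ T → tourLength (origin ∷ T)) e)
                 (trans (cong (_+ tourLength (origin ∷ T)) (dist-self origin)) length≡))) (in-time (fromℕ k))
    ; visits = λ h → S h , S⊆V h
        , ≤-trans (enough h) (sum<-≤-card (S h) (seen-≤1 VL (upTill k W h)) (outside h))
        , λ {v} i → let t , a , b = reached 0 h (S-seen h i)
                in t , subst (λ T → (v , t) ∈ˡ arrivals 0 (origin ∷ T)) (sym e)
                         (there (subst (λ d → (v , t) ∈ˡ arrivals d (origin ∷ T)) (sym (dist-self origin)) a))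
                     , ≤-trans b (in-time h)
    } , cong (o ∷_) (sym (trans (map-++ toℕ w (origin ∷ [])) (cong (_++ (o ∷ [])) p)))
    where
    chosen : Fin (suc k) → Fin m → Bool
    chosen h v = does (v ∈? V) ∧ does (toℕ v ∈ˡ? upTill k W h)
    S : Fin (suc k) → Subset m
    S h = tabulateᵛ (chosen h)
    S-chosen : ∀ h {v} → v ∈ S h → chosen h v ≡ true
    S-chosen h {v} i = trans (sym (lookup∘tabulate (chosen h) v)) ([]=⇒lookup i)
    S⊆V : ∀ h → S h ⊆ˢ V
    S⊆V h {v} i with v ∈? V | S-chosen h i
    ... | yes j | _ = j
    S-seen : ∀ h {v} → v ∈ S h → toℕ v ∈ˡ upTill k W h
    S-seen h {v} i with v ∈? V | toℕ v ∈ˡ? upTill k W h | S-chosen h i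
    ... | yes _ | yes j | _ = j
    outside : ∀ h {v} → ¬ v ∈ S h → seen VL (upTill k W h) (toℕ v) ≡ 0
    outside h {v} n with toℕ v ∈ˡ? VL
    ... | no _  = refl
    ... | yes i = mark-no (upTill k W h) λ j → n (lookup⇒[]= v (S h) (trans (lookup∘tabulate (chosen h) v) (both-true i j)))
      where
      both-true : toℕ v ∈ˡ VL → toℕ v ∈ˡ upTill k W h → chosen h v ≡ true
      both-true i j with v ∈? V | toℕ v ∈ˡ? upTill k W h
      ... | yes _ | yes _ = refl
      ... | no n  | _     = contradiction (VL⁻ i) n
      ... | yes _ | no n  = contradiction j n

  -- From tours to trails

  join : ∀ {a b z U W c d} → Trail a U b c → Trail b W z d →
         ∃[ X ] Trail a X z (c + d) × (∀ {v} → v ∈ˡ U → v ∈ˡ X) × (∀ {v} → v ∈ˡ W → v ∈ˡ X)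
  join {W = W} stop t = W , t , (λ { (here refl) → trail-first t }) , id
  join (_∷_ {a = a} {w = w} l s) t =
    let X , q , i , j = join s t
    in a ∷ X , subst (Trail a (a ∷ X) _) (sym (+-assoc w _ _)) (l ∷ q)
     , (λ { (here refl) → here refl ; (there h) → there (i h) }) , there ∘ j

  leg : ∀ u v → ∃[ W ] Trail (toℕ u) W (toℕ v) (dist u v)
  leg u v = let q , e = tree-path grown all u v
            in _ , subst (Trail _ _ _) (cong weight e) (trail q)

  data Ends : List (Fin m) → Set where
    end  : Ends (origin ∷ [])
    more : ∀ {u v us} → Ends (v ∷ us) → Ends (u ∷ v ∷ us)

  ends-snoc : ∀ u us → Ends (u ∷ us ++ (origin ∷ []))
  ends-snoc u []       = more end
  ends-snoc u (v ∷ us) = more (ends-snoc v us)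

  arrive-late : ∀ τ us {e} → e ∈ˡ arrivals τ us → τ ≤ proj₂ e
  arrive-late τ (u ∷ [])     (here refl) = ≤-refl
  arrive-late τ (u ∷ v ∷ us) (here refl) = ≤-refl
  arrive-late τ (u ∷ v ∷ us) (there i)   = ≤-trans (m≤m+n τ _) (arrive-late _ (v ∷ us) i)

  -- A segment ends at the last stop reached in time, so that positions inside
  -- an edge do not occur.
  record Prefix (ℓ τ : ℕ) (u : Fin m) (us : List (Fin m)) : Set where
    field
      {last}   : Fin m
      {rest}   : List (Fin m)
      {walked} : List ℕ
      {spent}  : ℕ
      travel   : Trail (toℕ u) walked (toℕ last) spent
      in-time  : τ + spent ≤ ℓ
      ending   : Ends (last ∷ rest)
      length≡  : tourLength (u ∷ us) ≡ spent + tourLength (last ∷ rest)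
      early    : ∀ {y t} → (y , t) ∈ˡ arrivals τ (u ∷ us) → t ≤ ℓ → toℕ y ∈ˡ walked
      anytime  : ∀ {y t} → (y , t) ∈ˡ arrivals τ (u ∷ us) → toℕ y ∈ˡ walked ⊎ (y , t) ∈ˡ arrivals (τ + spent) (last ∷ rest)

  -- The segment is extended while the next arrival is within `ℓ`. Arrival times never decrease, so
  -- behind the first late stop all stops are late.
  prefix : ∀ ℓ τ u us → Ends (u ∷ us) → τ ≤ ℓ → Prefix ℓ τ u us
  prefix ℓ τ u [] e le = record
    { travel  = stop
    ; in-time = ≤-trans (≤-reflexive (+-identityʳ τ)) le
    ; ending  = e
    ; length≡ = refl
    ; early   = λ { (here refl) _ → here refl }
    ; anytime = λ { (here refl) → inj₁ (here refl) }
    }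
  prefix ℓ τ u (v ∷ us) (more e) le with τ + dist u v ≤? ℓ
  ... | no n  = record
    { travel  = stop
    ; in-time = ≤-trans (≤-reflexive (+-identityʳ τ)) le
    ; ending  = more e
    ; length≡ = refl
    ; early   = λ { (here refl) _ → here refl ; (there i) b → contradiction (≤-trans (arrive-late _ (v ∷ us) i) b) n }
    ; anytime = λ {y} {t} i → inj₂ (subst (λ τ → (y , t) ∈ˡ arrivals τ (u ∷ v ∷ us)) (sym (+-identityʳ τ)) i)
    }
  ... | yes le′ =
    let U , s = leg u v
        X , q , i , j = join s (Prefix.travel later)
    in record
    { travel  = q
    ; in-time = ≤-trans (≤-reflexive (sym (+-assoc τ _ _))) (Prefix.in-time later)
    ; ending  = Prefix.ending later
    ; length≡ = trans (cong (dist u v +_) (Prefix.length≡ later)) (sym (+-assoc (dist u v) _ _))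
    ; early   = λ { (here refl) _ → i (trail-first s) ; (there h) b → j (Prefix.early later h b) }
    ; anytime = λ { (here refl) → inj₁ (i (trail-first s))
                  ; (there h) → map-⊎ j shift (Prefix.anytime later h) }
    }
    where
    later : Prefix ℓ (τ + dist u v) v us
    later = prefix ℓ (τ + dist u v) v us e le′
    shift : ∀ {e} → e ∈ˡ arrivals (τ + dist u v + Prefix.spent later) (Prefix.last later ∷ Prefix.rest later) →
            e ∈ˡ arrivals (τ + (dist u v + Prefix.spent later)) (Prefix.last later ∷ Prefix.rest later)
    shift {e} = subst (λ τ → e ∈ˡ arrivals τ (Prefix.last later ∷ Prefix.rest later)) (+-assoc τ _ _)

  complete-leg : ∀ τ u us → Ends (u ∷ us) →
                 ∃[ W ] Trail (toℕ u) W o (tourLength (u ∷ us)) × (∀ {y t} → (y , t) ∈ˡ arrivals τ (u ∷ us) → toℕ y ∈ˡ W)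
  complete-leg τ u [] end = _ , stop , λ { (here refl) → here refl }
  complete-leg τ u (v ∷ us) (more e) =
    let U , s = leg u v
        W , t , h = complete-leg (τ + dist u v) v us e
        X , q , i , j = join s t
    in X , q , λ { (here refl) → i (trail-first s) ; (there a) → j (h a) }

  record Legs (k : ℕ) (len : Fin (suc k) → ℕ) (τ : ℕ) (u : Fin m) (us : List (Fin m)) : Set where
    field
      {guess}   : ⟦ Tup k nat ⟧
      {W}       : Fin (suc k) → List ℕ
      {c}       : Fin (suc k) → ℕ
      trails    : ∀ h → Trail (proj₁ (get k (chainOf k o (toℕ u) guess) h)) (W h)
                              (proj₂ (get k (chainOf k o (toℕ u) guess) h)) (c h)
      in-time   : ∀ h → τ + total k c h ≤ len h
      on-time   : ∀ h {y t} → (y , t) ∈ˡ arrivals τ (u ∷ us) → t ≤ len h → toℕ y ∈ˡ upTill k W h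
      bounded   : ∀ h → get k guess h < m

  -- All segments but the last are split off by `prefix`; the last takes the rest of the tour, which
  -- the total length keeps within its limit. Monotone limits ensure that each segment starts in
  -- time.
  legs : ∀ k {len} → (∀ {g h} → g Data.Fin.≤ h → len g ≤ len h) → ∀ τ u us → Ends (u ∷ us) →
         τ ≤ len zero → τ + tourLength (u ∷ us) ≤ len (fromℕ k) → Legs k len τ u us
  legs zero mono τ u us e le short =
    let W , t , h = complete-leg τ u us e
    in record
    -- The last component of a guess is ignored by `chainOf`, so any vertex would do.
    { guess   = o
    ; W       = λ _ → W
    ; c       = λ _ → tourLength (u ∷ us)
    ; trails  = λ { zero → t }
    ; in-time = λ { zero → short }
    ; on-time = λ { zero i _ → h i }
    ; bounded = λ { zero → toℕ<n origin }
    }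
  legs (suc k) {len} mono τ u us e le short = record
    { guess   = toℕ last , Legs.guess later
    ; W       = λ { zero → walked ; (suc h) → Legs.W later h }
    ; c       = λ { zero → spent ; (suc h) → Legs.c later h }
    ; trails  = λ { zero → travel ; (suc h) → Legs.trails later h }
    ; in-time = λ { zero → in-time
                  ; (suc h) → ≤-trans (≤-reflexive (sym (+-assoc τ _ _))) (Legs.in-time later h) }
    ; on-time = λ { zero i b → early i b
                  ; (suc h) i b → [ ∈-++⁺ˡ , (λ j → ∈-++⁺ʳ walked (Legs.on-time later h j b)) ] (anytime i) }
    ; bounded = λ { zero → toℕ<n last ; (suc h) → Legs.bounded later h }
    }
    where
    open Prefix (prefix (len zero) τ u us e le)
    later : Legs k (len ∘ suc) (τ + spent) last rest
    later = legs k (λ g≤h → mono (s≤s g≤h)) (τ + spent) last rest ending (≤-trans in-time (mono z≤n))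
      (≤-trans (≤-reflexive (trans (+-assoc τ _ _) (cong (τ +_) (sym length≡)))) short)

  from-solution : ∀ {tour} → IsSolution tour →
    ∃[ g ] ∃[ W ] ∃[ c ]
      (∀ h → get k g h < m) ×
      (∀ h → Trail (proj₁ (get k (chainOf k o o g) h)) (W h) (proj₂ (get k (chainOf k o o g) h)) (c h)) ×
      (∀ h → total k c h ≤ len h) × (∀ h → num h ≤ sum< m (visits k W h))
  from-solution {tour} sol with IsSolution.closed sol
  ... | stops , refl = _ , _ , _ , Legs.bounded L , Legs.trails L , Legs.in-time L , enough
    where
    L : Legs k len 0 origin (stops ++ (origin ∷ []))
    L = legs k len-mono 0 origin _ (ends-snoc origin stops) z≤n (IsSolution.short sol)
    enough : ∀ h → num h ≤ sum< m (visits k (Legs.W L) h)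
    enough h with IsSolution.visits sol h
    ... | S , S⊆V , n≤ , vis = ≤-trans n≤ (card-≤-sum< S λ {v} i →
      let t , a , b = vis i in
      ≤-reflexive (sym (trans (when-yes (toℕ v ∈ˡ? VL) (VL⁺ (S⊆V i))) (mark-yes (upTill k (Legs.W L) h) (Legs.on-time L h a b)))))

-- The search over all guesses.

module Solver {k : ℕ} (I : Instance k) (M : ℕ) (light : ∀ {u v w} → (u , v , w) ∈ˡ Instance.E I → w ≤ M)
              (N : ℕ) (1≤N : 1 ≤ N) (room : Room k (Instance.m I) M N)
              (edge-room : Instance.m I * Instance.m I ≤ N) (guess-room : Instance.m I ^ suc k ≤ N)
              (tour-room : suc k * (2 * Instance.m I) ≤ N) where
  open Instance I
  open Tree isTree
  open TupleProcedures N 1≤N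

  private
    o : ℕ
    o = toℕ origin

    VL : List ℕ
    VL = map toℕ (filter (_∈? V) (allFin m))

    m≤N : m ≤ N
    m≤N = ≤-trans (m≤m+n m _) (Room.double room)

    VL≤N : length VL ≤ N
    VL≤N = ≤-trans (≤-reflexive (length-map toℕ (filter (_∈? V) (allFin m))))
      (≤-trans (length-filter (_∈? V) (allFin m)) (≤-trans (≤-reflexive (length-tabulate {n = m} id)) m≤N))

    E≤N : length E³ ≤ N
    E≤N = ≤-trans (≤-reflexive (length-map enc E)) (≤-trans length-E edge-room)

    light-link : ∀ {u v} (l : Link E u v) → linkWeight l ≤ M
    light-link (forward i)  = light i
    light-link (backward i) = light i

  Answer : List ℕ → Set
  Answer out = ∃[ tour ] IsSolution tour × out ≡ map toℕ tour

  module Searching {vs : List ℕ} {R : List E3} (grown : Grown E³ o vs R) (reach : ∀ {v} → Reach E³ o m v → v ∈ˡ vs)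
                   {lims : ⟦ Tup k (nat ⊗ nat) ⟧} (lims≡ : ∀ h → get k lims h ≡ (len h , num h)) where
    open Growth-facts {E³} {o}
    private
      all : ∀ {v} → v < m → v ∈ˡ vs
      all l = reach (reachable origin l)

      rooted : Rooted m M o vs R
      rooted = record
        { valid     = valid grown
        ; edge      = λ i → let x∈ , p∈ , l = edges grown i in x∈ , p∈ , weight≤ l
        ; vertex    = vertex (toℕ<n origin) ends grown
        ; all       = all
        ; root∈     = root∈ grown
        ; covers    = covers grown
        ; length-vs = length-vs (toℕ<n origin) ends grown
        ; length-R  = length-R (toℕ<n origin) ends grown
        }
        where
        weight≤ : ∀ {a b w} → Link³ E³ a b w → w ≤ M
        weight≤ l with dec-link l
        ... | _ , _ , l′ , _ , _ , refl = light-link l′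

      module Guess (g : ⟦ Tup k nat ⟧) = Run N 1≤N k m M o vs R rooted VL VL≤N room (chainOf k o o g) lims

    open Solutions I grown all using (Good-tour; to-solution; from-solution)

    chain∈ : ∀ k {s g} → s ∈ˡ vs → (∀ h → get k g h ∈ˡ vs) → ∀ h →
             proj₁ (get k (chainOf k o s g) h) ∈ˡ vs × proj₂ (get k (chainOf k o s g) h) ∈ˡ vs
    chain∈ zero    i j zero    = i , root∈ grown
    chain∈ (suc k) i j zero    = i , j zero
    chain∈ (suc k) i j (suc h) = chain∈ k (j zero) (j ∘ suc) h

    Feasible : ⟦ Tup k nat ⟧ → (Fin (suc k) → List ℕ) → (Fin (suc k) → ℕ) → Set
    Feasible g = Guess.Feasible g

    -- The bound on `length z` pays for the last concatenation, which folds over the tour found.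
    Searched : List ⟦ Tup k nat ⟧ → List (List ℕ) → Set
    Searched gs r = (∀ {z} → z ∈ˡ r → Good-tour z × length z ≤ N) ×
                    (∀ {g W c} → g ∈ˡ gs → Feasible g W c → ∃[ z ] z ∈ˡ r)

    found : ∀ {g z} → Guess.Tour g z → Good-tour z × length z ≤ N
    found {g} (W , c , f , refl , l) =
      to-solution {g} {W} {c} (Guess.Feasible.trail f)
        (λ h → ≤-trans (Guess.Feasible.in-time f h) (≤-reflexive (cong proj₁ (lims≡ h))))
        (λ h → ≤-trans (≤-reflexive (cong proj₂ (sym (lims≡ h)))) (Guess.Feasible.enough f h)) ,
      ≤-trans l tour-room

    guess-exists : ∀ {gs r tour} → (∀ {g} → (∀ h → get k g h ∈ˡ vs) → g ∈ˡ gs) → Searched gs r → IsSolution tour → ∃[ z ] z ∈ˡ r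
    guess-exists complete (_ , cmp) sol =
      let g , W , c , small , trails , in-time , enough = from-solution sol
      in cmp {g} {W} {c} (complete (λ h → all (small h))) (record
           { trail   = trails
           ; in-time = λ h → ≤-trans (in-time h) (≤-reflexive (cong proj₁ (sym (lims≡ h))))
           ; enough  = λ h → ≤-trans (≤-reflexive (cong proj₂ (lims≡ h))) (enough h)
           })

    search-wp : ∀ {g gs r} → (∀ h → get k g h ∈ˡ vs) → Searched gs r →
      WP (run k) ((R , vs , VL , o , lims , g) ∷ [])
        (λ r′ → (r′ ≡ [] → Searched (g ∷ gs) r) × (∀ z zs → r′ ≡ z ∷ zs → Searched (g ∷ gs) (z ∷ [])))
    search-wp {g} g∈ (snds , cmp) = wp-conseq
      (Guess.run-wp g (λ h → proj₁ (chain∈ k (root∈ grown) g∈ h)) (λ h → proj₂ (chain∈ k (root∈ grown) g∈ h)) refl)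
      λ r′ (rs , rc) →
        (λ { refl → snds , λ { (here refl) f → contradiction (proj₂ (rc f)) (λ ()) ; (there i) f → cmp i f } }) ,
        (λ { z zs refl → (λ { (here refl) → found {g} (rs (here refl)) }) , λ _ _ → z , here refl })

  solver-wp : WP (solver k) (encode I ∷ []) (λ out → (∃[ tour ] IsSolution tour) → Answer out)
  solver-wp =
    wp-let (wp-call (wp-flat (wp-conseq
      (Discovery.growAll-wp N 1≤N {E³} {o} {m} m≤N E≤N (toℕ<n origin) ends) λ { (vs , R) (grown , reach) →
    wp-let (wp-call (wp-flat (wp-conseq (fromList-wp k (λ h → len h , num h)) λ lims lims≡ →
    wp-let (wp-call (wp-flat (wp-conseq
      (tuples-wp k {vs} (∈-length (Growth-facts.root∈ grown))
        (≤-trans (^-monoˡ-≤ (suc k) (Growth-facts.length-vs (toℕ<n origin) ends grown)) guess-room)) λ gs (lg , gsnd , gcmp) →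
    let open Searching grown reach {lims} lims≡ in
    wp-case (wp-fold Searched
      (wp-flat ( ≤-trans lg (≤-trans (^-monoˡ-≤ (suc k) (Growth-facts.length-vs (toℕ<n origin) ends grown)) guess-room)
      , wp-flat ((λ ()) , (λ ()))
      , (λ { zs g ys r split done → wp-case (wp-call (wp-flat (wp-conseq
          (search-wp {g} (gsnd (subst (g ∈ˡ_) split (∈-++⁺ʳ zs (here refl)))) done)
          λ r′ (empty , one) → (λ e → wp-flat (empty e)) , (λ z zs e → wp-flat (one z zs e))))) })
      , (λ r done →
          (λ { refl → wp-flat (λ (tour , sol) → contradiction (proj₂ (guess-exists gcmp done sol)) (λ ())) }) ,
          (λ { z zs refl → let (tour , sol , e) , l = proj₁ done (here refl) in
               wp-cons (wp-flat (wp-append (wp-flat (l , wp-flat (λ _ → tour , sol , e))))) }))))))))))) })))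

-- The explicit polynomial bound.

-- As `y` is at least 1, its power `length p` dominates every monomial, and the coefficients can be
-- summed.
evalPoly-≤ : ∀ p {x y} → x ≤ y → 1 ≤ y → evalPoly p x ≤ sum p * y ^ length p
evalPoly-≤ []      x≤y 1≤y = z≤n
evalPoly-≤ (a ∷ p) {x} {y} x≤y 1≤y = begin
  a + x * evalPoly p x                        ≤⟨ +-mono-≤ (≤-trans (≤-reflexive (sym (*-identityʳ a))) (*-monoʳ-≤ a (m^n>0 y ⦃ >-nonZero 1≤y ⦄ (suc (length p)))))
                                                          (*-mono-≤ x≤y (evalPoly-≤ p x≤y 1≤y)) ⟩
  a * y ^ suc (length p) + y * (sum p * y ^ length p) ≡⟨ arith a y (sum p) (y ^ length p) ⟩
  (a + sum p) * y ^ suc (length p)            ∎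
  where
  open ≤-Reasoning
  arith : ∀ a y s q → a * (y * q) + y * (s * q) ≡ (a + s) * (y * q)
  arith = solve-∀

keyCount : ℕ → ℕ → ℕ
keyCount m M = 2 * (suc (2 * M * m) * suc m)

module Sizes (k m M : ℕ) (1≤m : 1 ≤ m) where
  box : ℕ
  box = boxSize k m M

  -- Candidates pair two entries of the table, hence the square.
  N : ℕ
  N = box * box

  private
    instance
      m≢0 : NonZero m
      m≢0 = >-nonZero 1≤m

  2m≤base : 2 * m ≤ keyCount m M
  2m≤base = *-monoʳ-≤ 2 (≤-trans (n≤1+n m) (m≤n*m (suc m) (suc (2 * M * m))))

  m≤base : m ≤ keyCount m M
  m≤base = ≤-trans (m≤m+n m _) 2m≤base

  2≤base : 2 ≤ keyCount m M
  2≤base = ≤-trans (*-monoʳ-≤ 2 1≤m) 2m≤base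

  base≤power : keyCount m M ≤ keyCount m M ^ suc k
  base≤power = m≤m*n (keyCount m M) (keyCount m M ^ k) ⦃ m^n≢0 (keyCount m M) k ⦃ >-nonZero (≤-trans (s≤s z≤n) 2≤base) ⦄ ⦄

  power≤box : keyCount m M ^ suc k ≤ box
  power≤box = m≤n*m _ m

  1≤box : 1 ≤ box
  1≤box = ≤-trans (≤-trans (s≤s z≤n) 2≤base) (≤-trans base≤power power≤box)

  box≤N : box ≤ N
  box≤N = m≤m*n box box ⦃ >-nonZero 1≤box ⦄

  1≤N : 1 ≤ N
  1≤N = ≤-trans 1≤box box≤N

  room : Room k m M N
  room = record
    { double = ≤-trans 2m≤base (≤-trans base≤power (≤-trans power≤box box≤N))
    ; box    = box≤N
    ; square = ≤-refl
    ; start  = *-monoʳ-≤ m (^-monoˡ-≤ (suc k) 2≤base)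
    }

  edge-room : m * m ≤ N
  edge-room = ≤-trans (*-monoʳ-≤ m (≤-trans m≤base base≤power)) box≤N

  guess-room : m ^ suc k ≤ N
  guess-room = ≤-trans (^-monoˡ-≤ (suc k) m≤base) (≤-trans power≤box box≤N)

  suc≤2^ : ∀ k → suc k * 2 ≤ 2 ^ suc k
  suc≤2^ zero    = ≤-refl
  suc≤2^ (suc k) = begin
    2 + suc k * 2            ≤⟨ +-mono-≤ (m≤m*n 2 (2 ^ k) ⦃ m^n≢0 2 k ⦄) (suc≤2^ k) ⟩
    2 ^ suc k + 2 ^ suc k    ≡⟨ cong (2 ^ suc k +_) (sym (+-identityʳ _)) ⟩
    2 ^ suc (suc k)          ∎
    where open ≤-Reasoning

  tour-room : suc k * (2 * m) ≤ N
  tour-room = begin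
    suc k * (2 * m)  ≡⟨ sym (*-assoc (suc k) 2 m) ⟩
    suc k * 2 * m    ≡⟨ *-comm (suc k * 2) m ⟩
    m * (suc k * 2)  ≤⟨ *-monoʳ-≤ m (suc≤2^ k) ⟩
    m * 2 ^ suc k    ≤⟨ Room.start room ⟩
    box              ≤⟨ box≤N ⟩
    N                ∎
    where open ≤-Reasoning

^-distribʳ-* : ∀ n a b → (a * b) ^ n ≡ a ^ n * b ^ n
^-distribʳ-* zero    a b = refl
^-distribʳ-* (suc n) a b = trans (cong (a * b *_) (^-distribʳ-* n a b)) (arith a b (a ^ n) (b ^ n))
  where
  arith : ∀ a b c d → a * b * (c * d) ≡ a * c * (b * d)
  arith = solve-∀

-- With weights at most A mᵉ, the table has at most (4 (2 A + 1))ᴷ m^((e + 3) K) entries.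
module Growth-of-box (k A e m M : ℕ) (1≤m : 1 ≤ m) (M≤ : M ≤ A * m ^ e) where
  B : ℕ
  B = 4 * suc (2 * A)

  private
    instance
      m≢0 : NonZero m
      m≢0 = >-nonZero 1≤m

  base≤ : keyCount m M ≤ B * m ^ (2 + e)
  base≤ = begin
    2 * (suc (2 * M * m) * suc m)
      ≤⟨ *-monoʳ-≤ 2 (*-mono-≤ (s≤s (*-monoˡ-≤ m (*-monoʳ-≤ 2 M≤))) (+-monoˡ-≤ m 1≤m)) ⟩
    2 * (suc (2 * (A * m ^ e) * m) * (m + m))
      ≤⟨ *-monoʳ-≤ 2 (*-monoˡ-≤ (m + m) (+-monoˡ-≤ (2 * (A * m ^ e) * m) (m^n>0 m (suc e)))) ⟩
    2 * ((m * m ^ e + 2 * (A * m ^ e) * m) * (m + m))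
      ≡⟨ arith A m (m ^ e) ⟩
    4 * suc (2 * A) * (m * (m * m ^ e)) ∎
    where
    open ≤-Reasoning
    arith : ∀ A m q → 2 * ((m * q + 2 * (A * q) * m) * (m + m)) ≡ 4 * (1 + 2 * A) * (m * (m * q))
    arith = solve-∀

  box≤ : boxSize k m M ≤ B ^ suc k * m ^ ((3 + e) * suc k)
  box≤ = begin
    m * keyCount m M ^ suc k
      -- The factor `m` for the vertex of an entry is enlarged to `m ^ suc k`, so that the whole
      -- exponent becomes a multiple of `suc k`.
      ≤⟨ *-mono-≤ (m≤m*n m (m ^ k) ⦃ m^n≢0 m k ⦄) (^-monoˡ-≤ (suc k) base≤) ⟩
    m ^ suc k * (B * m ^ (2 + e)) ^ suc k
      ≡⟨ cong (m ^ suc k *_) (^-distribʳ-* (suc k) B (m ^ (2 + e))) ⟩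
    m ^ suc k * (B ^ suc k * (m ^ (2 + e)) ^ suc k)
      ≡⟨ cong (λ q → m ^ suc k * (B ^ suc k * q)) (^-*-assoc m (2 + e) (suc k)) ⟩
    m ^ suc k * (B ^ suc k * m ^ ((2 + e) * suc k))
      ≡⟨ arith (m ^ suc k) (B ^ suc k) (m ^ ((2 + e) * suc k)) ⟩
    B ^ suc k * (m ^ suc k * m ^ ((2 + e) * suc k))
      ≡⟨ cong (B ^ suc k *_) (sym (^-distribˡ-+-* m (suc k) ((2 + e) * suc k))) ⟩
    B ^ suc k * m ^ ((3 + e) * suc k) ∎
    where
    open ≤-Reasoning
    arith : ∀ a b c → a * (b * c) ≡ b * (a * c)
    arith = solve-∀

  -- The power 5 is the nesting depth of the solver; the square in `N` turns it into 10.
  N≤ : (boxSize k m M * boxSize k m M) ^ 5 ≤ (B ^ suc k) ^ 10 * m ^ ((3 + e) * 10 * suc k)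
  N≤ = begin
    (boxSize k m M * boxSize k m M) ^ 5
      ≡⟨ cong (λ q → (boxSize k m M * q) ^ 5) (sym (*-identityʳ (boxSize k m M))) ⟩
    (boxSize k m M ^ 2) ^ 5
      ≡⟨ ^-*-assoc (boxSize k m M) 2 5 ⟩
    boxSize k m M ^ 10
      ≤⟨ ^-monoˡ-≤ 10 box≤ ⟩
    (B ^ suc k * m ^ ((3 + e) * suc k)) ^ 10
      ≡⟨ ^-distribʳ-* 10 (B ^ suc k) (m ^ ((3 + e) * suc k)) ⟩
    (B ^ suc k) ^ 10 * (m ^ ((3 + e) * suc k)) ^ 10
      ≡⟨ cong ((B ^ suc k) ^ 10 *_) (^-*-assoc m ((3 + e) * suc k) 10) ⟩
    (B ^ suc k) ^ 10 * m ^ ((3 + e) * suc k * 10)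
      ≡⟨ cong (λ d → (B ^ suc k) ^ 10 * m ^ d) (arith (3 + e) (suc k)) ⟩
    (B ^ suc k) ^ 10 * m ^ ((3 + e) * 10 * suc k) ∎
    where
    open ≤-Reasoning
    arith : ∀ a b → a * b * 10 ≡ a * 10 * b
    arith = solve-∀

mainTheorem3 : (p : Polynomial) →
    ∃[ c ] ((k : ℕ) →
    Σ[ A ∈ Program ] ∃[ a ] ((I : Instance k) → WeightsBoundedBy p I →
    Solves A I × RunsInTime A (λ m → a * m ^ (c * suc k)) I))
-- `3 + length p` is the exponent per segment in the table size, and 10 is twice the nesting depth;
-- neither depends on `k`.
mainTheorem3 p = (3 + length p) * 10 , λ k →
  solver k , coef (solver k) * ((4 * suc (2 * sum p)) ^ suc k) ^ 10 , λ I light →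
    let open Instance I using (m; n; V)
        M = evalPoly p n
        -- Weights are bounded in terms of `n`, the time in terms of `m`; the `n + 1` points are
        -- vertices, which compares the two.
        1+n≤m = ≤-trans (≤-reflexive (sym (Instance.size I))) (∣p∣≤n V)
        1≤m = ≤-trans (s≤s z≤n) 1+n≤m
        module S = Sizes k m M 1≤m
        module G = Growth-of-box k (sum p) (length p) m M 1≤m (evalPoly-≤ p (≤-trans (n≤1+n n) 1+n≤m) 1≤m)
        module L = Logic S.N S.1≤N
        w = Solver.solver-wp I M light S.N S.1≤N S.room S.edge-room S.guess-room S.tour-room
    in L.WP.post w , (begin
         time (solver k) I
           ≤⟨ L.WP.cheap w ⟩
         coef (solver k) * S.N ^ depth (solver k)
           ≡⟨ cong (λ d → coef (solver k) * S.N ^ d) (solver-depth k) ⟩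
         coef (solver k) * S.N ^ 5
           ≤⟨ *-monoʳ-≤ (coef (solver k)) G.N≤ ⟩
         coef (solver k) * (((4 * suc (2 * sum p)) ^ suc k) ^ 10 * m ^ ((3 + length p) * 10 * suc k))
           ≡⟨ sym (*-assoc (coef (solver k)) (((4 * suc (2 * sum p)) ^ suc k) ^ 10) (m ^ ((3 + length p) * 10 * suc k))) ⟩
         coef (solver k) * ((4 * suc (2 * sum p)) ^ suc k) ^ 10 * m ^ ((3 + length p) * 10 * suc k) ∎)
  where open ≤-Reasoning
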